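{- Let $k\ge3$ and let $\mathbf F$ be a $k$-CNF formula on $n$ variables. There exists a randomized algorithm that takes $\mathbf F$ and an integer $s\ge1$ as input and, if $\mathbf F$ is satisfiable and has at least $s$ satisfying assignments, with probability at least $1-o(1)$ outputs a set $S^*\subseteq\Omega_{\mathbf F}$ of size $s$ such that: 1. $\mathrm{sumPD}(S^*)\ge\frac12\left(1-\frac{2}{k+1}\right)\cdot\mathrm{OptSum}_{\ne}(\mathbf F,s)$ if $s\le\left\lfloor\frac{3k+1}{k-1}\right\rfloor$; 2. $\mathrm{sumPD}(S^*)\ge\frac{k-1}{k+3}\left(\frac{1-\frac1s}{1+\frac{k-1}{k+3}\cdot\frac1s}\right)\cdot\mathrm{OptSum}_{\ne}(\mathbf F,s)$ if $s\ge\left\lceil\frac{3k+1}{k-1}\right\rceil$. The algorithm runs in time $O^*\left(2^{n-n/k+o(n)}\right)$, as long as $s=o\left(\frac{n}{\log n}\right)$.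
   Context: $\Omega_{\mathbf F}\subseteq\{0,1\}^n$ is the set of satisfying assignments of $\mathbf F$; $d_H$ is Hamming distance. For a set $S\subseteq\{0,1\}^n$, $\mathrm{sumPD}(S)=\frac12\sum_{z_1,z_2\in S}d_H(z_1,z_2)$ (sum over ordered pairs), and $\mathrm{OptSum}_{\neq}(\mathbf F,s)$ is the maximum of $\mathrm{sumPD}(S)$ over sets $S$ of $s$ distinct satisfying assignments of $\mathbf F$. A $k$-CNF formula is a conjunction of clauses, each a disjunction of at most $k$ literals; formulas have $n^{O(1)}$ clauses. $k$ is a constant and $O^*$ hides factors polynomial in $n$; $o(\cdot)$ is as $n\to\infty$. -}

module Defs where

open import Data.Bool.Base using (Bool; true; false; if_then_else_)
import Data.Bool.Properties as Bool
open import Data.Fin.Base using (Fin; toℕ)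
open import Data.Integer.Base using (+_)
import Data.Integer.Base as ℤ
import Data.Integer.Properties as ℤ
open import Data.List.Base using (List; []; _∷_; _++_; map; filter; length; foldr; cartesianProductWith)
open import Data.List.Relation.Unary.All using (All; all?)
open import Data.List.Relation.Unary.Any using (Any; any?)
import Data.List.Relation.Unary.Unique.DecPropositional as DecUnique
open import Data.List.Relation.Unary.Unique.Propositional using (Unique)
open import Data.Maybe using (Maybe; just; nothing; Is-just)
import Data.Maybe.Relation.Unary.Any as Maybe
open import Data.Nat.Base using (ℕ; zero; suc; _^_; _∸_; _≤_; NonZero; s≤s)
import Data.Nat.Base as ℕ
import Data.Nat.Properties as ℕ
open import Data.Nat.ListAction using (sum)
open import Data.Product.Base using (_×_; _,_; ∃-syntax)
open import Data.Rational.Base using (ℚ; 0ℚ; 1ℚ; ½; _/_; _+_; _-_; _*_; _÷_; _⊔_; _≥_; floor; ceiling)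
import Data.Rational.Base as ℚ
import Data.Rational.Properties as ℚ
open import Data.Vec.Base using (Vec; []; _∷_; lookup; zip; count; toList)
import Data.Vec.Properties as Vec
open import Level using (0ℓ)
open import Relation.Binary.PropositionalEquality using (_≡_)
open import Relation.Nullary using (Dec; ¬?)
open import Relation.Nullary.Decidable using (_×-dec_; _→-dec_)
open import Relation.Unary using (Pred; Decidable)

------------------------------------------------------------------------
-- CNF formulas

Assignment : ℕ → Set
Assignment n = Vec Bool n

-- (x , b) is satisfied when variable x takes the value b, so
-- (x , true) is the literal x and (x , false) its negation.
Literal Clause CNF : ℕ → Set
Literal n = Fin n × Bool
Clause  n = List (Literal n)
CNF     n = List (Clause n)

_IsCNFOfWidth_ : ∀ {n} → CNF n → ℕ → Set
F IsCNFOfWidth k = All (λ C → length C ≤ k) F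

_⊨_ : ∀ {n} → Assignment n → CNF n → Set
z ⊨ F = All (Any (λ (x , b) → lookup z x ≡ b)) F

_⊨?_ : ∀ {n} (z : Assignment n) (F : CNF n) → Dec (z ⊨ F)
z ⊨? F = all? (any? (λ (x , b) → lookup z x Bool.≟ b)) F

Satisfiable : ∀ {n} → CNF n → Set
Satisfiable F = ∃[ z ] z ⊨ F

bitVectors : ∀ n → List (Vec Bool n)
bitVectors zero    = [] ∷ []
bitVectors (suc n) = cartesianProductWith _∷_ (false ∷ true ∷ []) (bitVectors n)

-- Ω F has no repetitions, so its length is the number of satisfying
-- assignments.
Ω : ∀ {n} → CNF n → List (Assignment n)
Ω {n} F = filter (_⊨? F) (bitVectors n)

------------------------------------------------------------------------
-- Sum of pairwise distances

dH : ∀ {n} → Assignment n → Assignment n → ℕ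
dH y z = count (λ (a , b) → ¬? (a Bool.≟ b)) (zip y z)

-- Finite sets are represented by lists without repetitions.
sumPD : ∀ {n} → List (Assignment n) → ℚ
sumPD S = ½ * (+ sum (cartesianProductWith dH S S) / 1)

subsetsOfSize : ∀ {A : Set} → ℕ → List A → List (List A)
subsetsOfSize zero    _        = [] ∷ []
subsetsOfSize (suc s) []       = []
subsetsOfSize (suc s) (x ∷ xs) = map (x ∷_) (subsetsOfSize s xs) ++ subsetsOfSize (suc s) xs

-- sumPD is nonnegative, so starting from 0 only matters when F has fewer
-- than s satisfying assignments.
OptSum≠ : ∀ {n} → CNF n → ℕ → ℚ
OptSum≠ F s = foldr _⊔_ 0ℚ (map sumPD (subsetsOfSize s (Ω F)))

------------------------------------------------------------------------
-- The approximation guarantee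

threshold : (k : ℕ) → 3 ≤ k → ℚ
threshold k 3≤k = + (3 ℕ.* k ℕ.+ 1) / (k ∸ 1)
  where instance _ = ℕ.>-nonZero (ℕ.m<n⇒0<n∸m (ℕ.<⇒≤ 3≤k))

ratioSmall : ℕ → ℚ
ratioSmall k = ½ * (1ℚ - + 2 / (1 ℕ.+ k))

β : ℕ → ℚ
β k = + (k ∸ 1) / (3 ℕ.+ k)

1+β/s≢0 : ∀ k s .{{_ : NonZero s}} → ℚ.NonZero (1ℚ + β k * (+ 1 / s))
1+β/s≢0 k s = ℚ.pos⇒nonZero (1ℚ + β k * (+ 1 / s)) {{positive}}
  where
  nonNegative : ℚ.NonNegative (β k * (+ 1 / s))
  nonNegative = ℚ.nonNeg*nonNeg⇒nonNeg (β k) {{ℚ.normalize-nonNeg (k ∸ 1) (3 ℕ.+ k)}}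
                                       (+ 1 / s) {{ℚ.normalize-nonNeg 1 s}}
  positive : ℚ.Positive (1ℚ + β k * (+ 1 / s))
  positive = ℚ.pos+nonNeg⇒pos 1ℚ (β k * (+ 1 / s)) {{nonNegative}}

ratioLarge : (k s : ℕ) .{{_ : NonZero s}} → ℚ
ratioLarge k s = β k * ((1ℚ - + 1 / s) ÷ (1ℚ + β k * (+ 1 / s)))
  where instance _ = 1+β/s≢0 k s

module _ (k : ℕ) (3≤k : 3 ≤ k) {n : ℕ} (F : CNF n) (s : ℕ) .{{_ : NonZero s}} where

  IsDiverse : Pred (List (Assignment n)) 0ℓ
  IsDiverse S =
      All (_⊨ F) S
    × Unique S
    × length S ≡ s
    × (+ s ℤ.≤ floor (threshold k 3≤k) → sumPD S ≥ ratioSmall k * OptSum≠ F s)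
    × (+ s ℤ.≥ ceiling (threshold k 3≤k) → sumPD S ≥ ratioLarge k s * OptSum≠ F s)

  isDiverse? : Decidable IsDiverse
  isDiverse? S =
          all? (_⊨? F) S
    ×-dec DecUnique.unique? (Vec.≡-dec Bool._≟_) S
    ×-dec (length S ℕ.≟ s)
    ×-dec ((_ ℤ.≤? _) →-dec (_ ℚ.≤? _))
    ×-dec ((_ ℤ.≤? _) →-dec (_ ℚ.≤? _))

------------------------------------------------------------------------
-- Randomized algorithms
--
-- Algorithms are programs of the WHILE language over binary trees (Jones,
-- "Computability and Complexity from a Programming Perspective"), extended
-- with a fair coin toss.  A step executes one command; the expressions in
-- it have a size fixed by the program, and trees are immutable and can be
-- shared, so a step amounts to a bounded number of pointer operations.
-- T steps of a random-access machine with logarithmically sized words cost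
-- T · (log T)^O(1) steps here and conversely, which for T = 2^O(n) is a
-- factor polynomial in n, as O* permits.

infixr 5 _∙_
data Tree : Set where
  nil : Tree
  _∙_ : Tree → Tree → Tree

left right : Tree → Tree
left  nil     = nil
left  (t ∙ _) = t
right nil     = nil
right (_ ∙ u) = u

isNode : Tree → Bool
isNode nil     = false
isNode (_ ∙ _) = true

data Expr : Set where
  var  : ℕ → Expr
  nil  : Expr
  cons : Expr → Expr → Expr
  hd   : Expr → Expr
  tl   : Expr → Expr

infixr 6 _⨾_
infix  7 _:=_
data Program : Set where
  _:=_ : ℕ → Expr → Program
  toss : ℕ → Program
  _⨾_  : Program → Program → Program
  cond : Expr → Program → Program → Program
  loop : Expr → Program → Program

Store : Set
Store = ℕ → Tree

update : ℕ → Tree → Store → Store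
update x t σ y = if x ℕ.≡ᵇ y then t else σ y

eval : Store → Expr → Tree
eval σ (var x)    = σ x
eval σ nil        = nil
eval σ (cons e f) = eval σ e ∙ eval σ f
eval σ (hd e)     = left (eval σ e)
eval σ (tl e)     = right (eval σ e)

-- The list holds the commands still to be executed.
Config : Set
Config = List Program × Store

encodeBool : Bool → Tree
encodeBool false = nil
encodeBool true  = nil ∙ nil

-- Every step is supplied with one fair coin, which only toss looks at.
step : Bool → Config → Config
step b ([]              , σ) = [] , σ
step b (x := e     ∷ ps , σ) = ps , update x (eval σ e) σ
step b (toss x     ∷ ps , σ) = ps , update x (encodeBool b) σ
step b ((p ⨾ q)    ∷ ps , σ) = p ∷ q ∷ ps , σ
step b (cond e p q ∷ ps , σ) = (if isNode (eval σ e) then p else q) ∷ ps , σ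
step b (loop e p   ∷ ps , σ) = (if isNode (eval σ e) then p ∷ loop e p ∷ ps else ps) , σ

steps : ∀ {t} → Vec Bool t → Config → Config
steps []      κ = κ
steps (b ∷ r) κ = steps r (step b κ)

-- Input and output are passed in variable 0; all other variables start
-- out as nil.
initial : Program → Tree → Config
initial p input = p ∷ [] , update 0 input (λ _ → nil)

output : Config → Maybe Tree
output ([]    , σ) = just (σ 0)
output (_ ∷ _ , _) = nothing

-- The result of running p for t steps on the coins r, nothing if it has not
-- halted by then.
run : ∀ {t} → Program → Tree → Vec Bool t → Maybe Tree
run p input r = output (steps r (initial p input))

HaltsWithin : Program → Tree → ℕ → Set
HaltsWithin p input t = (r : Vec Bool t) → Is-just (run p input r)

-- The probability of an event under t independent fair coins.
Pr : ∀ {t} {P : Pred (Vec Bool t) 0ℓ} → Decidable P → ℚ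
Pr {t} P? = + length (filter P? (bitVectors t)) / (2 ^ t)
  where instance 2^t≢0 : NonZero (2 ^ t)
                 2^t≢0 = ℕ.m^n≢0 2 t

------------------------------------------------------------------------
-- Encoding of inputs and outputs

encodeList : List Tree → Tree
encodeList = foldr _∙_ nil

-- Unary: variable indices are below n, and running times are only bounded
-- for s = o(n / log n), so binary notation would be at most polynomially
-- in n shorter.
encodeℕ : ℕ → Tree
encodeℕ zero    = nil
encodeℕ (suc m) = nil ∙ encodeℕ m

encodeLiteral : ∀ {n} → Literal n → Tree
encodeLiteral (x , b) = encodeℕ (toℕ x) ∙ encodeBool b

encodeCNF : ∀ {n} → CNF n → Tree
encodeCNF F = encodeList (map (λ C → encodeList (map encodeLiteral C)) F)

encodeInput : ∀ {n} → CNF n → ℕ → Tree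
encodeInput {n} F s = encodeℕ n ∙ encodeCNF F ∙ encodeℕ s

-- Every tree is read as a list of assignments.
decodeAssignment : ∀ n → Tree → Assignment n
decodeAssignment zero    _ = []
decodeAssignment (suc n) t = isNode (left t) ∷ decodeAssignment n (right t)

decodeAssignments : ∀ n → Tree → List (Assignment n)
decodeAssignments n nil     = []
decodeAssignments n (t ∙ u) = decodeAssignment n t ∷ decodeAssignments n u

module _ (k : ℕ) (3≤k : 3 ≤ k) {n : ℕ} (F : CNF n) (s : ℕ) .{{_ : NonZero s}} (p : Program) where

  Succeeds : ∀ {t} → Pred (Vec Bool t) 0ℓ
  Succeeds r = Maybe.Any (λ out → IsDiverse k 3≤k F s (decodeAssignments n out))
                         (run p (encodeInput F s) r)

  succeeds? : ∀ {t} → Decidable (Succeeds {t})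
  succeeds? r = Maybe.dec (λ out → isDiverse? k 3≤k F s (decodeAssignments n out)) _

------------------------------------------------------------------------
-- Asymptotics

_∈o_ : (ℕ → ℕ) → (ℕ → ℕ) → Set
f ∈o h = ∀ q → ∃[ N ] ∀ n → N ≤ n → q ℕ.* f n ≤ h n

{-# OPTIONS --safe #-}

-- Branching on falsified clauses explores the Hamming ball of radius r around
-- a centre a in about k ^ r steps, and can be made to avoid a small set Y of
-- solutions. If z is a solution outside Y and E is the set of r coordinates
-- in which a and z differ, it returns a solution c outside Y with
-- Σ d(c , y) ≥ W - 2 w(E), where w counts for each coordinate the members of
-- Y that differ from z there and W = Σ d(z , y) is the total weight. When
-- each coordinate is in E with probability 1 / (k + 1), then w(E) has mean
-- W / (k + 1), so by Markov's inequality at least a fraction 1 / (W + 1) of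
-- the patterns E have w(E) ≤ W / (k + 1), and for these c attains the distance
-- sum of z up to the factor 1 - 2 / (k + 1). As a pattern of size r has
-- likelihood proportional to k ^ -r, for some r about (2 k / (k + 1)) ^ n / k ^ r
-- uniformly random centres contain a good one, at total cost
-- (2 k / (k + 1)) ^ n ≤ 2 ^ (n - n / k). By a union bound over z and w the
-- same centres serve for all z and Y.
--
-- With this oracle a set S of s solutions is improved by single swaps until
-- no swap helps. Compare such an S with an optimal set O: summing the
-- optimality conditions bounds Σ d(o , x) over o in O and x in S by the
-- distance sum of S. The triangle inequality through the points of S then
-- gives the first ratio, and the fact that the Hamming metric is of negative
-- type gives the second one; both hold for every s.
module Submission where

open import Defs
open import Data.Bool.Base using (Bool; true; false; if_then_else_; not; T; _xor_; _∧_)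
import Data.Bool.Properties as BoolP
open import Data.Empty using (⊥-elim)
open import Data.Fin.Base using (Fin; zero; suc; toℕ; fromℕ<)
open import Data.Fin.Properties using (toℕ<n; toℕ-fromℕ<; fromℕ<-toℕ)
open import Data.Integer.Base using (+[1+_]) renaming (+_ to pos)
import Data.Integer.Base as ℤ
import Data.Integer.Properties as ℤP
open import Data.List.Base using (List; []; _∷_; _++_; [_]; map; length; foldl; foldr; filter; reverse; _ʳ++_; cartesianProductWith)
open import Data.List.Membership.Propositional using (_∈_; _∉_)
import Data.List.Membership.DecPropositional as DecMembership
open import Data.List.Membership.Propositional.Properties using (∈-filter⁺; ∈-filter⁻; ∈-∃++; ∈-++⁻; ∈-map⁻)
open import Data.List.Membership.Propositional.Properties.WithK using (unique∧set⇒bag)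
open import Data.List.Properties using (length-++; length-map; filter-++; ++-identityʳ; ++-assoc; unfold-reverse; reverse-involutive; map-++; length-reverse)
open import Data.List.Relation.Binary.BagAndSetEquality using (∼bag⇒↭)
open import Data.List.Relation.Binary.Permutation.Propositional using (_↭_; ↭⇒↭ₛ)
open import Data.List.Relation.Binary.Permutation.Propositional.Properties using (map⁺; ↭-length; All-resp-↭; ∈-resp-↭; ++-comm; shift)
import Data.List.Relation.Binary.Permutation.Setoid.Properties as PermSetoid
open import Data.List.Relation.Unary.All using (All; []; _∷_; universal)
import Data.List.Relation.Unary.All as AllP
open import Data.List.Relation.Unary.AllPairs using ([]; _∷_)
open import Data.List.Relation.Unary.Any using (Any; here; there)
open import Data.List.Relation.Unary.Unique.Propositional using (Unique)
import Data.List.Relation.Unary.Unique.Propositional.Properties as UniqueP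
open import Data.Maybe.Base using (Maybe; just; nothing)
import Data.Maybe.Relation.Unary.All as MaybeAll
open MaybeAll using (just; nothing)
import Data.Maybe.Relation.Unary.Any as MaybeAny
open MaybeAny using (just)
open import Data.Nat.Base using (ℕ; zero; suc; _+_; _*_; _^_; _∸_; _⊔_; _≤_; _<_; z≤n; s≤s; _≡ᵇ_; _≤ᵇ_; ⌈_/2⌉; ⌊_/2⌋; NonZero; >-nonZero; >-nonZero⁻¹; ≢-nonZero; ≢-nonZero⁻¹)
open import Data.Nat.DivMod using (_/_; _%_; m/n*n≤m; m%n<n; m≡m%n+[m/n]*n; m<n⇒m/n≡0; m/n≡1+[m∸n]/n; m/n≤m)
open import Data.Nat.ListAction using (sum)
open import Data.Nat.ListAction.Properties using (sum-++; sum-↭)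
open import Data.Nat.Logarithm using (⌈log₂_⌉; ⌈log₂⌉-mono-≤; ⌈log₂⌈n/2⌉⌉≡⌈log₂n⌉∸1)
open import Data.Nat.Properties
open import Data.Nat.Solver using (module +-*-Solver)
open +-*-Solver using (solve; con; _:+_; _:*_) renaming (_:=_ to _:≡_)
open import Data.Product.Base using (_×_; _,_; ∃-syntax; proj₁; proj₂)
open import Data.Rational.Base using (ℚ; 0ℚ; 1ℚ; ½; mkℚ; _-_) renaming (_<_ to _<ℚ_; _≥_ to _≥ℚ_; _/_ to _/ℚ_)
import Data.Rational.Base as ℚ
import Data.Rational.Properties as ℚP
open import Data.Rational.Unnormalised.Base using (mkℚᵘ; *≡*; *≤*)
import Data.Rational.Unnormalised.Properties as ℚᵘP
open import Data.Sum.Base using (_⊎_; inj₁; inj₂)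
open import Data.Unit.Base using (tt)
open import Data.Vec.Base using (Vec; []; _∷_; lookup; zipWith; replicate; toList; splitAt) renaming (_++_ to _++ᵛ_)
import Data.Vec.Base as Vec
import Data.Vec.Properties as VecP
import Data.Vec.Relation.Unary.All as VecAll
open VecAll using ([]; _∷_)
open import Function.Base using (it; _∘_; id)
open import Function.Bundles using (mk⇔)
open import Level using (0ℓ)
open import Relation.Binary.PropositionalEquality using (_≡_; _≢_; refl; sym; trans; cong; cong₂; subst; subst₂; setoid; module ≡-Reasoning)
open import Relation.Nullary using (¬_; Dec; yes; no; does; ¬?)
open import Relation.Unary using (Pred; Decidable)

-- The sets Y to be avoided arise during the run and so depend on the centres; this is why the
-- centres have to serve all Y at once. In return all coins can be tossed before the searches, and
-- what follows is deterministic. A search cannot stop at the members of Y: it continues from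
-- satisfying assignments along every variable. A path that approaches z meets each of the at most s
-- members of Y at most once, so this costs a factor (n + 1) ^ s, which is 2 ^ o(n) for s = o(n /
-- log n). The good radius depends on the weights and is unknown to the algorithm, so all radii are
-- tried, with about B / k ^ r centres of radius r; each radius then costs B up to such factors. The
-- bound (2 k / (k + 1)) ^ n ≤ 2 ^ (n - n / k) comes from (1 + 1 / k) ^ k ≥ 2. Distance sums are
-- integers of polynomial size and an element is replaced only by a strictly better one, so
-- polynomially many rounds suffice although the oracle is only approximate. Probabilities are
-- counts of bit vectors and fractions are multiplied out, so that nearly all of the argument is
-- about natural numbers.

-- Runs of the machine that do not depend on the coins.

infix 4 _↦[_]_
-- The quantification over all coins restricts this to stretches without tosses; such stretches can
-- be chained without any mention of coins.
_↦[_]_ : Config → ℕ → Config → Set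
κ ↦[ t ] κ′ = (r : Vec Bool t) → steps r κ ≡ κ′

steps-++ : ∀ {t u} (r : Vec Bool t) (r′ : Vec Bool u) κ → steps (r ++ᵛ r′) κ ≡ steps r′ (steps r κ)
steps-++ []      r′ κ = refl
steps-++ (b ∷ r) r′ κ = steps-++ r r′ (step b κ)

stay : ∀ {κ} → κ ↦[ 0 ] κ
stay [] = refl

infixr 5 _▸_ _▹_
_▸_ : ∀ {κ κ′ t u κ″} → κ ↦[ t ] κ′ → κ′ ↦[ u ] κ″ → κ ↦[ t + u ] κ″
_▸_ {κ} {t = t} {u} p q r with splitAt t r
... | r₁ , r₂ , refl = trans (steps-++ r₁ r₂ κ) (trans (cong (steps r₂) (p r₁)) (q r₂))

_▹_ : ∀ {κ κ′ κ″ u} → (∀ b → step b κ ≡ κ′) → κ′ ↦[ u ] κ″ → κ ↦[ suc u ] κ″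
_▹_ p q (b ∷ r) = trans (cong (steps r) (p b)) (q r)

-- The machine is programmed in a first-order language with local
-- definitions. The value computed by a code replaces the environment in
-- variable 0; variable 1 holds a stack of saved environments.

data Code : Set where
  ret    : Expr → Code
  bind   : Code → Code → Code
  branch : Expr → Code → Code → Code
  while  : Code → Expr → Code → Code
  call   : Expr → Code → Code

nth : Tree → Store
nth ρ zero    = left ρ
nth ρ (suc i) = nth (right ρ) i

component : ℕ → Expr → Expr
component zero    e = hd e
component (suc i) e = component i (tl e)

-- In a code, var i is the i-th component of the environment.
⟪_⟫ : Expr → Expr
⟪ var i ⟫    = component i (var 0)
⟪ nil ⟫      = nil
⟪ cons e f ⟫ = cons ⟪ e ⟫ ⟪ f ⟫
⟪ hd e ⟫     = hd ⟪ e ⟫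
⟪ tl e ⟫     = tl ⟪ e ⟫

eval-component : ∀ σ i e → eval σ (component i e) ≡ nth (eval σ e) i
eval-component σ zero    e = refl
eval-component σ (suc i) e = eval-component σ i (tl e)

eval-⟪⟫ : ∀ σ e → eval σ ⟪ e ⟫ ≡ eval (nth (σ 0)) e
eval-⟪⟫ σ (var i)    = eval-component σ i (var 0)
eval-⟪⟫ σ nil        = refl
eval-⟪⟫ σ (cons e f) = cong₂ _∙_ (eval-⟪⟫ σ e) (eval-⟪⟫ σ f)
eval-⟪⟫ σ (hd e)     = cong left (eval-⟪⟫ σ e)
eval-⟪⟫ σ (tl e)     = cong right (eval-⟪⟫ σ e)

restore : Program
restore = 0 := cons (var 0) (hd (var 1)) ⨾ 1 := tl (var 1)

compile : Code → Program
compile (ret e)        = 0 := ⟪ e ⟫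
compile (bind c d)     = 1 := cons (var 0) (var 1) ⨾ compile c ⨾ restore ⨾ compile d
compile (branch e c d) = cond ⟪ e ⟫ (compile c) (compile d)
compile (while c e d)  = 1 := cons (var 0) (var 1) ⨾ compile c ⨾ restore ⨾
                         loop ⟪ e ⟫ (1 := cons (tl (var 0)) (var 1) ⨾ compile d ⨾ restore) ⨾
                         0 := hd (var 0)
compile (call e c)     = 0 := ⟪ e ⟫ ⨾ compile c

infix 4 _⊢_⇓_within_
-- The stack in variable 1 must come back unchanged, since enclosing codes keep their environments
-- there. Nothing is said about other variables: compiled codes use only 0 and 1.
record _⊢_⇓_within_ (ρ : Tree) (c : Code) (v : Tree) (T : ℕ) : Set where
  constructor runs
  field
    execute : ∀ {ps σ} → σ 0 ≡ ρ → ∃[ t ] ∃[ σ′ ]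
      t ≤ T × σ′ 0 ≡ v × σ′ 1 ≡ σ 1 × (compile c ∷ ps , σ) ↦[ t ] (ps , σ′)
open _⊢_⇓_within_ public

⇓-mono : ∀ {ρ c v T T′} → T ≤ T′ → ρ ⊢ c ⇓ v within T → ρ ⊢ c ⇓ v within T′
execute (⇓-mono T≤T′ r) σ0 with execute r σ0
... | t , σ′ , t≤T , rest = t , σ′ , ≤-trans t≤T T≤T′ , rest

⇓-ret : ∀ ρ e → ρ ⊢ ret e ⇓ eval (nth ρ) e within 1
execute (⇓-ret ρ e) {σ = σ} σ0 = 1 , _ , ≤-refl , trans (eval-⟪⟫ σ e) (cong (λ τ → eval (nth τ) e) σ0) , refl , (λ _ → refl) ▹ stay

⇓-call : ∀ {ρ e c v T} → eval (nth ρ) e ⊢ c ⇓ v within T → ρ ⊢ call e c ⇓ v within 2 + T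
execute (⇓-call {e = e} r) {ps} {σ} σ0
  with execute r {ps} {update 0 (eval σ ⟪ e ⟫) σ} (trans (eval-⟪⟫ σ e) (cong (λ τ → eval (nth τ) e) σ0))
... | t , σ′ , t≤T , σ′0 , σ′1 , go =
  2 + t , σ′ , s≤s (s≤s t≤T) , σ′0 , σ′1 , (λ _ → refl) ▹ (λ _ → refl) ▹ go

⇓-branch-true : ∀ {ρ e c d v T} → isNode (eval (nth ρ) e) ≡ true → ρ ⊢ c ⇓ v within T →
                ρ ⊢ branch e c d ⇓ v within 1 + T
execute (⇓-branch-true {e = e} {c} {d} is r) {ps} {σ} σ0 with execute r {ps} {σ} σ0
... | t , σ′ , t≤T , σ′0 , σ′1 , go = 1 + t , σ′ , s≤s t≤T , σ′0 , σ′1 ,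
  (λ _ → cong (λ b → (if b then compile c else compile d) ∷ ps , σ)
              (trans (cong isNode (trans (eval-⟪⟫ σ e) (cong (λ τ → eval (nth τ) e) σ0))) is)) ▹ go

⇓-branch-false : ∀ {ρ e c d v T} → isNode (eval (nth ρ) e) ≡ false → ρ ⊢ d ⇓ v within T →
                 ρ ⊢ branch e c d ⇓ v within 1 + T
execute (⇓-branch-false {e = e} {c} {d} is r) {ps} {σ} σ0 with execute r {ps} {σ} σ0
... | t , σ′ , t≤T , σ′0 , σ′1 , go = 1 + t , σ′ , s≤s t≤T , σ′0 , σ′1 ,
  (λ _ → cong (λ b → (if b then compile c else compile d) ∷ ps , σ)
              (trans (cong isNode (trans (eval-⟪⟫ σ e) (cong (λ τ → eval (nth τ) e) σ0))) is)) ▹ go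

-- Here c and d count the bookkeeping steps before the first and before the second of two partial
-- runs.
pad : ∀ c d {t u T U} → t ≤ T → u ≤ U → c + (t + (d + u)) ≤ c + d + (T + U)
pad c d {t} {u} {T} {U} t≤T u≤U = begin
  c + (t + (d + u))  ≡⟨ cong (c +_) (sym (+-assoc t d u)) ⟩
  c + (t + d + u)    ≡⟨ cong (λ x → c + (x + u)) (+-comm t d) ⟩
  c + (d + t + u)    ≡⟨ cong (c +_) (+-assoc d t u) ⟩
  c + (d + (t + u))  ≡⟨ +-assoc c d (t + u) ⟨
  c + d + (t + u)    ≤⟨ +-monoʳ-≤ (c + d) (+-mono-≤ t≤T u≤U) ⟩
  c + d + (T + U)    ∎
  where open ≤-Reasoning

⇓-bind : ∀ {ρ c d u v T U} → ρ ⊢ c ⇓ u within T → u ∙ ρ ⊢ d ⇓ v within U →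
         ρ ⊢ bind c d ⇓ v within 7 + (T + U)
execute (⇓-bind {c = c} {d} r₁ r₂) {ps} {σ} σ0
  with execute r₁ {restore ⨾ compile d ∷ ps} {update 1 (σ 0 ∙ σ 1) σ} σ0
... | t , σ₁ , t≤T , σ₁0 , σ₁1 , go₁
  with execute r₂ {ps} {update 1 (right (σ₁ 1)) (update 0 (σ₁ 0 ∙ left (σ₁ 1)) σ₁)}
            (cong₂ _∙_ σ₁0 (trans (cong left σ₁1) σ0))
... | u , σ₂ , u≤U , σ₂0 , σ₂1 , go₂ =
  _ , σ₂ , pad 3 4 t≤T u≤U , σ₂0 , trans σ₂1 (cong right σ₁1) ,
  (λ _ → refl) ▹ (λ _ → refl) ▹ (λ _ → refl) ▹ go₁ ▸
  (λ _ → refl) ▹ (λ _ → refl) ▹ (λ _ → refl) ▹ (λ _ → refl) ▹ go₂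

infix 4 _⊢while_body_from_⇓_within_
-- The loop state is the head of the environment: test and body see it on top of ρ, and the value of
-- the body replaces it. Weakening is a constructor so that bounds can be relaxed at every
-- iteration.
data _⊢while_body_from_⇓_within_ (ρ : Tree) (e : Expr) (d : Code) : Tree → Tree → ℕ → Set where
  done : ∀ {v} → isNode (eval (nth (v ∙ ρ)) e) ≡ false → ρ ⊢while e body d from v ⇓ v within 1
  more : ∀ {v v′ w T U} → isNode (eval (nth (v ∙ ρ)) e) ≡ true → v ∙ ρ ⊢ d ⇓ v′ within T →
         ρ ⊢while e body d from v′ ⇓ w within U → ρ ⊢while e body d from v ⇓ w within 8 + (T + U)
  ⇓-while-mono : ∀ {v w T U} → T ≤ U → ρ ⊢while e body d from v ⇓ w within T → ρ ⊢while e body d from v ⇓ w within U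

⇓-loop : ∀ {ρ e d v w T} → ρ ⊢while e body d from v ⇓ w within T → ∀ {ps σ} → σ 0 ≡ v ∙ ρ → ∃[ t ] ∃[ σ′ ]
  t ≤ T × σ′ 0 ≡ w ∙ ρ × σ′ 1 ≡ σ 1 ×
  (loop ⟪ e ⟫ (1 := cons (tl (var 0)) (var 1) ⨾ compile d ⨾ restore) ∷ ps , σ) ↦[ t ] (ps , σ′)
⇓-loop (⇓-while-mono T≤U its) σ0 with ⇓-loop its σ0
... | t , σ′ , t≤T , rest = t , σ′ , ≤-trans t≤T T≤U , rest
⇓-loop {e = e} (done is) {σ = σ} σ0 = 1 , _ , ≤-refl , σ0 , refl ,
  (λ _ → cong (λ b → (if b then _ else _) , σ)
              (trans (cong isNode (trans (eval-⟪⟫ σ e) (cong (λ τ → eval (nth τ) e) σ0))) is)) ▹ stay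
⇓-loop {e = e} {d} (more is r its) {ps} {σ} σ0
  with execute r {restore ∷ loop ⟪ e ⟫ (1 := cons (tl (var 0)) (var 1) ⨾ compile d ⨾ restore) ∷ ps}
           {update 1 (right (σ 0) ∙ σ 1) σ} σ0
... | t , σ₁ , t≤T , σ₁0 , σ₁1 , go₁
  with ⇓-loop its {ps} {update 1 (right (σ₁ 1)) (update 0 (σ₁ 0 ∙ left (σ₁ 1)) σ₁)}
              (cong₂ _∙_ σ₁0 (trans (cong left σ₁1) (cong right σ0)))
... | u , σ₂ , u≤U , σ₂0 , σ₂1 , go₂ =
  _ , σ₂ , ≤-trans (pad 4 3 t≤T u≤U) (n≤1+n _) , σ₂0 , trans σ₂1 (cong right σ₁1) ,
  (λ _ → cong (λ b → (if b then _ else _) , σ)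
              (trans (cong isNode (trans (eval-⟪⟫ σ e) (cong (λ τ → eval (nth τ) e) σ0))) is)) ▹
  (λ _ → refl) ▹ (λ _ → refl) ▹ (λ _ → refl) ▹ go₁ ▸ (λ _ → refl) ▹ (λ _ → refl) ▹ (λ _ → refl) ▹ go₂

⇓-while : ∀ {ρ c e d v w T U} → ρ ⊢ c ⇓ v within T → ρ ⊢while e body d from v ⇓ w within U →
          ρ ⊢ while c e d ⇓ w within 9 + (T + U)
execute (⇓-while {c = c} {e} {d} r its) {ps} {σ} σ0
  with execute r {restore ⨾ loop ⟪ e ⟫ (1 := cons (tl (var 0)) (var 1) ⨾ compile d ⨾ restore) ⨾ 0 := hd (var 0) ∷ ps}
           {update 1 (σ 0 ∙ σ 1) σ} σ0
... | t , σ₁ , t≤T , σ₁0 , σ₁1 , go₁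
  with ⇓-loop its {0 := hd (var 0) ∷ ps} {update 1 (right (σ₁ 1)) (update 0 (σ₁ 0 ∙ left (σ₁ 1)) σ₁)}
              (cong₂ _∙_ σ₁0 (trans (cong left σ₁1) σ0))
... | u , σ₂ , u≤U , σ₂0 , σ₂1 , go₂ =
  _ , _ , ≤-trans (pad 3 5 t≤T (≤-trans (≤-reflexive (+-comm u 1)) (s≤s u≤U))) (≤-reflexive (cong (8 +_) (+-suc _ _))) , cong left σ₂0 , trans σ₂1 (cong right σ₁1) ,
  (λ _ → refl) ▹ (λ _ → refl) ▹ (λ _ → refl) ▹ go₁ ▸
  (λ _ → refl) ▹ (λ _ → refl) ▹ (λ _ → refl) ▹ (λ _ → refl) ▹ (λ _ → refl) ▹ go₂ ▸ (λ _ → refl) ▹ stay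

-- A calculus of costs up to powers of a size parameter.

-- The summands 4 and 2 pay for bookkeeping, as a constant number of steps is at most 2 ^ 4 or 2 ^ 2
-- and the size parameter is at least 2. The 10 in a loop allows for the number of its iterations.
deg : Code → ℕ
deg (ret e)        = 0
deg (bind c d)     = 4 + (deg c + deg d)
deg (branch e c d) = 2 + (deg c + deg d)
deg (while c e d)  = 4 + (deg c + (10 + (4 + deg d)))
deg (call e c)     = 2 + deg c

-- Turns sums into products so that exponents add up: for nonzero factors, x and y are each at most
-- x * y, and c is at most c * (x * y).
overhead : ∀ m c γ x y .{{_ : NonZero γ}} .{{_ : NonZero x}} .{{_ : NonZero y}} → c + 2 ≤ 2 ^ m →
           c + (γ * x + γ * y) ≤ γ * (2 ^ m * (x * y))
overhead m c γ x y c+2≤2^m = begin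
  c + (γ * x + γ * y)                      ≤⟨ +-monoˡ-≤ _ (≤-trans (m≤n*m c γ) (*-monoʳ-≤ γ (m≤m*n c (x * y) {{m*n≢0 x y}}))) ⟩
  γ * (c * (x * y)) + (γ * x + γ * y)      ≡⟨ cong (γ * (c * (x * y)) +_) (*-distribˡ-+ γ x y) ⟨
  γ * (c * (x * y)) + γ * (x + y)          ≡⟨ *-distribˡ-+ γ (c * (x * y)) (x + y) ⟨
  γ * (c * (x * y) + (x + y))              ≤⟨ *-monoʳ-≤ γ (+-monoʳ-≤ (c * (x * y)) (+-mono-≤ (m≤m*n x y) (m≤n*m y x))) ⟩
  γ * (c * (x * y) + (x * y + x * y))      ≡⟨ cong (λ z → γ * (c * (x * y) + (x * y + z))) (+-identityʳ (x * y)) ⟨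
  γ * (c * (x * y) + 2 * (x * y))          ≡⟨ cong (γ *_) (*-distribʳ-+ (x * y) c 2) ⟨
  γ * ((c + 2) * (x * y))                  ≤⟨ *-monoʳ-≤ γ (*-monoˡ-≤ (x * y) c+2≤2^m) ⟩
  γ * (2 ^ m * (x * y))                    ∎
  where open ≤-Reasoning

-- Everything of polynomial size is bounded by a power of Z; a code then
-- costs at most γ * Z ^ deg, where γ accounts for exponentially long loops.
module Costs (Z : ℕ) (2≤Z : 2 ≤ Z) where

  instance
    Z≢0 : NonZero Z
    Z≢0 = >-nonZero (≤-trans (s≤s z≤n) 2≤Z)

  infix 4 _⊢_⇓_[_]
  record _⊢_⇓_[_] (ρ : Tree) (c : Code) (v : Tree) (γ : ℕ) : Set where
    constructor costs
    field cost : ρ ⊢ c ⇓ v within γ * Z ^ deg c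

  infix 4 _⊢while_body_from_⇓_[_×_]
  record _⊢while_body_from_⇓_[_×_] (ρ : Tree) (e : Expr) (d : Code) (v w : Tree) (i γ : ℕ) : Set where
    constructor costs
    field cost : ρ ⊢while e body d from v ⇓ w within 1 + i * (8 + γ * Z ^ deg d)

  2^≤Z^ : ∀ m → 2 ^ m ≤ Z ^ m
  2^≤Z^ m = ^-monoˡ-≤ m 2≤Z

  absorb : ∀ m c γ a b .{{_ : NonZero γ}} → c + 2 ≤ 2 ^ m →
           c + (γ * Z ^ a + γ * Z ^ b) ≤ γ * Z ^ (m + (a + b))
  absorb m c γ a b c+2≤2^m = begin
    c + (γ * Z ^ a + γ * Z ^ b)          ≤⟨ overhead m c γ (Z ^ a) (Z ^ b) {{it}} {{m^n≢0 Z a}} {{m^n≢0 Z b}} c+2≤2^m ⟩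
    γ * (2 ^ m * (Z ^ a * Z ^ b))        ≤⟨ *-monoʳ-≤ γ (*-monoˡ-≤ _ (2^≤Z^ m)) ⟩
    γ * (Z ^ m * (Z ^ a * Z ^ b))        ≡⟨ cong (λ x → γ * (Z ^ m * x)) (^-distribˡ-+-* Z a b) ⟨
    γ * (Z ^ m * Z ^ (a + b))            ≡⟨ cong (γ *_) (^-distribˡ-+-* Z m (a + b)) ⟨
    γ * Z ^ (m + (a + b))                ∎
    where open ≤-Reasoning

  absorb₁ : ∀ m c γ a b .{{_ : NonZero γ}} → c + 2 ≤ 2 ^ m → c + γ * Z ^ a ≤ γ * Z ^ (m + (a + b))
  absorb₁ m c γ a b c+2≤2^m = ≤-trans (+-monoʳ-≤ c (m≤m+n _ _)) (absorb m c γ a b c+2≤2^m)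

  weaken : ∀ {ρ c v γ δ} → γ ≤ δ → ρ ⊢ c ⇓ v [ γ ] → ρ ⊢ c ⇓ v [ δ ]
  weaken γ≤δ (costs p) = costs (⇓-mono (*-monoˡ-≤ _ γ≤δ) p)

  poly : ∀ {ρ c v γ} .{{_ : NonZero γ}} → ρ ⊢ c ⇓ v [ 1 ] → ρ ⊢ c ⇓ v [ γ ]
  poly {γ = suc _} = weaken (s≤s z≤n)

  return : ∀ {ρ} e {γ} .{{_ : NonZero γ}} → ρ ⊢ ret e ⇓ eval (nth ρ) e [ γ ]
  return {ρ} e {γ = suc _} = costs (⇓-mono (s≤s z≤n) (⇓-ret ρ e))

  infixr 3 _then_
  _then_ : ∀ {ρ c d u v γ} .{{_ : NonZero γ}} → ρ ⊢ c ⇓ u [ γ ] → u ∙ ρ ⊢ d ⇓ v [ γ ] → ρ ⊢ bind c d ⇓ v [ γ ]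
  _then_ {c = c} {d} {γ = γ} (costs p) (costs q) =
    costs (⇓-mono (absorb 4 7 γ (deg c) (deg d) (m≤m+n 9 7)) (⇓-bind p q))

  calling : ∀ {ρ e c v γ} .{{_ : NonZero γ}} → eval (nth ρ) e ⊢ c ⇓ v [ γ ] → ρ ⊢ call e c ⇓ v [ γ ]
  calling {c = c} {γ = γ} (costs p) =
    costs (⇓-mono (≤-trans (absorb₁ 2 2 γ (deg c) 0 ≤-refl) (≤-reflexive (cong (λ x → γ * Z ^ (2 + x)) (+-identityʳ (deg c)))))
           (⇓-call p))

  yes! : ∀ {ρ e c d v γ} .{{_ : NonZero γ}} → isNode (eval (nth ρ) e) ≡ true → ρ ⊢ c ⇓ v [ γ ] → ρ ⊢ branch e c d ⇓ v [ γ ]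
  yes! {c = c} {d} {γ = γ} is (costs p) = costs (⇓-mono (absorb₁ 2 1 γ (deg c) (deg d) (n≤1+n 3)) (⇓-branch-true is p))

  no! : ∀ {ρ e c d v γ} .{{_ : NonZero γ}} → isNode (eval (nth ρ) e) ≡ false → ρ ⊢ d ⇓ v [ γ ] → ρ ⊢ branch e c d ⇓ v [ γ ]
  no! {c = c} {d} {γ = γ} is (costs p) = costs (⇓-mono
    (≤-trans (absorb₁ 2 1 γ (deg d) (deg c) (n≤1+n 3)) (≤-reflexive (cong (λ x → γ * Z ^ (2 + x)) (+-comm (deg d) (deg c)))))
    (⇓-branch-false is p))

  stop : ∀ {ρ e d v i γ} → isNode (eval (nth (v ∙ ρ)) e) ≡ false → ρ ⊢while e body d from v ⇓ v [ i × γ ]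
  stop is = costs (⇓-while-mono (s≤s z≤n) (done is))

  again : ∀ {ρ e d v v′ w i γ} → isNode (eval (nth (v ∙ ρ)) e) ≡ true → v ∙ ρ ⊢ d ⇓ v′ [ γ ] →
          ρ ⊢while e body d from v′ ⇓ w [ i × γ ] → ρ ⊢while e body d from v ⇓ w [ suc i × γ ]
  again {d = d} {i = i} {γ} is (costs p) (costs q) = costs (⇓-while-mono (≤-reflexive eq) (more is p q))
    where
    eq : 8 + (γ * Z ^ deg d + (1 + i * (8 + γ * Z ^ deg d))) ≡ 1 + (suc i * (8 + γ * Z ^ deg d))
    eq = trans (cong (8 +_) (+-suc (γ * Z ^ deg d) _)) (cong suc (sym (+-assoc 8 (γ * Z ^ deg d) _)))

  -- The body has its own factor δ. Exponentially many iterations of a polynomial body and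
  -- polynomially many iterations of an exponential body are thus covered alike.
  looping : ∀ {ρ c e d v w i γ δ} .{{_ : NonZero γ}} .{{_ : NonZero δ}} → i * δ ≤ γ * Z ^ 10 →
            ρ ⊢ c ⇓ v [ γ ] → ρ ⊢while e body d from v ⇓ w [ i × δ ] → ρ ⊢ while c e d ⇓ w [ γ ]
  looping {c = c} {e} {d} {i = i} {γ} {δ} iδ≤ (costs p) (costs q) = costs (⇓-mono bound (⇓-while p q))
    where
    y = Z ^ deg d
    inner : i * (8 + δ * y) ≤ γ * Z ^ (10 + (4 + deg d))
    inner = begin
      i * (8 + δ * y)                ≤⟨ *-monoʳ-≤ i (absorb₁ 4 8 δ (deg d) 0 (m≤m+n 10 6)) ⟩
      i * (δ * Z ^ (4 + (deg d + 0))) ≡⟨ cong (λ x → i * (δ * Z ^ (4 + x))) (+-identityʳ (deg d)) ⟩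
      i * (δ * Z ^ (4 + deg d))      ≡⟨ *-assoc i δ _ ⟨
      i * δ * Z ^ (4 + deg d)        ≤⟨ *-monoˡ-≤ _ iδ≤ ⟩
      γ * Z ^ 10 * Z ^ (4 + deg d)   ≡⟨ *-assoc γ _ _ ⟩
      γ * (Z ^ 10 * Z ^ (4 + deg d)) ≡⟨ cong (γ *_) (^-distribˡ-+-* Z 10 (4 + deg d)) ⟨
      γ * Z ^ (10 + (4 + deg d))     ∎
      where open ≤-Reasoning
    bound : 9 + (γ * Z ^ deg c + (1 + i * (8 + δ * y))) ≤ γ * Z ^ deg (while c e d)
    bound = begin
      9 + (γ * Z ^ deg c + (1 + i * (8 + δ * y)))   ≡⟨ cong (9 +_) (+-suc _ _) ⟩
      10 + (γ * Z ^ deg c + i * (8 + δ * y))        ≤⟨ +-monoʳ-≤ 10 (+-monoʳ-≤ (γ * Z ^ deg c) inner) ⟩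
      10 + (γ * Z ^ deg c + γ * Z ^ (10 + (4 + deg d))) ≤⟨ absorb 4 10 γ (deg c) (10 + (4 + deg d)) (m≤m+n 12 4) ⟩
      γ * Z ^ deg (while c e d)                     ∎
      where open ≤-Reasoning

-- Encodings, and the codes of the search together with the functions they compute.

encodeAssignment : ∀ {n} → Assignment n → Tree
encodeAssignment []      = nil
encodeAssignment (b ∷ z) = encodeBool b ∙ encodeAssignment z

encodeAssignments : ∀ {n} → List (Assignment n) → Tree
encodeAssignments zs = encodeList (map encodeAssignment zs)

encodeClause : ∀ {n} → Clause n → Tree
encodeClause C = encodeList (map encodeLiteral C)

encodeNumbers : List ℕ → Tree
encodeNumbers ns = encodeList (map encodeℕ ns)

encodeMaybe : ∀ {A : Set} → (A → Tree) → Maybe A → Tree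
encodeMaybe enc nothing  = nil
encodeMaybe enc (just x) = enc x ∙ nil

-- A search task: centre, remaining radius, remaining number of times that a
-- satisfying assignment may be expanded.
Task : ℕ → Set
Task n = Assignment n × ℕ × ℕ

encodeTask : ∀ {n} → Task n → Tree
encodeTask (a , r , j) = encodeAssignment a ∙ encodeℕ r ∙ encodeℕ j

encodeTasks : ∀ {n} → List (Task n) → Tree
encodeTasks st = encodeList (map encodeTask st)

encodeBest : ∀ {n} → Maybe (Assignment n) → Tree
encodeBest = encodeMaybe encodeAssignment

positive : ℕ → Bool
positive zero    = false
positive (suc _) = true

loopBody : Code → Code
loopBody (while c e d) = d
loopBody (bind c d)    = loopBody c
loopBody c             = c

-- The arguments of a code are the components of its environment.

yep : Expr
yep = cons nil nil

distance : Code
distance = bind (while (ret (cons (var 0) (cons (var 1) (var 2)))) (tl (tl (var 0)))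
                       (branch (hd (hd (tl (var 0))))
                               (branch (hd (tl (tl (var 0)))) same differ)
                               (branch (hd (tl (tl (var 0)))) differ same)))
                (ret (hd (var 0)))
  where
  same differ : Code
  same   = ret (cons (hd (var 0)) (cons (tl (hd (tl (var 0)))) (tl (tl (tl (var 0))))))
  differ = ret (cons (cons nil (hd (var 0))) (cons (tl (hd (tl (var 0)))) (tl (tl (tl (var 0))))))

-- Like the other functions that accompany a code, this one repeats the loop of the code,
-- accumulator included, so that correctness can be checked step by step. The mathematical meaning
-- is established separately, here by `addDistance-dH`.
addDistance : ∀ {n} → ℕ → Assignment n → Assignment n → ℕ
addDistance m []          []          = m
addDistance m (true ∷ a)  (true ∷ b)  = addDistance m a b
addDistance m (true ∷ a)  (false ∷ b) = addDistance (suc m) a b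
addDistance m (false ∷ a) (true ∷ b)  = addDistance (suc m) a b
addDistance m (false ∷ a) (false ∷ b) = addDistance m a b

score : Code
score = bind (while (ret (cons nil (var 1))) (tl (var 0))
                    (bind (call (cons (hd (var 0)) (cons (var 1) (cons (hd (tl (var 0))) nil))) distance)
                          (ret (cons (var 0) (tl (tl (var 1)))))))
             (ret (hd (var 0)))

scoreOf : ∀ {n} → Assignment n → List (Assignment n) → ℕ
scoreOf z = foldl (λ m y → addDistance m z y) 0

member : Code
member = bind (while (ret (cons nil (var 1))) (tl (var 0))
                     (bind (call (cons nil (cons (var 1) (cons (hd (tl (var 0))) nil))) distance)
                           (branch (var 0) (ret (cons (hd (var 1)) (tl (tl (var 1)))))
                                           (ret (cons yep (tl (tl (var 1))))))))
              (ret (hd (var 0)))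

memberOf : ∀ {n} → Assignment n → List (Assignment n) → Bool
memberOf z = foldl (λ m y → if positive (addDistance 0 z y) then m else true) false

monus : Code
monus = bind (while (ret (cons (var 0) (var 1))) (tl (var 0))
                    (ret (cons (tl (hd (var 0))) (tl (tl (var 0))))))
             (ret (hd (var 0)))

agrees : Code
agrees = bind (while (ret (cons (hd (var 0)) (var 1))) (hd (var 0))
                     (ret (cons (tl (hd (var 0))) (tl (tl (var 0))))))
              (branch (hd (tl (var 0))) (ret (tl (var 1)))
                      (branch (tl (var 1)) (ret nil) (ret yep)))

agreesOf : ∀ {n} → Literal n → Assignment n → Bool
agreesOf (x , b) a = if lookup a x then b else not b

satisfied : Code
satisfied = bind (while (ret (cons nil (var 0))) (tl (var 0))
                        (bind (call (cons (hd (tl (var 0))) (cons (var 2) nil)) agrees)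
                              (branch (var 0) (ret (cons yep (tl (tl (var 1)))))
                                              (ret (cons (hd (var 1)) (tl (tl (var 1))))))))
                 (ret (hd (var 0)))

satisfiedBy : ∀ {n} → Assignment n → Clause n → Bool
satisfiedBy a = foldl (λ m l → if agreesOf l a then true else m) false

falsified : Code
falsified = bind (while (ret (cons nil (var 0))) (tl (var 0))
                        (bind (call (cons (hd (tl (var 0))) (cons (var 2) nil)) satisfied)
                              (branch (var 0) (ret (cons (hd (var 1)) (tl (tl (var 1)))))
                                              (ret (cons (cons (hd (tl (var 1))) nil) (tl (tl (var 1))))))))
                 (ret (hd (var 0)))

falsifiedClause : ∀ {n} → CNF n → Assignment n → Maybe (Clause n)
falsifiedClause F a = foldl (λ m C → if satisfiedBy a C then m else just C) nothing F

flipBack : Code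
flipBack = bind (while (ret (var 0)) (hd (var 0))
                       (ret (cons (tl (hd (var 0))) (cons (hd (hd (var 0))) (tl (var 0))))))
                (ret (tl (var 0)))

-- The state is a counter, the reversed prefix and the remaining bits. After the bit is toggled,
-- `flipBack` moves the prefix back.
flip : Code
flip = bind (while (ret (cons (var 0) (cons nil (var 1)))) (hd (var 0))
                   (ret (cons (tl (hd (var 0))) (cons (cons (hd (tl (tl (var 0)))) (hd (tl (var 0)))) (tl (tl (tl (var 0))))))))
      (bind (branch (hd (tl (tl (var 0))))
                    (ret (cons (hd (tl (var 0))) (cons nil (tl (tl (tl (var 0)))))))
                    (ret (cons (hd (tl (var 0))) (cons yep (tl (tl (tl (var 0))))))))
            flipBack)

flipAt : ∀ {n} → Fin n → Assignment n → Assignment n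
flipAt zero    (b ∷ a) = not b ∷ a
flipAt (suc x) (b ∷ a) = b ∷ flipAt x a

-- Environment: clause, centre, radius, expansion budget, tasks. The loop state pairs the remaining
-- literals with the growing stack.
push : Code
push = bind (while (ret (cons (var 0) (var 4))) (hd (var 0))
                   (bind (call (cons (hd (hd (hd (var 0)))) (cons (var 2) nil)) flip)
                         (ret (cons (tl (hd (var 1))) (cons (cons (var 0) (cons (var 4) (var 5))) (tl (var 1)))))))
            (ret (tl (var 0)))

pushAll : ∀ {n} → Clause n → Assignment n → ℕ → ℕ → List (Task n) → List (Task n)
pushAll C a r j st = foldl (λ st l → (flipAt (proj₁ l) a , r , j) ∷ st) st C

-- Environment: the answer of `member`, the candidate, the incumbent, and the set to stay away from.
considerRest : Code
considerRest =
  branch (var 0) (ret (var 2))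
  (branch (var 2)
    (bind (call (cons (var 1) (cons (var 3) nil)) score)
    (bind (call (cons (hd (var 3)) (cons (var 4) nil)) score)
    (bind (call (cons (var 1) (cons (var 0) nil)) monus)
    (branch (var 0) (ret (cons (var 4) nil)) (ret (var 5))))))
    (ret (cons (var 1) nil)))

consider : Code
consider =
  bind (call (cons (var 0) (cons (var 2) nil)) member) considerRest

improved : ∀ {n} → Assignment n → Maybe (Assignment n) → List (Assignment n) → Maybe (Assignment n)
improved a nothing  Y = just a
improved a (just b) Y = if positive (scoreOf a Y ∸ scoreOf b Y) then just a else just b

considered : ∀ {n} → Assignment n → Maybe (Assignment n) → List (Assignment n) → Maybe (Assignment n)
considered a best Y = if memberOf a Y then best else improved a best Y

-- Environment: the state stack ∙ best, an unused component, the set to stay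
-- away from, the formula, and the list of all literals.
expandRest : Code
expandRest =
  branch (var 0)
    (branch (hd (tl (hd (hd (var 1)))))
      (bind (call (cons (hd (var 0)) (cons (hd (hd (hd (var 1)))) (cons (tl (hd (tl (hd (hd (var 1))))))
                  (cons (tl (tl (hd (hd (var 1))))) (cons (tl (hd (var 1))) nil))))) push)
            (ret (cons (var 0) (tl (var 2)))))
      (ret (cons (tl (hd (var 1))) (tl (var 1)))))
    (bind (call (cons (hd (hd (hd (var 1)))) (cons (tl (var 1)) (cons (var 3) nil))) consider)
      (branch (hd (tl (hd (hd (var 2)))))
        (branch (tl (tl (hd (hd (var 2)))))
          (bind (call (cons (var 6) (cons (hd (hd (hd (var 2)))) (cons (tl (hd (tl (hd (hd (var 2))))))
                      (cons (tl (tl (tl (hd (hd (var 2)))))) (cons (tl (hd (var 2))) nil))))) push)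
                (ret (cons (var 0) (var 1))))
          (ret (cons (tl (hd (var 2))) (var 0))))
        (ret (cons (tl (hd (var 2))) (var 0)))))

expand : Code
expand = bind (call (cons (var 3) (cons (hd (hd (hd (var 0)))) nil)) falsified) expandRest

-- A satisfying assignment is also branched on, over the literals of V and at the price of one unit
-- of j, because it may be a forbidden solution lying between the centre and the target.
expanded : ∀ {n} → CNF n → Clause n → List (Assignment n) → Task n → List (Task n) → Maybe (Assignment n) →
           List (Task n) × Maybe (Assignment n)
expanded F V Y (a , r , j) st best with falsifiedClause F a
expanded F V Y (a , zero  , j)     st best | just C  = st , best
expanded F V Y (a , suc r , j)     st best | just C  = pushAll C a r j st , best
expanded F V Y (a , zero  , j)     st best | nothing = st , considered a best Y
expanded F V Y (a , suc r , zero)  st best | nothing = st , considered a best Y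
expanded F V Y (a , suc r , suc j) st best | nothing = pushAll V a r j st , considered a best Y

-- Environment: incumbent, set to stay away from, formula, literals, tasks. The recursion of the
-- exploration is replaced by an explicit stack. The incumbent is nil when a set is being filled and
-- the element to be replaced when it is being improved.
search : Code
search = bind (while (ret (cons (var 4) (var 0))) (hd (var 0)) expand) (ret (tl (var 0)))

falsified-≤ : ∀ {n m} (F : CNF n) (a : Assignment n) → All (λ C → length C ≤ m) F →
              MaybeAll.All (λ C → length C ≤ m) (falsifiedClause F a)
falsified-≤ {m = m} F a = go F nothing
  where
  go : ∀ F {c} → MaybeAll.All (λ C → length C ≤ m) c → All (λ C → length C ≤ m) F →
       MaybeAll.All (λ C → length C ≤ m) (foldl (λ m C → if satisfiedBy a C then m else just C) c F)
  go []      m []          = m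
  go (C ∷ F) m (C≤ ∷ F≤) with satisfiedBy a C
  ... | true  = go F m F≤
  ... | false = go F (just C≤) F≤

-- Correctness and cost of the search routines.

module Routines (Z : ℕ) (2≤Z : 2 ≤ Z) where
  open Costs Z 2≤Z public

  ≤Z^10 : ∀ {i} → i ≤ Z → i * 1 ≤ 1 * Z ^ 10
  ≤Z^10 {i} i≤Z = ≤-trans (≤-reflexive (*-identityʳ i)) (≤-trans i≤Z
    (≤-trans (m≤m*n Z (Z ^ 9) {{m^n≢0 Z 9}}) (≤-reflexive (sym (*-identityˡ (Z ^ 10))))))

  ≤Z²^10 : ∀ {i} → i ≤ Z * Z → i * 1 ≤ 1 * Z ^ 10
  ≤Z²^10 {i} i≤ = ≤-trans (≤-reflexive (*-identityʳ i)) (≤-trans i≤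
    (≤-trans (*-monoʳ-≤ Z (m≤m*n Z (Z ^ 8) {{m^n≢0 Z 8}})) (≤-reflexive (sym (*-identityˡ (Z ^ 10))))))

  rounds : ∀ {ρ e d v w i j γ} → i ≡ j → ρ ⊢while e body d from v ⇓ w [ i × γ ] → ρ ⊢while e body d from v ⇓ w [ j × γ ]
  rounds refl p = p

  -- The common form of loops that consume a list: `st` lays out accumulator and rest as loop state,
  -- and `P` is what the body must know about an element. It is the trivial `0 ≤ 0` except in
  -- `falsified-⇓`, which needs a bound on the clauses.
  while-foldl : ∀ {A B : Set} {P : A → Set} {ρ e d γ} (st : B → List A → Tree) (f : B → A → B) →
                (∀ b x xs → isNode (eval (nth (st b (x ∷ xs) ∙ ρ)) e) ≡ true) →
                (∀ b → isNode (eval (nth (st b [] ∙ ρ)) e) ≡ false) →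
                (∀ b {x} xs → P x → st b (x ∷ xs) ∙ ρ ⊢ d ⇓ st (f b x) xs [ γ ]) →
                ∀ b {xs} → All P xs → ρ ⊢while e body d from st b xs ⇓ st (foldl f b xs) [] [ length xs × γ ]
  while-foldl st f go end step b []         = stop (end b)
  while-foldl st f go end step b (px ∷ pxs) = again (go b _ _) (step b _ px) (while-foldl st f go end step (f b _) pxs)

  distance-⇓ : ∀ {n ρ} m (a b : Assignment n) → n ≤ Z →
               encodeℕ m ∙ encodeAssignment a ∙ encodeAssignment b ∙ ρ ⊢ distance ⇓ encodeℕ (addDistance m a b) [ 1 ]
  distance-⇓ {n} {ρ} m a b n≤Z = looping (≤Z^10 n≤Z) (return _) (loop′ m a b) then return _
    where
    loop′ : ∀ {n ρ} m (a b : Assignment n) → ρ ⊢while tl (tl (var 0)) body loopBody distance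
              from encodeℕ m ∙ encodeAssignment a ∙ encodeAssignment b ⇓ encodeℕ (addDistance m a b) ∙ nil ∙ nil [ n × 1 ]
    loop′ m []          []          = stop refl
    loop′ m (true ∷ a)  (true ∷ b)  = again refl (yes! refl (yes! refl (return _))) (loop′ m a b)
    loop′ m (true ∷ a)  (false ∷ b) = again refl (yes! refl (no! refl (return _))) (loop′ (suc m) a b)
    loop′ m (false ∷ a) (true ∷ b)  = again refl (no! refl (yes! refl (return _))) (loop′ (suc m) a b)
    loop′ m (false ∷ a) (false ∷ b) = again refl (no! refl (no! refl (return _))) (loop′ m a b)

  score-⇓ : ∀ {n ρ} (z : Assignment n) Y → n ≤ Z → length Y ≤ Z →
            encodeAssignment z ∙ encodeAssignments Y ∙ ρ ⊢ score ⇓ encodeℕ (scoreOf z Y) [ 1 ]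
  score-⇓ z Y n≤Z Y≤Z = looping (≤Z^10 Y≤Z) (return _)
    (while-foldl {P = λ _ → 0 ≤ 0} (λ m Y → encodeℕ m ∙ encodeAssignments Y) (λ m y → addDistance m z y)
      (λ _ _ _ → refl) (λ _ → refl) (λ m {y} Y _ → calling (distance-⇓ m z y n≤Z) then return _)
      0 {Y} (universal (λ _ → z≤n) Y))
    then return _

  member-⇓ : ∀ {n ρ} (z : Assignment n) Y → n ≤ Z → length Y ≤ Z →
             encodeAssignment z ∙ encodeAssignments Y ∙ ρ ⊢ member ⇓ encodeBool (memberOf z Y) [ 1 ]
  member-⇓ z Y n≤Z Y≤Z = looping (≤Z^10 Y≤Z) (return _)
    (while-foldl {P = λ _ → 0 ≤ 0} (λ m Y → encodeBool m ∙ encodeAssignments Y) _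
      (λ _ _ _ → refl) (λ _ → refl) (λ m {y} Y _ → calling (distance-⇓ 0 z y n≤Z) then body m y Y)
      false {Y} (universal (λ _ → z≤n) Y))
    then return _
    where
    body : ∀ {ρ} m y Y →
      encodeℕ (addDistance 0 z y) ∙ (encodeBool m ∙ encodeAssignments (y ∷ Y)) ∙ ρ ⊢
      branch (var 0) (ret (cons (hd (var 1)) (tl (tl (var 1))))) (ret (cons yep (tl (tl (var 1))))) ⇓
      encodeBool (if positive (addDistance 0 z y) then m else true) ∙ encodeAssignments Y [ 1 ]
    body m y Y with addDistance 0 z y
    ... | zero  = no! refl (return _)
    ... | suc _ = yes! refl (return _)

  monus-⇓ : ∀ {ρ} u v → v ≤ Z * Z → encodeℕ u ∙ encodeℕ v ∙ ρ ⊢ monus ⇓ encodeℕ (u ∸ v) [ 1 ]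
  monus-⇓ u v v≤ = looping (≤Z²^10 v≤) (return _) (loop′ u v refl) then return _
    where
    loop′ : ∀ {ρ} u v {w} → u ∸ v ≡ w → ρ ⊢while tl (var 0) body loopBody monus
              from encodeℕ u ∙ encodeℕ v ⇓ encodeℕ w ∙ nil [ v × 1 ]
    loop′ u       zero    refl = stop refl
    loop′ zero    (suc v) eq   = again refl (return _) (loop′ zero v (trans (0∸n≡0 v) eq))
    loop′ (suc u) (suc v) eq   = again refl (return _) (loop′ u v eq)

  agrees-⇓ : ∀ {n ρ} (l : Literal n) (a : Assignment n) → n ≤ Z →
             encodeLiteral l ∙ encodeAssignment a ∙ ρ ⊢ agrees ⇓ encodeBool (agreesOf l a) [ 1 ]
  agrees-⇓ {n} (x , b) a n≤Z with walk x a
    where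
    walk : ∀ {n ρ} (x : Fin n) (a : Assignment n) → ∃[ t ] ρ ⊢while hd (var 0) body loopBody agrees
             from encodeℕ (toℕ x) ∙ encodeAssignment a ⇓ nil ∙ encodeBool (lookup a x) ∙ t [ toℕ x × 1 ]
    walk zero    (b ∷ a) = _ , stop refl
    walk (suc x) (b ∷ a) with walk x a
    ... | t , p = t , again refl (return _) p
  ... | t , p = looping (≤Z^10 (≤-trans (<⇒≤ (toℕ<n x)) n≤Z)) (return _) p then check (lookup a x) b
    where
    check : ∀ {ρ} y b → (nil ∙ encodeBool y ∙ t) ∙ (encodeℕ (toℕ x) ∙ encodeBool b) ∙ ρ ⊢
      branch (hd (tl (var 0))) (ret (tl (var 1))) (branch (tl (var 1)) (ret nil) (ret yep)) ⇓
      encodeBool (if y then b else not b) [ 1 ]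
    check true  b     = yes! refl (return _)
    check false true  = no! refl (yes! refl (return _))
    check false false = no! refl (no! refl (return _))

  satisfied-⇓ : ∀ {n ρ} (a : Assignment n) (C : Clause n) → n ≤ Z → length C ≤ Z →
                encodeClause C ∙ encodeAssignment a ∙ ρ ⊢ satisfied ⇓ encodeBool (satisfiedBy a C) [ 1 ]
  satisfied-⇓ a C n≤Z C≤Z = looping (≤Z^10 C≤Z) (return _)
    (while-foldl {P = λ _ → 0 ≤ 0} (λ m C → encodeBool m ∙ encodeClause C) _
      (λ _ _ _ → refl) (λ _ → refl) (λ m {l} C _ → calling (agrees-⇓ l a n≤Z) then body m l C)
      false {C} (universal (λ _ → z≤n) C))
    then return _
    where
    body : ∀ {ρ} m l C →
      encodeBool (agreesOf l a) ∙ (encodeBool m ∙ encodeClause (l ∷ C)) ∙ ρ ⊢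
      branch (var 0) (ret (cons yep (tl (tl (var 1))))) (ret (cons (hd (var 1)) (tl (tl (var 1))))) ⇓
      encodeBool (if agreesOf l a then true else m) ∙ encodeClause C [ 1 ]
    body m l C with agreesOf l a
    ... | false = no! refl (return _)
    ... | true  = yes! refl (return _)

  falsified-⇓ : ∀ {n ρ} (F : CNF n) (a : Assignment n) → n ≤ Z → length F ≤ Z → All (λ C → length C ≤ Z) F →
                encodeCNF F ∙ encodeAssignment a ∙ ρ ⊢ falsified ⇓ encodeMaybe encodeClause (falsifiedClause F a) [ 1 ]
  falsified-⇓ F a n≤Z F≤Z C≤Z = looping (≤Z^10 F≤Z) (return _)
    (while-foldl (λ m F → encodeMaybe encodeClause m ∙ encodeCNF F) _
      (λ _ _ _ → refl) (λ _ → refl) (λ m {C} F C≤Z → calling (satisfied-⇓ a C n≤Z C≤Z) then body m C F)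
      nothing {F} C≤Z)
    then return _
    where
    body : ∀ {ρ} m C F →
      encodeBool (satisfiedBy a C) ∙ (encodeMaybe encodeClause m ∙ encodeCNF (C ∷ F)) ∙ ρ ⊢
      branch (var 0) (ret (cons (hd (var 1)) (tl (tl (var 1))))) (ret (cons (cons (hd (tl (var 1))) nil) (tl (tl (var 1))))) ⇓
      encodeMaybe encodeClause (if satisfiedBy a C then m else just C) ∙ encodeCNF F [ 1 ]
    body m C F with satisfiedBy a C
    ... | false = no! refl (return _)
    ... | true  = yes! refl (return _)

  flip-⇓ : ∀ {n ρ} (x : Fin n) (a : Assignment n) → n ≤ Z →
           encodeℕ (toℕ x) ∙ encodeAssignment a ∙ ρ ⊢ flip ⇓ encodeAssignment (flipAt x a) [ 1 ]
  flip-⇓ {n} x a n≤Z with walk x a nil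
    where
    -- The second loop undoes the first one, whatever has happened to the
    -- bit at x in between.
    walk : ∀ {n} (x : Fin n) (a : Assignment n) pre → ∃[ pre′ ] ∃[ b ] ∃[ t ]
           (∀ {ρ} → ρ ⊢while hd (var 0) body loopBody flip from encodeℕ (toℕ x) ∙ pre ∙ encodeAssignment a
              ⇓ nil ∙ pre′ ∙ encodeBool b ∙ t [ toℕ x × 1 ])
         × (∀ {ρ w i} → ρ ⊢while hd (var 0) body loopBody flipBack from pre ∙ encodeAssignment (flipAt x a) ⇓ w [ i × 1 ] →
              ρ ⊢while hd (var 0) body loopBody flipBack from pre′ ∙ encodeBool (not b) ∙ t ⇓ w [ toℕ x + i × 1 ])
    walk zero    (b ∷ a) pre = pre , b , _ , stop refl , λ p → p
    walk (suc x) (b ∷ a) pre with walk x a (encodeBool b ∙ pre)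
    ... | pre′ , c , t , forth , back = pre′ , c , t , again refl (return _) forth ,
          λ {_} {_} {i} p → rounds (+-suc (toℕ x) i) (back (again refl (return _) p))
  ... | pre , b , t , forth , back =
    looping (≤Z^10 x≤Z) (return _) forth then toggle b then
    (looping (≤Z^10 (≤-trans (≤-reflexive (+-identityʳ (toℕ x))) x≤Z)) (return _) (back {i = 0} (stop refl)) then return _)
    where
    x≤Z = ≤-trans (<⇒≤ (toℕ<n x)) n≤Z
    toggle : ∀ {ρ} b → (nil ∙ pre ∙ encodeBool b ∙ t) ∙ ρ ⊢
      branch (hd (tl (tl (var 0)))) (ret (cons (hd (tl (var 0))) (cons nil (tl (tl (tl (var 0)))))))
                                    (ret (cons (hd (tl (var 0))) (cons yep (tl (tl (tl (var 0))))))) ⇓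
      pre ∙ encodeBool (not b) ∙ t [ 1 ]
    toggle true  = yes! refl (return _)
    toggle false = no! refl (return _)

  push-⇓ : ∀ {n ρ} (C : Clause n) (a : Assignment n) r j st → n ≤ Z → length C ≤ Z →
           encodeClause C ∙ encodeAssignment a ∙ encodeℕ r ∙ encodeℕ j ∙ encodeTasks st ∙ ρ ⊢ push ⇓
           encodeTasks (pushAll C a r j st) [ 1 ]
  push-⇓ C a r j st n≤Z C≤Z = looping (≤Z^10 C≤Z) (return _)
    (while-foldl {P = λ _ → 0 ≤ 0} (λ st C → encodeClause C ∙ encodeTasks st) _
      (λ _ _ _ → refl) (λ _ → refl) (λ st {l} C _ → calling (flip-⇓ (proj₁ l) a n≤Z) then return _)
      st {C} (universal (λ _ → z≤n) C))
    then return _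

  module Search {n : ℕ} (F : CNF n) (V : Clause n) (Y : List (Assignment n)) (n≤Z : n ≤ Z) (F≤Z : length F ≤ Z)
                (C≤Z : All (λ C → length C ≤ Z) F) (V≤Z : length V ≤ Z) (Y≤Z : length Y ≤ Z)
                (Y-scores : ∀ z → scoreOf z Y ≤ Z * Z) where

    consider-⇓ : ∀ {ρ} (a : Assignment n) best →
                 encodeAssignment a ∙ encodeBest best ∙ encodeAssignments Y ∙ ρ ⊢ consider ⇓
                 encodeBest (considered a best Y) [ 1 ]
    consider-⇓ a best = calling (member-⇓ a Y n≤Z Y≤Z) then outcome best
      where
      choose : ∀ {ρ t₁ t₂ t₃} b u →
        encodeℕ u ∙ t₁ ∙ t₂ ∙ t₃ ∙ encodeAssignment a ∙ (encodeAssignment b ∙ nil) ∙ ρ ⊢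
        branch (var 0) (ret (cons (var 4) nil)) (ret (var 5)) ⇓
        encodeBest (if positive u then just a else just b) [ 1 ]
      choose b zero    = no! refl (return _)
      choose b (suc _) = yes! refl (return _)
      outcome : ∀ {ρ} best →
        encodeBool (memberOf a Y) ∙ encodeAssignment a ∙ encodeBest best ∙ encodeAssignments Y ∙ ρ ⊢
        considerRest ⇓ encodeBest (considered a best Y) [ 1 ]
      outcome best with memberOf a Y
      outcome best     | true = yes! refl (return _)
      outcome nothing  | false = no! refl (no! refl (return _))
      outcome (just b) | false = no! refl (yes! refl
        (calling (score-⇓ a Y n≤Z Y≤Z) then calling (score-⇓ b Y n≤Z Y≤Z) then
         calling (monus-⇓ (scoreOf a Y) (scoreOf b Y) (Y-scores b)) then choose b (scoreOf a Y ∸ scoreOf b Y)))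

    expand-⇓ : ∀ {ρ t} (task : Task n) st best →
               (encodeTasks (task ∷ st) ∙ encodeBest best) ∙ t ∙
                 encodeAssignments Y ∙ encodeCNF F ∙ encodeClause V ∙ ρ ⊢ expand ⇓
               encodeTasks (proj₁ (expanded F V Y task st best)) ∙
                 encodeBest (proj₂ (expanded F V Y task st best)) [ 1 ]
    expand-⇓ (a , r , j) st best = calling (falsified-⇓ F a n≤Z F≤Z C≤Z) then outcome r j
      where
      outcome : ∀ {ρ t} r j →
        encodeMaybe encodeClause (falsifiedClause F a) ∙
        (encodeTasks ((a , r , j) ∷ st) ∙ encodeBest best) ∙ t ∙
          encodeAssignments Y ∙ encodeCNF F ∙ encodeClause V ∙ ρ ⊢ expandRest ⇓
        encodeTasks (proj₁ (expanded F V Y (a , r , j) st best)) ∙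
          encodeBest (proj₂ (expanded F V Y (a , r , j) st best)) [ 1 ]
      outcome r j with falsifiedClause F a | falsified-≤ F a C≤Z
      outcome zero    j       | just C  | _       = yes! refl (no! refl (return _))
      outcome (suc r) j       | just C  | just C≤ = yes! refl (yes! refl (calling (push-⇓ C a r j st n≤Z C≤) then return _))
      outcome zero    j       | nothing | _ = no! refl (calling (consider-⇓ a best) then no! refl (return _))
      outcome (suc r) zero    | nothing | _ = no! refl (calling (consider-⇓ a best) then yes! refl (no! refl (return _)))
      outcome (suc r) (suc j) | nothing | _ = no! refl (calling (consider-⇓ a best) then
        yes! refl (yes! refl (calling (push-⇓ V a r j st n≤Z V≤Z) then return _)))

-- What the exploration finds and how many nodes it visits.

module Exploration {n : ℕ} (F : CNF n) (V : Clause n) (Y : List (Assignment n)) where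

  -- c is visited when a is explored with remaining budgets r and j.
  data Reach : ℕ → ℕ → Assignment n → Assignment n → Set where
    visit : ∀ {r j a} → Reach r j a a
    unsat : ∀ {r j a c C l} → falsifiedClause F a ≡ just C → l ∈ C → Reach r j (flipAt (proj₁ l) a) c → Reach (suc r) j a c
    sat   : ∀ {r j a c l} → falsifiedClause F a ≡ nothing → l ∈ V → Reach r j (flipAt (proj₁ l) a) c → Reach (suc r) (suc j) a c

  Admissible : Assignment n → Set
  Admissible z = falsifiedClause F z ≡ nothing × memberOf z Y ≡ false

  infix 4 _≼_
  _≼_ : Maybe (Assignment n) → Maybe (Assignment n) → Set
  m ≼ m′ = ∀ {y} → m ≡ just y → ∃[ z ] m′ ≡ just z × scoreOf y Y ≤ scoreOf z Y

  ≼-refl : ∀ {m} → m ≼ m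
  ≼-refl m≡ = _ , m≡ , ≤-refl

  ≼-trans : ∀ {l m p} → l ≼ m → m ≼ p → l ≼ p
  ≼-trans l≼m m≼p l≡ with l≼m l≡
  ... | z , m≡ , le with m≼p m≡
  ... | w , p≡ , le′ = w , p≡ , ≤-trans le le′

  -- Strictness is what lets a potential argument end the local search; the unchanged case is the
  -- one that certifies the incumbent.
  Improves : Maybe (Assignment n) → Maybe (Assignment n) → Set
  Improves m m′ = m′ ≡ m ⊎ ∃[ z ] m′ ≡ just z × Admissible z × (∀ {y} → m ≡ just y → scoreOf y Y < scoreOf z Y)

  improves⇒≼ : ∀ {m m′} → Improves m m′ → m ≼ m′
  improves⇒≼ (inj₁ refl)               = ≼-refl
  improves⇒≼ (inj₂ (z , m′≡ , _ , lt)) m≡ = z , m′≡ , <⇒≤ (lt m≡)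

  improves-trans : ∀ {l m p} → Improves l m → Improves m p → Improves l p
  improves-trans p             (inj₁ refl)              = p
  improves-trans (inj₁ refl)   (inj₂ q)                 = inj₂ q
  improves-trans (inj₂ (y , m≡ , _ , lt)) (inj₂ (z , p≡ , adm , lt′)) =
    inj₂ (z , p≡ , adm , λ l≡ → <-trans (lt l≡) (lt′ m≡))

  DominatesReach : List (Task n) → Maybe (Assignment n) → Set
  DominatesReach st m = ∀ {a r j c} → (a , r , j) ∈ st → Reach r j a c → Admissible c → just c ≼ m

  considered-improves : ∀ a best → falsifiedClause F a ≡ nothing → Improves best (considered a best Y)
  considered-improves a best F✓ with memberOf a Y in a∉Y
  ... | true = inj₁ refl
  considered-improves a nothing  F✓ | false = inj₂ (a , refl , (F✓ , a∉Y) , λ ())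
  considered-improves a (just b) F✓ | false with scoreOf a Y ∸ scoreOf b Y in eq
  ... | zero  = inj₁ refl
  ... | suc _ = inj₂ (a , refl , (F✓ , a∉Y) , λ { refl → m∸n≢0⇒n<m (λ e → 0≢1+n (trans (sym e) eq)) })

  considered-≽ : ∀ a best → memberOf a Y ≡ false → just a ≼ considered a best Y
  considered-≽ a best a∉Y {y} refl rewrite a∉Y with best
  ... | nothing = a , refl , ≤-refl
  ... | just b with scoreOf a Y ∸ scoreOf b Y in eq
  ...   | zero  = b , refl , m∸n≡0⇒m≤n eq
  ...   | suc _ = a , refl , ≤-refl

  ∈-pushAll-stack : ∀ C (a : Assignment n) r j st {t} → t ∈ st → t ∈ pushAll C a r j st
  ∈-pushAll-stack []      a r j st t∈ = t∈
  ∈-pushAll-stack (l ∷ C) a r j st t∈ = ∈-pushAll-stack C a r j _ (there t∈)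

  ∈-pushAll : ∀ {C l} (a : Assignment n) r j st → l ∈ C → (flipAt (proj₁ l) a , r , j) ∈ pushAll C a r j st
  ∈-pushAll {l ∷ C} a r j st (here refl) = ∈-pushAll-stack C a r j _ (here refl)
  ∈-pushAll {l ∷ C} a r j st (there l∈)  = ∈-pushAll {C} a r j _ l∈

  expanded-stack : ∀ task st best {t} → t ∈ st → t ∈ proj₁ (expanded F V Y task st best)
  expanded-stack (a , r , j) st best t∈ with falsifiedClause F a
  expanded-stack (a , zero  , j)     st best t∈ | just C  = t∈
  expanded-stack (a , suc r , j)     st best t∈ | just C  = ∈-pushAll-stack C a r j st t∈
  expanded-stack (a , zero  , j)     st best t∈ | nothing = t∈
  expanded-stack (a , suc r , zero)  st best t∈ | nothing = t∈
  expanded-stack (a , suc r , suc j) st best t∈ | nothing = ∈-pushAll-stack V a r j st t∈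

  expanded-improves : ∀ task st best → Improves best (proj₂ (expanded F V Y task st best))
  expanded-improves (a , r , j) st best with falsifiedClause F a | considered-improves a best
  expanded-improves (a , zero  , j)     st best | just C  | _ = inj₁ refl
  expanded-improves (a , suc r , j)     st best | just C  | _ = inj₁ refl
  expanded-improves (a , zero  , j)     st best | nothing | p = p refl
  expanded-improves (a , suc r , zero)  st best | nothing | p = p refl
  expanded-improves (a , suc r , suc j) st best | nothing | p = p refl

  -- The invariant of the stack: a path either ends at the node being expanded, which is then
  -- compared with the incumbent, or its first step leads to a task that is pushed now.
  expanded-reach : ∀ a r j st best {c} → Reach r j a c → Admissible c →
                   just c ≼ proj₂ (expanded F V Y (a , r , j) st best) ⊎
                   ∃[ a′ ] ∃[ r′ ] ∃[ j′ ] (a′ , r′ , j′) ∈ proj₁ (expanded F V Y (a , r , j) st best) × Reach r′ j′ a′ c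
  expanded-reach a zero j st best visit (s , a∉) rewrite s = inj₁ (considered-≽ a best a∉)
  expanded-reach a (suc r) zero st best visit (s , a∉) rewrite s = inj₁ (considered-≽ a best a∉)
  expanded-reach a (suc r) (suc j) st best visit (s , a∉) rewrite s = inj₁ (considered-≽ a best a∉)
  expanded-reach a (suc r) j st best (unsat u l∈ p) _ rewrite u = inj₂ (_ , _ , _ , ∈-pushAll a r j st l∈ , p)
  expanded-reach a (suc r) (suc j) st best (sat s l∈ p) _ rewrite s = inj₂ (_ , _ , _ , ∈-pushAll a r j st l∈ , p)

-- Bounds the number of nodes explored below a task.
potential : ∀ {n} → ℕ → Task n → ℕ
potential {n} k (a , r , j) = suc r * (k ^ r * suc n ^ j)

totalPotential : ∀ {n} → ℕ → List (Task n) → ℕ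
totalPotential k st = sum (map (potential k) st)

-- The children use up `suc r` of the `suc (suc r)` equal shares k ^ suc r * suc n ^ j of the
-- parent. The remaining share pays for the parent itself, which is the purpose of the linear factor
-- in `potential`.
potential-unsat : ∀ {n} k r j {a a′ : Assignment n} .{{_ : NonZero k}} → k * potential k (a , r , j) < potential k (a′ , suc r , j)
potential-unsat {n} k r j = begin-strict
  k * (suc r * (k ^ r * suc n ^ j))      ≡⟨ *-comm k _ ⟩
  suc r * (k ^ r * suc n ^ j) * k        ≡⟨ *-assoc (suc r) (k ^ r * suc n ^ j) k ⟩
  suc r * (k ^ r * suc n ^ j * k)        ≡⟨ cong (suc r *_) (trans (*-comm _ k) (sym (*-assoc k _ _))) ⟩
  suc r * (k * k ^ r * suc n ^ j)        <⟨ +-monoˡ-< _ (>-nonZero⁻¹ _ {{m*n≢0 (k * k ^ r) (suc n ^ j) {{m^n≢0 k (suc r)}} {{m^n≢0 (suc n) j}}}}) ⟩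
  k * k ^ r * suc n ^ j + suc r * (k * k ^ r * suc n ^ j) ∎
  where open ≤-Reasoning

-- The n children lose one factor `suc n` through the smaller budget j, which makes up for their
-- number.
potential-sat : ∀ {n} k r j {a a′ : Assignment n} .{{_ : NonZero k}} → n * potential k (a , r , j) < potential k (a′ , suc r , suc j)
potential-sat {n} k r j {a} {a′} = begin-strict
  n * potential k (a , r , j)                      ≤⟨ *-monoˡ-≤ _ (n≤1+n n) ⟩
  suc n * potential k (a , r , j)                  ≡⟨ *-comm (suc n) _ ⟩
  suc r * (k ^ r * suc n ^ j) * suc n              ≡⟨ *-assoc (suc r) (k ^ r * suc n ^ j) (suc n) ⟩
  suc r * (k ^ r * suc n ^ j * suc n)              ≡⟨ cong (suc r *_) (trans (*-assoc (k ^ r) _ _) (cong (k ^ r *_) (*-comm _ (suc n)))) ⟩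
  potential k (a , r , suc j)                      ≤⟨ m≤n*m _ k ⟩
  k * potential k (a , r , suc j)                  <⟨ potential-unsat k r (suc j) {a} {a′} ⟩
  potential k (a′ , suc r , suc j)                 ∎
  where open ≤-Reasoning

potential-positive : ∀ {n} k (t : Task n) .{{_ : NonZero k}} → 0 < potential k t
potential-positive {n} k (a , r , j) = >-nonZero⁻¹ _ {{m*n≢0 (suc r) _ {{_}} {{m*n≢0 (k ^ r) (suc n ^ j) {{m^n≢0 k r}} {{m^n≢0 (suc n) j}}}}}}

totalPotential-pushAll : ∀ {n} k C (a : Assignment n) r j st →
                         totalPotential k (pushAll C a r j st) ≡ length C * potential k (a , r , j) + totalPotential k st
totalPotential-pushAll k []      a r j st = refl
totalPotential-pushAll k (l ∷ C) a r j st = begin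
  totalPotential k (pushAll C a r j ((flipAt (proj₁ l) a , r , j) ∷ st))  ≡⟨ totalPotential-pushAll k C a r j _ ⟩
  length C * p + (p + totalPotential k st)                               ≡⟨ +-assoc (length C * p) p _ ⟨
  length C * p + p + totalPotential k st                                 ≡⟨ cong (_+ totalPotential k st) (+-comm (length C * p) p) ⟩
  p + length C * p + totalPotential k st                                 ∎
  where
  open ≡-Reasoning
  p = potential k (a , r , j)

expanded-potential : ∀ {n} k .{{_ : NonZero k}} (F : CNF n) V Y → F IsCNFOfWidth k → length V ≤ n → ∀ task st best →
                     totalPotential k (proj₁ (expanded F V Y task st best)) < totalPotential k (task ∷ st)
expanded-potential k F V Y F≤ V≤ (a , r , j) st best with falsifiedClause F a | falsified-≤ F a F≤
expanded-potential k F V Y F≤ V≤ (a , zero  , j)     st best | just C  | _ = m<n+m _ (potential-positive k (a , zero , j))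
expanded-potential k F V Y F≤ V≤ (a , zero  , j)     st best | nothing | _ = m<n+m _ (potential-positive k (a , zero , j))
expanded-potential k F V Y F≤ V≤ (a , suc r , zero)  st best | nothing | _ = m<n+m _ (potential-positive k (a , suc r , zero))
expanded-potential k F V Y F≤ V≤ (a , suc r , j)     st best | just C  | just C≤ =
  ≤-<-trans (≤-reflexive (totalPotential-pushAll k C a r j st))
            (+-monoˡ-< _ (≤-<-trans (*-monoˡ-≤ _ C≤) (potential-unsat k r j {a} {a})))
expanded-potential k F V Y F≤ V≤ (a , suc r , suc j) st best | nothing | _ =
  ≤-<-trans (≤-reflexive (totalPotential-pushAll k V a r j st))
            (+-monoˡ-< _ (≤-<-trans (*-monoˡ-≤ _ V≤) (potential-sat k r j {a} {a})))

module Searching (Z : ℕ) (2≤Z : 2 ≤ Z) {n k : ℕ} (k≢0 : NonZero k) (F : CNF n) (V : Clause n) (Y : List (Assignment n))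
                 (n≤Z : n ≤ Z) (F≤Z : length F ≤ Z) (k≤Z : k ≤ Z) (F-width : F IsCNFOfWidth k) (V≤n : length V ≤ n)
                 (Y≤Z : length Y ≤ Z) (Y-scores : ∀ z → scoreOf z Y ≤ Z * Z) where
  open Routines Z 2≤Z
  open Search F V Y n≤Z F≤Z (AllP.map (λ C≤k → ≤-trans C≤k k≤Z) F-width) (≤-trans V≤n n≤Z) Y≤Z Y-scores
  open Exploration F V Y
  instance
    k-nonZero : NonZero k
    k-nonZero = k≢0

  -- Induction on a bound for the potential of the stack: every expansion decreases it strictly, so
  -- it also bounds the number of iterations.
  exploring : ∀ p st best → totalPotential k st ≤ p → ∃[ best′ ] ∃[ i ] i ≤ p × Improves best best′ × DominatesReach st best′ ×
    (∀ {ρ t} → t ∙ encodeAssignments Y ∙ encodeCNF F ∙ encodeClause V ∙ ρ ⊢while hd (var 0) body expand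
       from encodeTasks st ∙ encodeBest best ⇓ nil ∙ encodeBest best′ [ i × 1 ])
  exploring p       []          best _ = best , 0 , z≤n , inj₁ refl , (λ ()) , stop refl
  exploring zero    (task ∷ st) best b = ⊥-elim (<⇒≱ (potential-positive k task) (≤-trans (m≤m+n _ _) b))
  exploring (suc p) (task ∷ st) best b
    with exploring p _ (proj₂ (expanded F V Y task st best))
           (≤-pred (≤-trans (expanded-potential k F V Y F-width V≤n task st best) b))
  ... | best′ , i , i≤ , imp , dom , go = best′ , suc i , s≤s i≤ ,
        improves-trans (expanded-improves task st best) imp , dominates , again refl (expand-⇓ task st best) go
    where
    dominates : DominatesReach (task ∷ st) best′
    dominates (there t∈) reach adm = dom (expanded-stack task st best t∈) reach adm
    dominates {a} {r} {j} (here refl) reach adm with expanded-reach a r j st best reach adm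
    ... | inj₁ c≼                       = ≼-trans c≼ (improves⇒≼ imp)
    ... | inj₂ (_ , _ , _ , t∈ , reach′) = dom t∈ reach′ adm

  searching : ∀ {γ} .{{_ : NonZero γ}} st best → totalPotential k st ≤ γ * Z ^ 10 →
    ∃[ best′ ] Improves best best′ × DominatesReach st best′ ×
    (∀ {ρ} → encodeBest best ∙ encodeAssignments Y ∙ encodeCNF F ∙ encodeClause V ∙
              encodeTasks st ∙ ρ ⊢ search ⇓ encodeBest best′ [ γ ])
  searching st best b with exploring _ st best b
  ... | best′ , i , i≤ , imp , dom , go = best′ , imp , dom ,
        (looping (≤-trans (≤-reflexive (*-identityʳ i)) i≤) (return _) go then return _)

-- The Hamming metric

δ : Bool → Bool → ℕ
δ true  true  = 0
δ true  false = 1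
δ false true  = 1
δ false false = 0

dH-∷ : ∀ {n} b c (y z : Assignment n) → dH (b ∷ y) (c ∷ z) ≡ δ b c + dH y z
dH-∷ true  true  y z = refl
dH-∷ true  false y z = refl
dH-∷ false true  y z = refl
dH-∷ false false y z = refl

dH-refl : ∀ {n} (z : Assignment n) → dH z z ≡ 0
dH-refl []          = refl
dH-refl (true ∷ z)  = dH-refl z
dH-refl (false ∷ z) = dH-refl z

δ-sym : ∀ b c → δ b c ≡ δ c b
δ-sym true  true  = refl
δ-sym true  false = refl
δ-sym false true  = refl
δ-sym false false = refl

dH-sym : ∀ {n} (y z : Assignment n) → dH y z ≡ dH z y
dH-sym []      []      = refl
dH-sym (b ∷ y) (c ∷ z) = trans (dH-∷ b c y z) (trans (cong₂ _+_ (δ-sym b c) (dH-sym y z)) (sym (dH-∷ c b z y)))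

δ-triangle : ∀ a b c → δ a c ≤ δ a b + δ b c
δ-triangle true  b     true  = z≤n
δ-triangle true  true  false = s≤s z≤n
δ-triangle true  false false = s≤s z≤n
δ-triangle false true  true  = s≤s z≤n
δ-triangle false false true  = s≤s z≤n
δ-triangle false b     false = z≤n

dH-triangle : ∀ {n} (x y z : Assignment n) → dH x z ≤ dH x y + dH y z
dH-triangle []      []      []      = z≤n
dH-triangle (a ∷ x) (b ∷ y) (c ∷ z) = begin
  dH (a ∷ x) (c ∷ z)                        ≡⟨ dH-∷ a c x z ⟩
  δ a c + dH x z                            ≤⟨ +-mono-≤ (δ-triangle a b c) (dH-triangle x y z) ⟩
  (δ a b + δ b c) + (dH x y + dH y z)       ≡⟨ solve 4 (λ p q r s → (p :+ q) :+ (r :+ s) :≡ (p :+ r) :+ (q :+ s)) refl (δ a b) (δ b c) (dH x y) (dH y z) ⟩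
  (δ a b + dH x y) + (δ b c + dH y z)       ≡⟨ cong₂ _+_ (dH-∷ a b x y) (dH-∷ b c y z) ⟨
  dH (a ∷ x) (b ∷ y) + dH (b ∷ y) (c ∷ z)   ∎
  where
  open ≤-Reasoning

dH≡0⇒≡ : ∀ {n} (y z : Assignment n) → dH y z ≡ 0 → y ≡ z
dH≡0⇒≡ []          []          _ = refl
dH≡0⇒≡ (true ∷ y)  (true ∷ z)  e = cong (true ∷_) (dH≡0⇒≡ y z e)
dH≡0⇒≡ (false ∷ y) (false ∷ z) e = cong (false ∷_) (dH≡0⇒≡ y z e)

dH≤n : ∀ {n} (y z : Assignment n) → dH y z ≤ n
dH≤n []          []          = z≤n
dH≤n (true ∷ y)  (true ∷ z)  = m≤n⇒m≤1+n (dH≤n y z)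
dH≤n (true ∷ y)  (false ∷ z) = s≤s (dH≤n y z)
dH≤n (false ∷ y) (true ∷ z)  = s≤s (dH≤n y z)
dH≤n (false ∷ y) (false ∷ z) = m≤n⇒m≤1+n (dH≤n y z)

addDistance-dH : ∀ {n} m (a b : Assignment n) → addDistance m a b ≡ m + dH a b
addDistance-dH m []          []          = sym (+-identityʳ m)
addDistance-dH m (true ∷ a)  (true ∷ b)  = addDistance-dH m a b
addDistance-dH m (true ∷ a)  (false ∷ b) = trans (addDistance-dH (suc m) a b) (sym (+-suc m _))
addDistance-dH m (false ∷ a) (true ∷ b)  = trans (addDistance-dH (suc m) a b) (sym (+-suc m _))
addDistance-dH m (false ∷ a) (false ∷ b) = addDistance-dH m a b

distanceSum : ∀ {n} → Assignment n → List (Assignment n) → ℕ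
distanceSum z Y = sum (map (dH z) Y)

scoreOf≡distanceSum : ∀ {n} (z : Assignment n) Y → scoreOf z Y ≡ distanceSum z Y
scoreOf≡distanceSum z = go 0
  where
  go : ∀ m Y → foldl (λ m y → addDistance m z y) m Y ≡ m + distanceSum z Y
  go m []      = sym (+-identityʳ m)
  go m (y ∷ Y) = trans (go _ Y) (trans (cong (_+ distanceSum z Y) (addDistance-dH m z y)) (+-assoc m _ _))

distanceSum≤ : ∀ {n} (z : Assignment n) Y → distanceSum z Y ≤ length Y * n
distanceSum≤ z []      = z≤n
distanceSum≤ z (y ∷ Y) = +-mono-≤ (dH≤n z y) (distanceSum≤ z Y)

memberOf-false : ∀ {n} (z : Assignment n) Y → memberOf z Y ≡ false → z ∉ Y
memberOf-false z Y = go Y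
  where
  update′ : Bool → Assignment _ → Bool
  update′ m y = if positive (addDistance 0 z y) then m else true
  true-stays : ∀ Y → foldl update′ true Y ≡ true
  true-stays []      = refl
  true-stays (y ∷ Y) with addDistance 0 z y
  ... | zero  = true-stays Y
  ... | suc _ = true-stays Y
  go : ∀ {m} Y → foldl update′ m Y ≡ false → z ∉ Y
  go (y ∷ Y) eq z∈ with addDistance 0 z y in d
  go (y ∷ Y) eq z∈           | zero  = BoolP.not-¬ (true-stays Y) eq
  go (y ∷ Y) eq (here refl)  | suc _ = 0≢1+n (trans (sym (trans (addDistance-dH 0 z z) (dH-refl z))) d)
  go (y ∷ Y) eq (there z∈)   | suc _ = go Y eq z∈

memberOf-true : ∀ {n} (z : Assignment n) Y → memberOf z Y ≡ true → z ∈ Y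
memberOf-true z Y eq with go Y eq
  where
  update′ : Bool → Assignment _ → Bool
  update′ m y = if positive (addDistance 0 z y) then m else true
  go : ∀ {m} Y → foldl update′ m Y ≡ true → m ≡ true ⊎ z ∈ Y
  go []      eq = inj₁ eq
  go (y ∷ Y) eq with addDistance 0 z y in d
  ... | zero  = inj₂ (here (dH≡0⇒≡ z y (trans (sym (addDistance-dH 0 z y)) d)))
  ... | suc _ with go Y eq
  ...   | inj₁ m≡ = inj₁ m≡
  ...   | inj₂ z∈ = inj₂ (there z∈)
... | inj₂ z∈ = z∈

agreesOf-true : ∀ {n} (l : Literal n) a → agreesOf l a ≡ true → lookup a (proj₁ l) ≡ proj₂ l
agreesOf-true (x , b) a eq with lookup a x
agreesOf-true (x , true)  a eq | true  = refl
agreesOf-true (x , false) a eq | false = refl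

agreesOf-false : ∀ {n} (l : Literal n) a → agreesOf l a ≡ false → lookup a (proj₁ l) ≢ proj₂ l
agreesOf-false (x , b) a eq eq′ with lookup a x
agreesOf-false (x , true)  a () refl | true
agreesOf-false (x , false) a () refl | false

satisfiedBy-true : ∀ {n} (a : Assignment n) C → satisfiedBy a C ≡ true → Any (λ (x , b) → lookup a x ≡ b) C
satisfiedBy-true a C eq with go C eq
  where
  go : ∀ {m} C → foldl (λ m l → if agreesOf l a then true else m) m C ≡ true → m ≡ true ⊎ Any (λ (x , b) → lookup a x ≡ b) C
  go []      eq = inj₁ eq
  go (l ∷ C) eq with agreesOf l a in ag
  ... | true  = inj₂ (here (agreesOf-true l a ag))
  ... | false with go C eq
  ...   | inj₁ m≡ = inj₁ m≡
  ...   | inj₂ ac = inj₂ (there ac)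
... | inj₂ ac = ac

satisfiedBy-false : ∀ {n} (a : Assignment n) C → satisfiedBy a C ≡ false → All (λ (x , b) → lookup a x ≢ b) C
satisfiedBy-false a C eq = go C eq
  where
  update′ : Bool → Literal _ → Bool
  update′ m l = if agreesOf l a then true else m
  true-stays : ∀ C → foldl update′ true C ≡ true
  true-stays []      = refl
  true-stays (l ∷ C) with agreesOf l a
  ... | true  = true-stays C
  ... | false = true-stays C
  go : ∀ {m} C → foldl update′ m C ≡ false → All (λ (x , b) → lookup a x ≢ b) C
  go []      eq = []
  go (l ∷ C) eq with agreesOf l a in ag
  ... | true  = ⊥-elim (BoolP.not-¬ (true-stays C) eq)
  ... | false = agreesOf-false l a ag ∷ go C eq

falsifiedClause-nothing : ∀ {n} (F : CNF n) a → falsifiedClause F a ≡ nothing → a ⊨ F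
falsifiedClause-nothing F a eq = go F eq
  where
  update′ : Maybe (Clause _) → Clause _ → Maybe (Clause _)
  update′ m C = if satisfiedBy a C then m else just C
  stays : ∀ {C} F → foldl update′ (just C) F ≢ nothing
  stays []      ()
  stays (C ∷ F) eq with satisfiedBy a C
  ... | true  = stays F eq
  ... | false = stays F eq
  go : ∀ {m} F → foldl update′ m F ≡ nothing → a ⊨ F
  go []      eq = []
  go (C ∷ F) eq with satisfiedBy a C in s
  ... | true  = satisfiedBy-true a C s ∷ go F eq
  ... | false = ⊥-elim (stays F eq)

falsifiedClause-just : ∀ {n} (F : CNF n) a {C} → falsifiedClause F a ≡ just C → C ∈ F × All (λ (x , b) → lookup a x ≢ b) C
falsifiedClause-just F a {C} eq with go F eq
  where
  go : ∀ {m} F → foldl (λ m C → if satisfiedBy a C then m else just C) m F ≡ just C →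
       m ≡ just C ⊎ C ∈ F × All (λ (x , b) → lookup a x ≢ b) C
  go []      eq = inj₁ eq
  go (D ∷ F) eq with satisfiedBy a D in s
  ... | true with go F eq
  ...   | inj₁ m≡        = inj₁ m≡
  ...   | inj₂ (C∈ , C✗) = inj₂ (there C∈ , C✗)
  go (D ∷ F) eq | false with go F eq
  ... | inj₁ refl      = inj₂ (here refl , satisfiedBy-false a D s)
  ... | inj₂ (C∈ , C✗) = inj₂ (there C∈ , C✗)
... | inj₂ r = r

-- Exploring the surroundings of a centre

flipAt-closer : ∀ {n} x (a z : Assignment n) → lookup a x ≢ lookup z x → suc (dH (flipAt x a) z) ≡ dH a z
flipAt-closer zero    (true ∷ a)  (true ∷ z)  ne = ⊥-elim (ne refl)
flipAt-closer zero    (true ∷ a)  (false ∷ z) ne = refl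
flipAt-closer zero    (false ∷ a) (true ∷ z)  ne = refl
flipAt-closer zero    (false ∷ a) (false ∷ z) ne = ⊥-elim (ne refl)
flipAt-closer (suc x) (b ∷ a)     (c ∷ z)     ne = begin
  suc (dH (b ∷ flipAt x a) (c ∷ z))   ≡⟨ cong suc (dH-∷ b c (flipAt x a) z) ⟩
  suc (δ b c + dH (flipAt x a) z)     ≡⟨ +-suc (δ b c) _ ⟨
  δ b c + suc (dH (flipAt x a) z)     ≡⟨ cong (δ b c +_) (flipAt-closer x a z ne) ⟩
  δ b c + dH a z                      ≡⟨ dH-∷ b c a z ⟨
  dH (b ∷ a) (c ∷ z)                  ∎
  where open ≡-Reasoning

dH-flipAt : ∀ {n} x (a : Assignment n) → dH a (flipAt x a) ≡ 1
dH-flipAt zero    (true ∷ a)  = cong suc (dH-refl a)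
dH-flipAt zero    (false ∷ a) = cong suc (dH-refl a)
dH-flipAt (suc x) (true ∷ a)  = dH-flipAt x a
dH-flipAt (suc x) (false ∷ a) = dH-flipAt x a

differ-somewhere : ∀ {n} (a z : Assignment n) → a ≢ z → ∃[ x ] lookup a x ≢ lookup z x
differ-somewhere []      []      ne = ⊥-elim (ne refl)
differ-somewhere (b ∷ a) (c ∷ z) ne with b BoolP.≟ c
... | no b≢c = zero , b≢c
... | yes refl with differ-somewhere a z (ne ∘ cong (b ∷_))
...   | x , d = suc x , d

-- Measures how many forbidden solutions a path that approaches z can still meet.
nearby : ∀ {n} → Assignment n → ℕ → List (Assignment n) → ℕ
nearby z d []      = 0
nearby z d (y ∷ Y) with dH y z ≤? d
... | yes _ = suc (nearby z d Y)
... | no  _ = nearby z d Y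

nearby≤length : ∀ {n} (z : Assignment n) d Y → nearby z d Y ≤ length Y
nearby≤length z d []      = z≤n
nearby≤length z d (y ∷ Y) with dH y z ≤? d
... | yes _ = s≤s (nearby≤length z d Y)
... | no  _ = m≤n⇒m≤1+n (nearby≤length z d Y)

nearby-mono : ∀ {n} (z : Assignment n) d Y → nearby z d Y ≤ nearby z (suc d) Y
nearby-mono z d []      = z≤n
nearby-mono z d (y ∷ Y) with dH y z ≤? d | dH y z ≤? suc d
... | yes _ | yes _  = s≤s (nearby-mono z d Y)
... | yes p | no ¬p  = ⊥-elim (¬p (m≤n⇒m≤1+n p))
... | no _  | yes _  = m≤n⇒m≤1+n (nearby-mono z d Y)
... | no _  | no _   = nearby-mono z d Y

nearby-strict : ∀ {n} (z : Assignment n) d {Y a} → a ∈ Y → dH a z ≡ suc d → nearby z d Y < nearby z (suc d) Y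
nearby-strict z d {a ∷ Y} (here refl) eq with dH a z ≤? d | dH a z ≤? suc d
... | yes p | _      = ⊥-elim (1+n≰n (subst (_≤ d) eq p))
... | no _  | yes _  = s≤s (nearby-mono z d Y)
... | no _  | no ¬p  = ⊥-elim (¬p (≤-reflexive eq))
nearby-strict z d {y ∷ Y} (there a∈) eq with dH y z ≤? d | dH y z ≤? suc d
... | yes _ | yes _  = s≤s (nearby-strict z d a∈ eq)
... | yes p | no ¬p  = ⊥-elim (¬p (m≤n⇒m≤1+n p))
... | no _  | yes _  = m≤n⇒m≤1+n (nearby-strict z d a∈ eq)
... | no _  | no _   = nearby-strict z d a∈ eq

satisfying-literal : ∀ {n} (z : Assignment n) {C} → Any (λ (x , b) → lookup z x ≡ b) C →
                     ∃[ l ] l ∈ C × lookup z (proj₁ l) ≡ proj₂ l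
satisfying-literal z (here {l} eq) = l , here refl , eq
satisfying-literal z (there p) with satisfying-literal z p
... | l , l∈ , eq = l , there l∈ , eq

module _ {n : ℕ} (F : CNF n) (V : Clause n) (Y : List (Assignment n)) where
  open Exploration F V Y

  -- On the way to z every member of Y is met at most once, as the distance
  -- to z decreases; this is what the budget j pays for.
  reach-near : (∀ x → ∃[ b ] (x , b) ∈ V) → ∀ {z} → z ⊨ F → z ∉ Y → ∀ r j a → dH a z ≤ r → nearby z (dH a z) Y ≤ j →
               ∃[ c ] Reach r j a c × Admissible c × dH a c ≤ r
  reach-near all-V {z} z⊨F z∉Y r j a d≤r nearby≤j with falsifiedClause F a in fc
  ... | just C with falsifiedClause-just F a fc
  ...   | C∈F , a⊭C with satisfying-literal z (AllP.lookup z⊨F C∈F)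
  ...     | (x , b) , l∈C , zx≡b = descend r d≤r (flipAt-closer x a z λ eq → AllP.lookup a⊭C l∈C (trans eq zx≡b))
    where
    descend : ∀ r → dH a z ≤ r → suc (dH (flipAt x a) z) ≡ dH a z → ∃[ c ] Reach r j a c × Admissible c × dH a c ≤ r
    descend zero    d≤ closer = ⊥-elim (1+n≰n (≤-trans (≤-reflexive closer) (≤-trans d≤ z≤n)))
    descend (suc r) d≤ closer
      with reach-near all-V z⊨F z∉Y r j (flipAt x a) (≤-pred (≤-trans (≤-reflexive closer) d≤))
             (≤-trans (nearby-mono z _ Y) (≤-trans (≤-reflexive (cong (λ d → nearby z d Y) closer)) nearby≤j))
    ... | c , reach , adm , near = c , unsat fc l∈C reach , adm ,
          ≤-trans (dH-triangle a (flipAt x a) c) (+-mono-≤ (≤-reflexive (dH-flipAt x a)) near)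
  reach-near all-V {z} z⊨F z∉Y r j a d≤r nearby≤j | nothing with memberOf a Y in a∈?
  -- An admissible solution met before z ends the walk: only its distance from the centre matters,
  -- not how close it is to z.
  ... | false = a , visit , (fc , a∈?) , ≤-trans (≤-reflexive (dH-refl a)) z≤n
  -- A forbidden solution is not z, so some coordinate can be corrected; V contains it, although no
  -- clause points to it.
  ... | true with differ-somewhere a z (λ { refl → z∉Y (memberOf-true a Y a∈?) })
  ...   | x , ne with all-V x
  ...     | b , l∈V = descend r j d≤r (flipAt-closer x a z ne) nearby≤j
    where
    descend : ∀ r j → dH a z ≤ r → suc (dH (flipAt x a) z) ≡ dH a z → nearby z (dH a z) Y ≤ j →
              ∃[ c ] Reach r j a c × Admissible c × dH a c ≤ r
    descend zero    j d≤ closer near≤ = ⊥-elim (1+n≰n (≤-trans (≤-reflexive closer) (≤-trans d≤ z≤n)))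
    descend (suc r) j d≤ closer near≤
      with ≤-trans (nearby-strict z _ (memberOf-true a Y a∈?) (sym closer))
                   (≤-trans (≤-reflexive (cong (λ d → nearby z d Y) closer)) near≤)
    descend (suc r) (suc j) d≤ closer near≤ | s≤s lt
      with reach-near all-V z⊨F z∉Y r j (flipAt x a) (≤-pred (≤-trans (≤-reflexive closer) d≤)) lt
    ... | c , reach , adm , near = c , sat fc l∈V reach , adm ,
          ≤-trans (dH-triangle a (flipAt x a) c) (+-mono-≤ (≤-reflexive (dH-flipAt x a)) near)

-- Weighing the coordinates in which the centre is wrong

errors : ∀ {n} → Assignment n → Assignment n → Vec Bool n
errors = zipWith _xor_

weight : ∀ {n} → Vec ℕ n → Vec Bool n → ℕ
weight []      []          = 0
weight (w ∷ u) (true ∷ e)  = w + weight u e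
weight (w ∷ u) (false ∷ e) = weight u e

total : ∀ {n} → Vec ℕ n → ℕ
total []      = 0
total (w ∷ u) = w + total u

differences : ∀ {n} → Assignment n → Assignment n → Vec ℕ n
differences = zipWith δ

-- Coordinate x is weighted by the number of members of Y that differ from z at x.
weights : ∀ {n} → Assignment n → List (Assignment n) → Vec ℕ n
weights z []      = replicate _ 0
weights z (y ∷ Y) = zipWith _+_ (differences z y) (weights z Y)

weight-+ : ∀ {n} (u v : Vec ℕ n) e → weight (zipWith _+_ u v) e ≡ weight u e + weight v e
weight-+ []      []      []          = refl
weight-+ (a ∷ u) (b ∷ v) (false ∷ e) = weight-+ u v e
weight-+ (a ∷ u) (b ∷ v) (true ∷ e)  = trans (cong (a + b +_) (weight-+ u v e))
  (solve 4 (λ p q r s → (p :+ q) :+ (r :+ s) :≡ (p :+ r) :+ (q :+ s)) refl a b (weight u e) (weight v e))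

total-+ : ∀ {n} (u v : Vec ℕ n) → total (zipWith _+_ u v) ≡ total u + total v
total-+ []      []      = refl
total-+ (a ∷ u) (b ∷ v) = trans (cong (a + b +_) (total-+ u v))
  (solve 4 (λ p q r s → (p :+ q) :+ (r :+ s) :≡ (p :+ r) :+ (q :+ s)) refl a b (total u) (total v))

total-0 : ∀ n → total (replicate n 0) ≡ 0
total-0 zero    = refl
total-0 (suc n) = total-0 n

total-differences : ∀ {n} (z y : Assignment n) → total (differences z y) ≡ dH z y
total-differences []      []      = refl
total-differences (b ∷ z) (c ∷ y) = trans (cong (δ b c +_) (total-differences z y)) (sym (dH-∷ b c z y))

total-weights : ∀ {n} (z : Assignment n) Y → total (weights z Y) ≡ distanceSum z Y
total-weights {n} z [] = total-0 n
total-weights z (y ∷ Y) = trans (total-+ (differences z y) (weights z Y)) (cong₂ _+_ (total-differences z y) (total-weights z Y))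

-- Coordinatewise: in an error coordinate y differs from exactly one of a and z, so there the
-- distances of y from a and from z add up to 1; elsewhere these distances coincide.
dH-errors : ∀ {n} (a z y : Assignment n) → dH a y + 2 * weight (differences z y) (errors a z) ≡ dH z y + dH a z
dH-errors []      []      []      = refl
dH-errors (a ∷ as) (b ∷ z) (c ∷ y) = begin
  dH (a ∷ as) (c ∷ y) + 2 * weight (δ b c ∷ differences z y) ((a xor b) ∷ errors as z)
    ≡⟨ cong₂ (λ p q → p + 2 * q) (dH-∷ a c as y) (head (a xor b)) ⟩
  (δ a c + dH as y) + 2 * (bit a b c + weight (differences z y) (errors as z))
    ≡⟨ solve 4 (λ p q r s → (p :+ q) :+ con 2 :* (r :+ s) :≡ (p :+ con 2 :* r) :+ (q :+ con 2 :* s)) refl (δ a c) (dH as y) (bit a b c) _ ⟩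
  (δ a c + 2 * bit a b c) + (dH as y + 2 * weight (differences z y) (errors as z))
    ≡⟨ cong₂ _+_ (bits a b c) (dH-errors as z y) ⟩
  (δ b c + δ a b) + (dH z y + dH as z)
    ≡⟨ solve 4 (λ p q r s → (p :+ q) :+ (r :+ s) :≡ (p :+ r) :+ (q :+ s)) refl (δ b c) (δ a b) (dH z y) (dH as z) ⟩
  (δ b c + dH z y) + (δ a b + dH as z)
    ≡⟨ cong₂ _+_ (dH-∷ b c z y) (dH-∷ a b as z) ⟨
  dH (b ∷ z) (c ∷ y) + dH (a ∷ as) (b ∷ z) ∎
  where
  open ≡-Reasoning
  bit : Bool → Bool → Bool → ℕ
  bit a b c = if a xor b then δ b c else 0
  head : ∀ t → weight (δ b c ∷ differences z y) (t ∷ errors as z) ≡ (if t then δ b c else 0) + weight (differences z y) (errors as z)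
  head true  = refl
  head false = refl
  bits : ∀ a b c → δ a c + 2 * bit a b c ≡ δ b c + δ a b
  bits true  true  true  = refl
  bits true  true  false = refl
  bits true  false true  = refl
  bits true  false false = refl
  bits false true  true  = refl
  bits false true  false = refl
  bits false false true  = refl
  bits false false false = refl

-- For each y, d(c , y) is at least d(a , y) - d(a , z), while by `dH-errors` d(a , y) is d(z , y) +
-- d(a , z) minus twice the weight of the errors. The terms d(a , z) cancel.
distanceSum-near : ∀ {n} (a z c : Assignment n) Y → dH a c ≤ dH a z →
                   distanceSum z Y ≤ distanceSum c Y + 2 * weight (weights z Y) (errors a z)
distanceSum-near a z c []      near = z≤n
distanceSum-near a z c (y ∷ Y) near = begin
  dH z y + distanceSum z Y                          ≤⟨ +-mono-≤ one (distanceSum-near a z c Y near) ⟩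
  (dH c y + 2 * u) + (distanceSum c Y + 2 * v)      ≡⟨ solve 4 (λ p q r s → (p :+ con 2 :* q) :+ (r :+ con 2 :* s) :≡ (p :+ r) :+ con 2 :* (q :+ s)) refl (dH c y) u (distanceSum c Y) v ⟩
  (dH c y + distanceSum c Y) + 2 * (u + v)          ≡⟨ cong (λ m → dH c y + distanceSum c Y + 2 * m) (weight-+ (differences z y) (weights z Y) (errors a z)) ⟨
  distanceSum c (y ∷ Y) + 2 * weight (weights z (y ∷ Y)) (errors a z) ∎
  where
  open ≤-Reasoning
  u = weight (differences z y) (errors a z)
  v = weight (weights z Y) (errors a z)
  one : dH z y ≤ dH c y + 2 * u
  one = +-cancelʳ-≤ (dH a z) (dH z y) (dH c y + 2 * u) (begin
    dH z y + dH a z               ≡⟨ dH-errors a z y ⟨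
    dH a y + 2 * u                ≤⟨ +-monoˡ-≤ (2 * u) (dH-triangle a c y) ⟩
    dH a c + dH c y + 2 * u       ≤⟨ +-monoˡ-≤ (2 * u) (+-monoˡ-≤ (dH c y) near) ⟩
    dH a z + dH c y + 2 * u       ≡⟨ solve 3 (λ p q r → (p :+ q) :+ con 2 :* r :≡ (q :+ con 2 :* r) :+ p) refl (dH a z) (dH c y) u ⟩
    dH c y + 2 * u + dH a z       ∎)

distanceSum-ratio : ∀ {n} k .{{_ : NonZero k}} (a z c : Assignment n) Y → dH a c ≤ dH a z →
                    suc k * weight (weights z Y) (errors a z) ≤ total (weights z Y) →
                    (k ∸ 1) * distanceSum z Y ≤ suc k * distanceSum c Y
distanceSum-ratio (suc k) a z c Y near light = +-cancelʳ-≤ (2 * distanceSum z Y) _ _ (begin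
  k * distanceSum z Y + 2 * distanceSum z Y              ≡⟨ *-distribʳ-+ (distanceSum z Y) k 2 ⟨
  (k + 2) * distanceSum z Y                              ≡⟨ cong (_* distanceSum z Y) (+-comm k 2) ⟩
  suc (suc k) * distanceSum z Y                          ≤⟨ *-monoʳ-≤ (suc (suc k)) (distanceSum-near a z c Y near) ⟩
  suc (suc k) * (distanceSum c Y + 2 * w)                ≡⟨ solve 3 (λ p q r → p :* (q :+ con 2 :* r) :≡ p :* q :+ con 2 :* (p :* r)) refl (suc (suc k)) (distanceSum c Y) w ⟩
  suc (suc k) * distanceSum c Y + 2 * (suc (suc k) * w)  ≤⟨ +-monoʳ-≤ (suc (suc k) * distanceSum c Y) (*-monoʳ-≤ 2 (≤-trans light (≤-reflexive (total-weights z Y)))) ⟩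
  suc (suc k) * distanceSum c Y + 2 * distanceSum z Y    ∎)
  where
  open ≤-Reasoning
  w = weight (weights z Y) (errors a z)

-- Sums over all bit vectors

ΣB : ∀ n → (Vec Bool n → ℕ) → ℕ
ΣB zero    f = f []
ΣB (suc n) f = ΣB n (f ∘ (false ∷_)) + ΣB n (f ∘ (true ∷_))

ΣB-cong : ∀ n {f g : Vec Bool n → ℕ} → (∀ e → f e ≡ g e) → ΣB n f ≡ ΣB n g
ΣB-cong zero    eq = eq []
ΣB-cong (suc n) eq = cong₂ _+_ (ΣB-cong n (eq ∘ _)) (ΣB-cong n (eq ∘ _))

ΣB-mono : ∀ n {f g : Vec Bool n → ℕ} → (∀ e → f e ≤ g e) → ΣB n f ≤ ΣB n g
ΣB-mono zero    le = le []
ΣB-mono (suc n) le = +-mono-≤ (ΣB-mono n (le ∘ _)) (ΣB-mono n (le ∘ _))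

+-interchange : ∀ a b c d → (a + b) + (c + d) ≡ (a + c) + (b + d)
+-interchange = solve 4 (λ p q r s → (p :+ q) :+ (r :+ s) :≡ (p :+ r) :+ (q :+ s)) refl

ΣB-+ : ∀ n (f g : Vec Bool n → ℕ) → ΣB n (λ e → f e + g e) ≡ ΣB n f + ΣB n g
ΣB-+ zero    f g = refl
ΣB-+ (suc n) f g = trans (cong₂ _+_ (ΣB-+ n _ _) (ΣB-+ n _ _)) (+-interchange (ΣB n (f ∘ (false ∷_))) _ _ _)

ΣB-* : ∀ n c (f : Vec Bool n → ℕ) → ΣB n (λ e → c * f e) ≡ c * ΣB n f
ΣB-* zero    c f = refl
ΣB-* (suc n) c f = trans (cong₂ _+_ (ΣB-* n c _) (ΣB-* n c _)) (sym (*-distribˡ-+ c _ _))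

ΣB-const : ∀ n c → ΣB n (λ _ → c) ≡ 2 ^ n * c
ΣB-const zero    c = sym (+-identityʳ c)
ΣB-const (suc n) c = trans (cong₂ _+_ (ΣB-const n c) (ΣB-const n c))
  (solve 2 (λ p c → p :* c :+ p :* c :≡ (con 2 :* p) :* c) refl (2 ^ n) c)

-- Adding z permutes the bit vectors, so a uniform centre has a uniform error pattern, whatever z
-- is.
ΣB-errors : ∀ {n} (z : Assignment n) f → ΣB n (λ a → f (errors a z)) ≡ ΣB n f
ΣB-errors []          f = refl
ΣB-errors (false ∷ z) f = cong₂ _+_ (ΣB-errors z (f ∘ (false ∷_))) (ΣB-errors z (f ∘ (true ∷_)))
ΣB-errors (true ∷ z)  f = trans (cong₂ _+_ (ΣB-errors z (f ∘ (true ∷_))) (ΣB-errors z (f ∘ (false ∷_)))) (+-comm (ΣB _ (f ∘ (true ∷_))) _)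

ΣB-++ : ∀ m n (f : Vec Bool (m + n) → ℕ) → ΣB (m + n) f ≡ ΣB m (λ a → ΣB n (λ b → f (a ++ᵛ b)))
ΣB-++ zero    n f = refl
ΣB-++ (suc m) n f = cong₂ _+_ (ΣB-++ m n _) (ΣB-++ m n _)

ΣB-positive : ∀ n {f : Vec Bool n → ℕ} → ΣB n f ≡ 0 → ∀ e → f e ≡ 0
ΣB-positive zero    eq []          = eq
ΣB-positive (suc n) eq (false ∷ e) = ΣB-positive n (m+n≡0⇒m≡0 _ eq) e
ΣB-positive (suc n) {f} eq (true ∷ e)  = ΣB-positive n (m+n≡0⇒n≡0 (ΣB n (f ∘ (false ∷_))) eq) e

indicator : Bool → ℕ
indicator b = if b then 1 else 0

length-filter-map : ∀ {A B : Set} {P : Pred B 0ℓ} (P? : Decidable P) (f : A → B) xs →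
                    length (filter P? (map f xs)) ≡ length (filter (P? ∘ f) xs)
length-filter-map P? f []       = refl
length-filter-map P? f (x ∷ xs) with does (P? (f x))
... | true  = cong suc (length-filter-map P? f xs)
... | false = length-filter-map P? f xs

length-filter-bitVectors : ∀ n {P : Pred (Vec Bool n) 0ℓ} (P? : Decidable P) →
                           length (filter P? (bitVectors n)) ≡ ΣB n (λ e → indicator (does (P? e)))
length-filter-bitVectors zero    P? with does (P? [])
... | true  = refl
... | false = refl
length-filter-bitVectors (suc n) P? = begin
  length (filter P? (map (false ∷_) (bitVectors n) ++ (map (true ∷_) (bitVectors n) ++ [])))
    ≡⟨ cong (λ l → length (filter P? (map (false ∷_) (bitVectors n) ++ l))) (++-identityʳ _) ⟩
  length (filter P? (map (false ∷_) (bitVectors n) ++ map (true ∷_) (bitVectors n)))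
    ≡⟨ cong length (filter-++ P? (map (false ∷_) (bitVectors n)) _) ⟩
  length (filter P? (map (false ∷_) (bitVectors n)) ++ filter P? (map (true ∷_) (bitVectors n)))
    ≡⟨ length-++ (filter P? (map (false ∷_) (bitVectors n))) ⟩
  length (filter P? (map (false ∷_) (bitVectors n))) + length (filter P? (map (true ∷_) (bitVectors n)))
    ≡⟨ cong₂ _+_ (half false) (half true) ⟩
  ΣB (suc n) (λ e → indicator (does (P? e))) ∎
  where
  open ≡-Reasoning
  half : ∀ b → length (filter P? (map (b ∷_) (bitVectors n))) ≡ ΣB n (λ e → indicator (does (P? (b ∷ e))))
  half b = trans (length-filter-map P? (b ∷_) (bitVectors n)) (length-filter-bitVectors n (P? ∘ (b ∷_)))

-- Error patterns of binomial size and small weight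

ones : ∀ {n} → Vec Bool n → ℕ
ones []          = 0
ones (true ∷ e)  = suc (ones e)
ones (false ∷ e) = ones e

ones≤ : ∀ {n} (e : Vec Bool n) → ones e ≤ n
ones≤ []          = z≤n
ones≤ (true ∷ e)  = s≤s (ones≤ e)
ones≤ (false ∷ e) = m≤n⇒m≤1+n (ones≤ e)

ones-errors : ∀ {n} (a z : Assignment n) → ones (errors a z) ≡ dH a z
ones-errors []          []          = refl
ones-errors (true ∷ a)  (true ∷ z)  = ones-errors a z
ones-errors (true ∷ a)  (false ∷ z) = cong suc (ones-errors a z)
ones-errors (false ∷ a) (true ∷ z)  = cong suc (ones-errors a z)
ones-errors (false ∷ a) (false ∷ z) = ones-errors a z

-- Up to normalisation, the distribution in which each coordinate is an
-- error with probability 1 / (k + 1).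
likelihood : ∀ {n} → ℕ → Vec Bool n → ℕ
likelihood k []          = 1
likelihood k (true ∷ e)  = likelihood k e
likelihood k (false ∷ e) = k * likelihood k e

-- The likelihood is k ^ (n - ones e), stated without subtraction; it depends on the size of the
-- pattern alone.
likelihood-ones : ∀ {n} k (e : Vec Bool n) → likelihood k e * k ^ ones e ≡ k ^ n
likelihood-ones k []          = refl
likelihood-ones k (true ∷ e)  = trans (solve 3 (λ p q r → p :* (q :* r) :≡ q :* (p :* r)) refl (likelihood k e) k (k ^ ones e)) (cong (k *_) (likelihood-ones k e))
likelihood-ones k (false ∷ e) = trans (*-assoc k (likelihood k e) _) (cong (k *_) (likelihood-ones k e))

ΣB-likelihood : ∀ n k → ΣB n (likelihood k) ≡ suc k ^ n
ΣB-likelihood zero    k = refl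
ΣB-likelihood (suc n) k = begin
  ΣB n (λ e → k * likelihood k e) + ΣB n (likelihood k) ≡⟨ cong₂ _+_ (ΣB-* n k _) refl ⟩
  k * ΣB n (likelihood k) + ΣB n (likelihood k)         ≡⟨ +-comm (k * ΣB n (likelihood k)) _ ⟩
  suc k * ΣB n (likelihood k)                           ≡⟨ cong (suc k *_) (ΣB-likelihood n k) ⟩
  suc k ^ suc n                                         ∎
  where open ≡-Reasoning

-- Linearity of expectation, for a distribution of total mass suc k ^ n: each coordinate contributes
-- its weight with probability 1 / (k + 1).
ΣB-likelihood-weight : ∀ {n} k (w : Vec ℕ n) → suc k * ΣB n (λ e → likelihood k e * weight w e) ≡ total w * suc k ^ n
ΣB-likelihood-weight k []      = *-zeroʳ (suc k)
ΣB-likelihood-weight {suc n} k (w ∷ u) = begin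
  suc k * (ΣB n (λ e → k * likelihood k e * weight u e) + ΣB n (λ e → likelihood k e * (w + weight u e)))
    ≡⟨ cong (suc k *_) (cong₂ _+_
         (trans (ΣB-cong n (λ e → *-assoc k (likelihood k e) (weight u e))) (ΣB-* n k _))
         (trans (ΣB-cong n (λ e → trans (*-distribˡ-+ (likelihood k e) w _) (cong (_+ likelihood k e * weight u e) (*-comm (likelihood k e) w))))
                (trans (ΣB-+ n _ _) (cong (_+ S) (trans (ΣB-* n w _) (cong (w *_) (ΣB-likelihood n k))))))) ⟩
  suc k * (k * S + (w * suc k ^ n + S))
    ≡⟨ solve 4 (λ k S w p → (con 1 :+ k) :* (k :* S :+ (w :* p :+ S)) :≡ (con 1 :+ k) :* ((con 1 :+ k) :* S) :+ w :* ((con 1 :+ k) :* p)) refl k S w (suc k ^ n) ⟩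
  suc k * (suc k * S) + w * suc k ^ suc n
    ≡⟨ cong (λ x → suc k * x + w * suc k ^ suc n) (ΣB-likelihood-weight k u) ⟩
  suc k * (total u * suc k ^ n) + w * suc k ^ suc n
    ≡⟨ solve 4 (λ k t w p → (con 1 :+ k) :* (t :* p) :+ w :* ((con 1 :+ k) :* p) :≡ (w :+ t) :* ((con 1 :+ k) :* p)) refl k (total u) w (suc k ^ n) ⟩
  (w + total u) * suc k ^ suc n ∎
  where
  open ≡-Reasoning
  S = ΣB n (λ e → likelihood k e * weight u e)

light : ∀ {n} → ℕ → Vec ℕ n → Vec Bool n → Bool
light k w e = suc k * weight w e ≤ᵇ total w

-- Markov's inequality: as weights are integers, the mean is attained with
-- probability at least 1 / (total w + 1).
light-likely : ∀ {n} k (w : Vec ℕ n) → suc k ^ n ≤ suc (total w) * ΣB n (λ e → indicator (light k w e) * likelihood k e)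
light-likely {n} k w = +-cancelʳ-≤ (total w * suc k ^ n) _ _ (begin
  suc (total w) * suc k ^ n                                       ≡⟨ cong (suc (total w) *_) (ΣB-likelihood n k) ⟨
  suc (total w) * ΣB n (likelihood k)                             ≡⟨ ΣB-* n (suc (total w)) _ ⟨
  ΣB n (λ e → suc (total w) * likelihood k e)                     ≤⟨ ΣB-mono n pointwise ⟩
  ΣB n (λ e → suc (total w) * (indicator (light k w e) * likelihood k e) + suc k * (likelihood k e * weight w e))
    ≡⟨ ΣB-+ n _ _ ⟩
  ΣB n (λ e → suc (total w) * (indicator (light k w e) * likelihood k e)) + ΣB n (λ e → suc k * (likelihood k e * weight w e))
    ≡⟨ cong₂ _+_ (ΣB-* n (suc (total w)) _) (trans (ΣB-* n (suc k) _) (ΣB-likelihood-weight k w)) ⟩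
  suc (total w) * ΣB n (λ e → indicator (light k w e) * likelihood k e) + total w * suc k ^ n ∎)
  where
  open ≤-Reasoning
  pointwise : ∀ e → suc (total w) * likelihood k e ≤
              suc (total w) * (indicator (light k w e) * likelihood k e) + suc k * (likelihood k e * weight w e)
  pointwise e with light k w e in eq
  ... | true  = ≤-trans (≤-reflexive (cong (suc (total w) *_) (sym (+-identityʳ _)))) (m≤m+n _ _)
  ... | false = begin
    suc (total w) * likelihood k e         ≤⟨ *-monoˡ-≤ (likelihood k e) (≰⇒> λ le → subst T eq (≤⇒≤ᵇ {suc k * weight w e} {total w} le)) ⟩
    -- Integrality: a left side that exceeds `total w` reaches `suc (total w)`.
    suc k * weight w e * likelihood k e    ≡⟨ trans (*-assoc (suc k) (weight w e) _) (cong (suc k *_) (*-comm (weight w e) _)) ⟩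
    suc k * (likelihood k e * weight w e)  ≤⟨ m≤n+m _ (suc (total w) * 0) ⟩
    suc (total w) * 0 + suc k * (likelihood k e * weight w e) ∎

Σ< : ℕ → (ℕ → ℕ) → ℕ
Σ< zero    f = 0
Σ< (suc m) f = f m + Σ< m f

pigeonhole : ∀ m f → ∃[ i ] i ≤ m × Σ< (suc m) f ≤ suc m * f i
pigeonhole zero    f = 0 , z≤n , ≤-refl
pigeonhole (suc m) f with pigeonhole m f
... | i , i≤m , le with ≤-total (f i) (f (suc m))
...   | inj₁ fi≤ = suc m , ≤-refl , +-monoʳ-≤ (f (suc m)) (≤-trans le (*-monoʳ-≤ (suc m) fi≤))
...   | inj₂ ≤fi = i , m≤n⇒m≤1+n i≤m , +-mono-≤ ≤fi le

Σ<-term : ∀ m f {i} → i < m → f i ≤ Σ< m f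
Σ<-term (suc m) f {i} (s≤s i≤m) with m≤n⇒m<n∨m≡n i≤m
... | inj₁ i<m  = ≤-trans (Σ<-term m f i<m) (m≤n+m _ _)
... | inj₂ refl = m≤m+n _ _

ΣB-Σ< : ∀ n m (f : ℕ → Vec Bool n → ℕ) → ΣB n (λ e → Σ< m (λ i → f i e)) ≡ Σ< m (λ i → ΣB n (f i))
ΣB-Σ< n zero    f = trans (ΣB-const n 0) (*-zeroʳ (2 ^ n))
ΣB-Σ< n (suc m) f = trans (ΣB-+ n (f m) _) (cong (ΣB n (f m) +_) (ΣB-Σ< n m f))

lightOfSize : ∀ {n} → ℕ → Vec ℕ n → ℕ → Vec Bool n → Bool
lightOfSize k w r e = (ones e ≡ᵇ r) ∧ light k w e

≡ᵇ-refl : ∀ m → (m ≡ᵇ m) ≡ true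
≡ᵇ-refl zero    = refl
≡ᵇ-refl (suc m) = ≡ᵇ-refl m

-- One of the n + 1 sizes carries at least the average share of the light mass. Patterns of that
-- size are equally likely, so multiplying by k ^ r turns their mass into k ^ n times their number.
lightOfSize-likely : ∀ {n} k (w : Vec ℕ n) → ∃[ r ] r ≤ n ×
  suc k ^ n * k ^ r ≤ suc (total w) * (suc n * (k ^ n * ΣB n (λ e → indicator (lightOfSize k w r e))))
lightOfSize-likely {n} k w with pigeonhole n (λ r → ΣB n (λ e → indicator (lightOfSize k w r e) * likelihood k e))
... | r , r≤n , le = r , r≤n , (begin
  suc k ^ n * k ^ r                                           ≤⟨ *-monoˡ-≤ (k ^ r) (light-likely k w) ⟩
  suc (total w) * ΣB n (λ e → indicator (light k w e) * likelihood k e) * k ^ r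
    ≤⟨ *-monoˡ-≤ (k ^ r) (*-monoʳ-≤ (suc (total w)) (≤-trans (ΣB-mono n by-size) (≤-trans (≤-reflexive (ΣB-Σ< n (suc n) _)) le))) ⟩
  suc (total w) * (suc n * ΣB n (λ e → indicator (lightOfSize k w r e) * likelihood k e)) * k ^ r
    ≡⟨ solve 4 (λ p q r s → p :* (q :* r) :* s :≡ p :* (q :* (s :* r))) refl (suc (total w)) (suc n) _ (k ^ r) ⟩
  suc (total w) * (suc n * (k ^ r * ΣB n (λ e → indicator (lightOfSize k w r e) * likelihood k e)))
    ≡⟨ cong (λ x → suc (total w) * (suc n * x)) (trans (sym (ΣB-* n (k ^ r) _)) (trans (ΣB-cong n normalise) (ΣB-* n (k ^ n) _))) ⟩
  suc (total w) * (suc n * (k ^ n * ΣB n (λ e → indicator (lightOfSize k w r e)))) ∎)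
  where
  open ≤-Reasoning
  by-size : ∀ e → indicator (light k w e) * likelihood k e ≤ Σ< (suc n) (λ r → indicator (lightOfSize k w r e) * likelihood k e)
  by-size e = ≤-trans (≤-reflexive (cong (λ b → indicator (b ∧ light k w e) * likelihood k e) (sym (≡ᵇ-refl (ones e)))))
                      (Σ<-term (suc n) (λ r → indicator (lightOfSize k w r e) * likelihood k e) (s≤s (ones≤ e)))
  normalise : ∀ e → k ^ r * (indicator (lightOfSize k w r e) * likelihood k e) ≡ k ^ n * indicator (lightOfSize k w r e)
  normalise e with ones e ≡ᵇ r in eq | light k w e
  ... | false | _     = trans (*-zeroʳ (k ^ r)) (sym (*-zeroʳ (k ^ n)))
  ... | true  | false = trans (*-zeroʳ (k ^ r)) (sym (*-zeroʳ (k ^ n)))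
  ... | true  | true  = trans (trans (cong (k ^ r *_) (+-identityʳ _)) (*-comm (k ^ r) _))
    (trans (cong (λ m → likelihood k e * k ^ m) (sym (≡ᵇ⇒≡ (ones e) r (subst T (sym eq) _)))) (trans (likelihood-ones k e) (sym (*-identityʳ _))))

ΣB-comm : ∀ m n (f : Vec Bool m → Vec Bool n → ℕ) → ΣB m (λ a → ΣB n (f a)) ≡ ΣB n (λ b → ΣB m (λ a → f a b))
ΣB-comm zero    n f = refl
ΣB-comm (suc m) n f = trans (cong₂ _+_ (ΣB-comm m n _) (ΣB-comm m n _)) (sym (ΣB-+ n _ _))

-- Repeated trials

^-distribʳ-* : ∀ a b c → (a * b) ^ c ≡ a ^ c * b ^ c
^-distribʳ-* a b zero    = refl
^-distribʳ-* a b (suc c) = trans (cong (a * b *_) (^-distribʳ-* a b c))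
  (solve 4 (λ x y z w → x :* y :* (z :* w) :≡ x :* z :* (y :* w)) refl a b (a ^ c) (b ^ c))

-- This is 1 + p * (g / x) ≤ (1 + g / x) ^ p, multiplied by x ^ (p + 1).
bernoulli : ∀ x g p → x * x ^ p + p * g * x ^ p ≤ (x + g) ^ p * x
bernoulli x g zero    = ≤-reflexive (solve 1 (λ x → x :* con 1 :+ con 0 :≡ con 1 :* x) refl x)
bernoulli x g (suc p) = begin
  x * (x * x ^ p) + suc p * g * (x * x ^ p)                 ≤⟨ m≤m+n _ (p * g * g * x ^ p) ⟩
  x * (x * x ^ p) + suc p * g * (x * x ^ p) + p * g * g * x ^ p
    ≡⟨ solve 4 (λ x g p q → x :* (x :* q) :+ (con 1 :+ p) :* g :* (x :* q) :+ p :* g :* g :* q :≡ (x :+ g) :* (x :* q :+ p :* g :* q)) refl x g p (x ^ p) ⟩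
  (x + g) * (x * x ^ p + p * g * x ^ p)                     ≤⟨ *-monoʳ-≤ (x + g) (bernoulli x g p) ⟩
  (x + g) * ((x + g) ^ p * x)                               ≡⟨ *-assoc (x + g) _ x ⟨
  (x + g) ^ suc p * x                                       ∎
  where open ≤-Reasoning

-- With x failing outcomes out of x + g, at least (x + g) / g independent trials all fail with
-- probability at most 1 / 2: by `bernoulli` the reciprocal (1 + g / x) ^ p is at least 1 + p * g /
-- x, hence at least 2.
halving : ∀ x g p .{{_ : NonZero g}} → x + g ≤ p * g → x ^ p * 2 ≤ (x + g) ^ p
halving zero    (suc g) (suc p) le = z≤n
halving (suc x) g       p       le = *-cancelʳ-≤ _ _ (suc x) (begin
  suc x ^ p * 2 * suc x                    ≡⟨ solve 2 (λ q x → q :* con 2 :* x :≡ x :* q :+ x :* q) refl (suc x ^ p) (suc x) ⟩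
  suc x * suc x ^ p + suc x * suc x ^ p    ≤⟨ +-monoʳ-≤ (suc x * suc x ^ p) (*-monoˡ-≤ (suc x ^ p) (≤-trans (m≤m+n (suc x) g) le)) ⟩
  suc x * suc x ^ p + p * g * suc x ^ p    ≤⟨ bernoulli (suc x) g p ⟩
  (suc x + g) ^ p * suc x                  ∎)
  where open ≤-Reasoning

-- The N trials contain l blocks of p trials, each block failing with probability at most 1 / 2; the
-- trials left over can only help.
trials : ∀ x g N l .{{_ : NonZero g}} → 2 * (l * (x + g)) ≤ N * g → x ^ N * 2 ^ l ≤ (x + g) ^ N
trials x g N l enough = begin
  x ^ N * 2 ^ l                              ≡⟨ cong (λ m → x ^ m * 2 ^ l) (m∸n+n≡m {N} {l * p} lp≤N) ⟨
  x ^ (N ∸ l * p + l * p) * 2 ^ l            ≡⟨ cong (_* 2 ^ l) (^-distribˡ-+-* x (N ∸ l * p) (l * p)) ⟩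
  x ^ (N ∸ l * p) * x ^ (l * p) * 2 ^ l      ≡⟨ cong (λ y → x ^ (N ∸ l * p) * y * 2 ^ l) (trans (cong (x ^_) (*-comm l p)) (sym (^-*-assoc x p l))) ⟩
  x ^ (N ∸ l * p) * (x ^ p) ^ l * 2 ^ l      ≡⟨ trans (*-assoc (x ^ (N ∸ l * p)) _ _) (cong (x ^ (N ∸ l * p) *_) (sym (^-distribʳ-* (x ^ p) 2 l))) ⟩
  x ^ (N ∸ l * p) * (x ^ p * 2) ^ l          ≤⟨ *-mono-≤ (^-monoˡ-≤ (N ∸ l * p) (m≤m+n x g)) (^-monoˡ-≤ l (halving x g p M≤pg)) ⟩
  (x + g) ^ (N ∸ l * p) * ((x + g) ^ p) ^ l  ≡⟨ cong ((x + g) ^ (N ∸ l * p) *_) (trans (^-*-assoc (x + g) p l) (cong ((x + g) ^_) (*-comm p l))) ⟩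
  (x + g) ^ (N ∸ l * p) * (x + g) ^ (l * p)  ≡⟨ ^-distribˡ-+-* (x + g) (N ∸ l * p) (l * p) ⟨
  (x + g) ^ (N ∸ l * p + l * p)              ≡⟨ cong ((x + g) ^_) (m∸n+n≡m {N} {l * p} lp≤N) ⟩
  (x + g) ^ N                                ∎
  where
  open ≤-Reasoning
  -- The length of a block. The 2 in the hypothesis absorbs the rounding up.
  p = suc ((x + g) / g)
  M≤pg : x + g ≤ p * g
  M≤pg = ≤-trans (≤-reflexive (m≡m%n+[m/n]*n (x + g) g)) (+-monoˡ-≤ ((x + g) / g * g) (<⇒≤ (m%n<n (x + g) g)))
  lp≤N : l * p ≤ N
  lp≤N = *-cancelʳ-≤ (l * p) N g (begin
    l * p * g                            ≡⟨ *-assoc l p g ⟩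
    l * (g + (x + g) / g * g)            ≤⟨ *-monoʳ-≤ l (+-mono-≤ (m≤n+m g x) (m/n*n≤m (x + g) g)) ⟩
    l * (x + g + (x + g))                ≡⟨ solve 2 (λ l m → l :* (m :+ m) :≡ con 2 :* (l :* m)) refl l (x + g) ⟩
    2 * (l * (x + g))                    ≤⟨ enough ⟩
    N * g                                ∎)

-- Random centres

-- Total in the same way as the machine, for which the head of nil is nil: missing bits are read as
-- false.
takeBits : ∀ n → List Bool → Vec Bool n
takeBits zero    bs       = []
takeBits (suc n) []       = false ∷ takeBits n []
takeBits (suc n) (b ∷ bs) = b ∷ takeBits n bs

dropBits : ℕ → List Bool → List Bool
dropBits zero    bs       = bs
dropBits (suc n) []       = []
dropBits (suc n) (b ∷ bs) = dropBits n bs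

takeBits-++ : ∀ {n} (a : Vec Bool n) bs → takeBits n (toList a ++ bs) ≡ a
takeBits-++ []      bs = refl
takeBits-++ (b ∷ a) bs = cong (b ∷_) (takeBits-++ a bs)

dropBits-++ : ∀ {n} (a : Vec Bool n) bs → dropBits n (toList a ++ bs) ≡ bs
dropBits-++ []      bs = refl
dropBits-++ (b ∷ a) bs = dropBits-++ a bs

toList-++ : ∀ {m n} (a : Vec Bool m) (b : Vec Bool n) → toList (a ++ᵛ b) ≡ toList a ++ toList b
toList-++ []      b = refl
toList-++ (x ∷ a) b = cong (x ∷_) (toList-++ a b)

centres : ∀ n → List ℕ → List Bool → List (Assignment n × ℕ)
centres n []      bs = []
centres n (r ∷ Λ) bs = (takeBits n bs , r) ∷ centres n Λ (dropBits n bs)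

occurrences : ℕ → List ℕ → ℕ
occurrences r []      = 0
occurrences r (q ∷ Λ) = indicator (q ≡ᵇ r) + occurrences r Λ

module _ {n : ℕ} (r : ℕ) (hit : Vec Bool n → Bool) where

  -- The indicator of the event that no centre of radius r is a hit, written as a product so that
  -- independence turns its sum into a product of sums.
  missing : List (Assignment n × ℕ) → ℕ
  missing []            = 1
  missing ((a , q) ∷ ts) = indicator (not ((q ≡ᵇ r) ∧ hit a)) * missing ts

  found : ∀ ts → missing ts ≡ 0 → ∃[ a ] (a , r) ∈ ts × hit a ≡ true
  found ((a , q) ∷ ts) eq with q ≡ᵇ r in q≡r | hit a in h
  ... | true | true rewrite ≡ᵇ⇒≡ q r (subst T (sym q≡r) _) = a , here refl , h
  ... | false | _ with found ts (trans (sym (+-identityʳ _)) eq)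
  ...   | a′ , a∈ , h′ = a′ , there a∈ , h′
  found ((a , q) ∷ ts) eq | true | false with found ts (trans (sym (+-identityʳ _)) eq)
  ...   | a′ , a∈ , h′ = a′ , there a∈ , h′

  hits misses : ℕ
  hits   = ΣB n (indicator ∘ hit)
  misses = ΣB n (indicator ∘ not ∘ hit)

  misses+hits : misses + hits ≡ 2 ^ n
  misses+hits = trans (sym (ΣB-+ n _ _)) (trans (ΣB-cong n split) (trans (ΣB-const n 1) (*-identityʳ (2 ^ n))))
    where
    split : ∀ a → indicator (not (hit a)) + indicator (hit a) ≡ 1
    split a with hit a
    ... | true  = refl
    ... | false = refl

  missingTotal : List ℕ → ℕ
  missingTotal Λ = ΣB (length Λ * n) (λ R → missing (centres n Λ (toList R)))

  missingTotal-∷ : ∀ q Λ → missingTotal (q ∷ Λ) ≡ ΣB n (λ a → indicator (not ((q ≡ᵇ r) ∧ hit a))) * missingTotal Λ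
  missingTotal-∷ q Λ = begin
    ΣB (n + length Λ * n) (λ R → missing (centres n (q ∷ Λ) (toList R)))
      ≡⟨ ΣB-++ n (length Λ * n) _ ⟩
    ΣB n (λ a → ΣB (length Λ * n) (λ R → missing (centres n (q ∷ Λ) (toList (a ++ᵛ R)))))
      ≡⟨ ΣB-cong n (λ a → ΣB-cong (length Λ * n) (λ R → cong₂ (λ a′ bs → indicator (not ((q ≡ᵇ r) ∧ hit a′)) * missing (centres n Λ bs))
           (trans (cong (takeBits n) (toList-++ a R)) (takeBits-++ a (toList R)))
           (trans (cong (dropBits n) (toList-++ a R)) (dropBits-++ a (toList R))))) ⟩
    ΣB n (λ a → ΣB (length Λ * n) (λ R → indicator (not ((q ≡ᵇ r) ∧ hit a)) * missing (centres n Λ (toList R))))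
      ≡⟨ ΣB-cong n (λ a → trans (ΣB-* (length Λ * n) (indicator (not ((q ≡ᵇ r) ∧ hit a))) _) (*-comm (indicator (not ((q ≡ᵇ r) ∧ hit a))) (missingTotal Λ))) ⟩
    ΣB n (λ a → missingTotal Λ * indicator (not ((q ≡ᵇ r) ∧ hit a)))
      ≡⟨ trans (ΣB-* n (missingTotal Λ) _) (*-comm (missingTotal Λ) _) ⟩
    ΣB n (λ a → indicator (not ((q ≡ᵇ r) ∧ hit a))) * missingTotal Λ ∎
    where open ≡-Reasoning

  -- Independence: each of the centres labelled r misses with probability misses / 2 ^ n, and the
  -- others do not affect the event. Both sides are multiplied by the denominators.
  missingTotal-≡ : ∀ Λ → missingTotal Λ * (2 ^ n) ^ occurrences r Λ ≡ misses ^ occurrences r Λ * (2 ^ n) ^ length Λ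
  missingTotal-≡ []      = refl
  missingTotal-≡ (q ∷ Λ) rewrite missingTotal-∷ q Λ with q ≡ᵇ r
  ... | true  = begin
    misses * missingTotal Λ * (2 ^ n * (2 ^ n) ^ occurrences r Λ)
      ≡⟨ solve 4 (λ m t p q → m :* t :* (p :* q) :≡ m :* p :* (t :* q)) refl misses (missingTotal Λ) (2 ^ n) _ ⟩
    misses * 2 ^ n * (missingTotal Λ * (2 ^ n) ^ occurrences r Λ)
      ≡⟨ cong (misses * 2 ^ n *_) (missingTotal-≡ Λ) ⟩
    misses * 2 ^ n * (misses ^ occurrences r Λ * (2 ^ n) ^ length Λ)
      ≡⟨ solve 4 (λ m p q r → m :* p :* (q :* r) :≡ m :* q :* (p :* r)) refl misses (2 ^ n) (misses ^ occurrences r Λ) _ ⟩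
    misses * misses ^ occurrences r Λ * (2 ^ n * (2 ^ n) ^ length Λ) ∎
    where open ≡-Reasoning
  ... | false = begin
    ΣB n (λ _ → 1) * missingTotal Λ * (2 ^ n) ^ occurrences r Λ
      ≡⟨ cong (λ m → m * missingTotal Λ * (2 ^ n) ^ occurrences r Λ) (trans (ΣB-const n 1) (*-identityʳ (2 ^ n))) ⟩
    2 ^ n * missingTotal Λ * (2 ^ n) ^ occurrences r Λ
      ≡⟨ trans (*-assoc (2 ^ n) _ _) (cong (2 ^ n *_) (missingTotal-≡ Λ)) ⟩
    2 ^ n * (misses ^ occurrences r Λ * (2 ^ n) ^ length Λ)
      ≡⟨ solve 3 (λ p q r → p :* (q :* r) :≡ q :* (p :* r)) refl (2 ^ n) (misses ^ occurrences r Λ) _ ⟩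
    misses ^ occurrences r Λ * (2 ^ n * (2 ^ n) ^ length Λ) ∎
    where open ≡-Reasoning

  missingTotal-≤ : ∀ Λ l .{{_ : NonZero hits}} → 2 * (l * 2 ^ n) ≤ occurrences r Λ * hits → missingTotal Λ * 2 ^ l ≤ (2 ^ n) ^ length Λ
  missingTotal-≤ Λ l enough = *-cancelʳ-≤ _ _ ((2 ^ n) ^ occurrences r Λ) {{m^n≢0 (2 ^ n) (occurrences r Λ) {{m^n≢0 2 n}}}} (begin
    missingTotal Λ * 2 ^ l * (2 ^ n) ^ occurrences r Λ
      ≡⟨ solve 3 (λ p q r → p :* q :* r :≡ q :* (p :* r)) refl (missingTotal Λ) (2 ^ l) _ ⟩
    2 ^ l * (missingTotal Λ * (2 ^ n) ^ occurrences r Λ)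
      ≡⟨ cong (2 ^ l *_) (missingTotal-≡ Λ) ⟩
    2 ^ l * (misses ^ occurrences r Λ * (2 ^ n) ^ length Λ)
      ≡⟨ solve 3 (λ p q r → p :* (q :* r) :≡ r :* (q :* p)) refl (2 ^ l) (misses ^ occurrences r Λ) _ ⟩
    (2 ^ n) ^ length Λ * (misses ^ occurrences r Λ * 2 ^ l)
      ≤⟨ *-monoʳ-≤ ((2 ^ n) ^ length Λ) (trials misses hits (occurrences r Λ) l (subst (λ m → 2 * (l * m) ≤ occurrences r Λ * hits) (sym misses+hits) enough)) ⟩
    (2 ^ n) ^ length Λ * (misses + hits) ^ occurrences r Λ
      ≡⟨ cong (λ m → (2 ^ n) ^ length Λ * m ^ occurrences r Λ) misses+hits ⟩
    (2 ^ n) ^ length Λ * (2 ^ n) ^ occurrences r Λ ∎)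
    where open ≤-Reasoning

-- There are ⌊B / k ^ r⌋ tasks of radius r, so that each radius costs B.

pushCopies : ℕ → ℕ → List ℕ → List ℕ
pushCopies zero    r Λ = Λ
pushCopies (suc u) r Λ = pushCopies u r (r ∷ Λ)

labelling : (k : ℕ) .{{_ : NonZero k}} → ℕ → ℕ → ℕ → List ℕ → List ℕ
labelling k zero    u r Λ = Λ
labelling k (suc ν) u r Λ = labelling k ν (u / k) (suc r) (pushCopies u r Λ)

quotient : (k : ℕ) .{{_ : NonZero k}} → ℕ → ℕ → ℕ
quotient k u zero    = u
quotient k u (suc i) = quotient k (u / k) i

quotient-< : ∀ k .{{_ : NonZero k}} u i → u < suc (quotient k u i) * k ^ i
quotient-< k u zero    = ≤-reflexive (sym (*-identityʳ (suc u)))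
quotient-< k u (suc i) = begin-strict
  u                                      ≡⟨ m≡m%n+[m/n]*n u k ⟩
  u % k + u / k * k                      <⟨ +-monoˡ-< (u / k * k) (m%n<n u k) ⟩
  suc (u / k) * k                        ≤⟨ *-monoˡ-≤ k (quotient-< k (u / k) i) ⟩
  suc (quotient k u (suc i)) * k ^ i * k ≡⟨ trans (*-assoc (suc (quotient k u (suc i))) (k ^ i) k) (cong (suc (quotient k u (suc i)) *_) (*-comm (k ^ i) k)) ⟩
  suc (quotient k u (suc i)) * k ^ suc i ∎
  where open ≤-Reasoning

occurrences-pushCopies : ∀ q u r Λ → occurrences q Λ ≤ occurrences q (pushCopies u r Λ)
occurrences-pushCopies q zero    r Λ = ≤-refl
occurrences-pushCopies q (suc u) r Λ = ≤-trans (m≤n+m _ _) (occurrences-pushCopies q u r (r ∷ Λ))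

occurrences-copies : ∀ u r Λ → u + occurrences r Λ ≤ occurrences r (pushCopies u r Λ)
occurrences-copies zero    r Λ = ≤-refl
occurrences-copies (suc u) r Λ = ≤-trans (≤-reflexive eq) (occurrences-copies u r (r ∷ Λ))
  where
  eq : suc u + occurrences r Λ ≡ u + (indicator (r ≡ᵇ r) + occurrences r Λ)
  eq rewrite ≡ᵇ-refl r = sym (+-suc u _)

occurrences-labelling : ∀ k .{{_ : NonZero k}} q ν u r Λ → occurrences q Λ ≤ occurrences q (labelling k ν u r Λ)
occurrences-labelling k q zero    u r Λ = ≤-refl
occurrences-labelling k q (suc ν) u r Λ = ≤-trans (occurrences-pushCopies q u r Λ) (occurrences-labelling k q ν (u / k) (suc r) _)

quotient≤occurrences : ∀ k .{{_ : NonZero k}} {ν} i u r Λ → i < ν → quotient k u i ≤ occurrences (r + i) (labelling k ν u r Λ)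
quotient≤occurrences k {suc ν} zero u r Λ _ rewrite +-identityʳ r =
  ≤-trans (m≤m+n u _) (≤-trans (occurrences-copies u r Λ) (occurrences-labelling k r ν (u / k) (suc r) _))
quotient≤occurrences k {suc ν} (suc i) u r Λ (s≤s i<ν) rewrite +-suc r i = quotient≤occurrences k i (u / k) (suc r) _ i<ν

powerSum : ℕ → List ℕ → ℕ
powerSum k Λ = sum (map (k ^_) Λ)

powerSum-pushCopies : ∀ k u r Λ → powerSum k (pushCopies u r Λ) ≡ u * k ^ r + powerSum k Λ
powerSum-pushCopies k zero    r Λ = refl
powerSum-pushCopies k (suc u) r Λ = trans (powerSum-pushCopies k u r (r ∷ Λ))
  (solve 3 (λ a b c → a :+ (b :+ c) :≡ b :+ a :+ c) refl (u * k ^ r) (k ^ r) (powerSum k Λ))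

powerSum-labelling : ∀ k .{{_ : NonZero k}} {B} ν u r Λ → u * k ^ r ≤ B → powerSum k (labelling k ν u r Λ) ≤ ν * B + powerSum k Λ
powerSum-labelling k zero        u r Λ le = ≤-refl
powerSum-labelling k {B} (suc ν) u r Λ le = begin
  powerSum k (labelling k ν (u / k) (suc r) (pushCopies u r Λ)) ≤⟨ powerSum-labelling k ν (u / k) (suc r) _ next ⟩
  ν * B + powerSum k (pushCopies u r Λ)                         ≡⟨ cong (ν * B +_) (powerSum-pushCopies k u r Λ) ⟩
  ν * B + (u * k ^ r + powerSum k Λ)                            ≤⟨ +-monoʳ-≤ (ν * B) (+-monoˡ-≤ (powerSum k Λ) le) ⟩
  ν * B + (B + powerSum k Λ)                                    ≡⟨ solve 3 (λ a b c → a :+ (b :+ c) :≡ b :+ a :+ c) refl (ν * B) B (powerSum k Λ) ⟩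
  suc ν * B + powerSum k Λ                                      ∎
  where
  open ≤-Reasoning
  next : u / k * k ^ suc r ≤ B
  next = begin
    u / k * (k * k ^ r)  ≡⟨ *-assoc (u / k) k (k ^ r) ⟨
    u / k * k * k ^ r    ≤⟨ *-monoˡ-≤ (k ^ r) (m/n*n≤m u k) ⟩
    u * k ^ r            ≤⟨ le ⟩
    B                    ∎

labels<-pushCopies : ∀ {m} u r Λ → r < m → All (_< m) Λ → All (_< m) (pushCopies u r Λ)
labels<-pushCopies zero    r Λ r< Λ< = Λ<
labels<-pushCopies (suc u) r Λ r< Λ< = labels<-pushCopies u r _ r< (r< ∷ Λ<)

labels<-labelling : ∀ k .{{_ : NonZero k}} {m} ν u r Λ → r + ν ≤ m → All (_< m) Λ → All (_< m) (labelling k ν u r Λ)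
labels<-labelling k zero    u r Λ le Λ< = Λ<
labels<-labelling k (suc ν) u r Λ le Λ< = labels<-labelling k ν (u / k) (suc r) _ (≤-trans (≤-reflexive (sym (+-suc r ν))) le)
  (labels<-pushCopies u r Λ (≤-trans (s≤s (m≤m+n r ν)) (≤-trans (≤-reflexive (sym (+-suc r ν))) le)) Λ<)

-- This is n / k rounded up.
blocks : (k : ℕ) .{{_ : NonZero k}} → ℕ → ℕ
blocks k n = (n + (k ∸ 1)) / k

blocks-0 : ∀ k .{{_ : NonZero k}} → blocks k 0 ≡ 0
blocks-0 (suc k) = m<n⇒m/n≡0 (n<1+n k)

-- The recursion of the loop in `scale`, which takes k off n, truncated at zero, until nothing is
-- left.
blocks-suc : ∀ k .{{_ : NonZero k}} m → blocks k (suc m) ≡ suc (blocks k (suc m ∸ k))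
blocks-suc (suc k) m = begin
  (suc m + k) / suc k              ≡⟨ m/n≡1+[m∸n]/n {suc m + k} {suc k} (s≤s (m≤n+m k m)) ⟩
  suc ((m + k ∸ k) / suc k)        ≡⟨ cong (λ x → suc (x / suc k)) (m+n∸n≡m m k) ⟩
  suc (m / suc k)                  ≡⟨ cong suc (lemma (k ≤? m)) ⟩
  suc ((m ∸ k + k) / suc k)        ∎
  where
  open ≡-Reasoning
  lemma : Dec (k ≤ m) → m / suc k ≡ (m ∸ k + k) / suc k
  lemma (yes k≤m) = cong (_/ suc k) (sym (m∸n+n≡m k≤m))
  lemma (no k≰m)  = trans (m<n⇒m/n≡0 (m≤n⇒m≤1+n (≰⇒> k≰m))) (sym (trans (cong (λ x → (x + k) / suc k) (m≤n⇒m∸n≡0 (<⇒≤ (≰⇒> k≰m)))) (m<n⇒m/n≡0 (n<1+n k))))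

n≤blocks*k : ∀ k .{{_ : NonZero k}} n → n ≤ blocks k n * k
n≤blocks*k (suc k) n = +-cancelʳ-≤ k n _ (begin
  n + k                                             ≡⟨ m≡m%n+[m/n]*n (n + k) (suc k) ⟩
  (n + k) % suc k + blocks (suc k) n * suc k        ≤⟨ +-monoˡ-≤ _ (≤-pred (m%n<n (n + k) (suc k))) ⟩
  k + blocks (suc k) n * suc k                      ≡⟨ +-comm k _ ⟩
  blocks (suc k) n * suc k + k                      ∎)
  where open ≤-Reasoning

blocks*k≤ : ∀ k .{{_ : NonZero k}} n → blocks k n * k ≤ n + k
blocks*k≤ k n = ≤-trans (m/n*n≤m (n + (k ∸ 1)) k) (+-monoʳ-≤ n (m∸n≤m k 1))

-- This is (1 + 1 / k) ^ k ≥ 2, by `bernoulli` with exponent k.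
2k^k≤[1+k]^k : ∀ k .{{_ : NonZero k}} → 2 * k ^ k ≤ suc k ^ k
2k^k≤[1+k]^k (suc k) = *-cancelʳ-≤ _ _ (suc k) (begin
  2 * suc k ^ suc k * suc k                                      ≡⟨ solve 2 (λ q x → con 2 :* q :* x :≡ x :* q :+ x :* con 1 :* q) refl (suc k ^ suc k) (suc k) ⟩
  suc k * suc k ^ suc k + suc k * 1 * suc k ^ suc k              ≤⟨ bernoulli (suc k) 1 (suc k) ⟩
  (suc k + 1) ^ suc k * suc k                                    ≡⟨ cong (λ x → x ^ suc k * suc k) (+-comm (suc k) 1) ⟩
  suc (suc k) ^ suc k * suc k                                    ∎)
  where open ≤-Reasoning

-- This is where the exponent n - n / k comes from.
savings : ∀ k .{{_ : NonZero k}} n → (2 * k) ^ n ≤ (2 ^ (k ∸ 1)) ^ blocks k n * suc k ^ n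
-- The exponent n is first rounded up to the multiple c * k, so that k factors at a time can be
-- traded for a factor 2.
savings k@(suc k′) n = *-cancelʳ-≤ _ _ (suc k ^ (c * k ∸ n)) {{m^n≢0 (suc k) (c * k ∸ n)}} (begin
  (2 * k) ^ n * suc k ^ (c * k ∸ n)          ≤⟨ *-monoʳ-≤ ((2 * k) ^ n) (^-monoˡ-≤ (c * k ∸ n) 1+k≤2k) ⟩
  (2 * k) ^ n * (2 * k) ^ (c * k ∸ n)        ≡⟨ ^-distribˡ-+-* (2 * k) n (c * k ∸ n) ⟨
  (2 * k) ^ (n + (c * k ∸ n))                ≡⟨ cong ((2 * k) ^_) (trans (m+[n∸m]≡n (n≤blocks*k k n)) (*-comm c k)) ⟩
  (2 * k) ^ (k * c)                          ≡⟨ ^-*-assoc (2 * k) k c ⟨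
  ((2 * k) ^ k) ^ c                          ≡⟨ cong (_^ c) (^-distribʳ-* 2 k k) ⟩
  (2 ^ k * k ^ k) ^ c                        ≡⟨ cong (_^ c) (solve 2 (λ a b → con 2 :* a :* b :≡ a :* (con 2 :* b)) refl (2 ^ k′) (k ^ k)) ⟩
  (2 ^ k′ * (2 * k ^ k)) ^ c                 ≤⟨ ^-monoˡ-≤ c (*-monoʳ-≤ (2 ^ k′) (2k^k≤[1+k]^k k)) ⟩
  (2 ^ k′ * suc k ^ k) ^ c                   ≡⟨ ^-distribʳ-* (2 ^ k′) (suc k ^ k) c ⟩
  (2 ^ k′) ^ c * (suc k ^ k) ^ c             ≡⟨ cong ((2 ^ k′) ^ c *_) (trans (^-*-assoc (suc k) k c) (cong (suc k ^_) (trans (*-comm k c) (sym (m+[n∸m]≡n (n≤blocks*k k n)))))) ⟩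
  (2 ^ k′) ^ c * suc k ^ (n + (c * k ∸ n))   ≡⟨ cong ((2 ^ k′) ^ c *_) (^-distribˡ-+-* (suc k) n (c * k ∸ n)) ⟩
  (2 ^ k′) ^ c * (suc k ^ n * suc k ^ (c * k ∸ n)) ≡⟨ *-assoc ((2 ^ k′) ^ c) _ _ ⟨
  (2 ^ k′) ^ c * suc k ^ n * suc k ^ (c * k ∸ n)   ∎)
  where
  open ≤-Reasoning
  c = blocks k n
  1+k≤2k : suc k ≤ 2 * k
  1+k≤2k = ≤-trans (≤-reflexive (+-comm 1 k)) (+-monoʳ-≤ k (s≤s z≤n))

-- The second factor is 2 ^ (n - n / k) with n / k rounded up. The power 7 collects the polynomial
-- losses in `factor-bound`: two each for the constant 4, for the logarithm l of the failure
-- probability and for Markov's inequality, and one for the choice of a radius.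
budget : (k : ℕ) .{{_ : NonZero k}} → ℕ → ℕ → ℕ
budget k n s = (n + (s + 2)) ^ 7 * (2 ^ (k ∸ 1)) ^ blocks k n

labels : (k : ℕ) .{{_ : NonZero k}} → ℕ → ℕ → List ℕ
labels k n s = labelling k (suc n) (budget k n s) 0 []

-- A union bound over all solutions and all bounded weights

ΣW : ∀ n → ℕ → (Vec ℕ n → ℕ) → ℕ
ΣW zero    s f = f []
ΣW (suc n) s f = Σ< (suc s) (λ i → ΣW n s (f ∘ (i ∷_)))

Bounded : ∀ {n} → ℕ → Vec ℕ n → Set
Bounded s = VecAll.All (_≤ s)

Σ<-≤ : ∀ m {f c} → (∀ i → i < m → f i ≤ c) → Σ< m f ≤ m * c
Σ<-≤ zero    le = z≤n
Σ<-≤ (suc m) le = +-mono-≤ (le m ≤-refl) (Σ<-≤ m (λ i i<m → le i (m≤n⇒m≤1+n i<m)))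

Σ<-positive : ∀ m {f} → Σ< m f ≡ 0 → ∀ i → i < m → f i ≡ 0
Σ<-positive m {f} eq i i<m = n≤0⇒n≡0 (≤-trans (Σ<-term m f i<m) (≤-reflexive eq))

ΣW-≤ : ∀ n {s f c} → (∀ w → Bounded s w → f w ≤ c) → ΣW n s f ≤ suc s ^ n * c
ΣW-≤ zero    {c = c} le = ≤-trans (le [] []) (≤-reflexive (sym (+-identityʳ c)))
ΣW-≤ (suc n) {s} {c = c} le = ≤-trans (Σ<-≤ (suc s) (λ i i< → ΣW-≤ n (λ w w≤ → le (i ∷ w) (≤-pred i< ∷ w≤))))
  (≤-reflexive (sym (*-assoc (suc s) (suc s ^ n) c)))

ΣW-positive : ∀ n {s f} → ΣW n s f ≡ 0 → ∀ w → Bounded s w → f w ≡ 0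
ΣW-positive zero    eq []      []         = eq
ΣW-positive (suc n) {s} {f} eq (i ∷ w) (i≤s ∷ w≤) =
  ΣW-positive n (Σ<-positive (suc s) {λ i → ΣW n s (f ∘ (i ∷_))} eq i (s≤s i≤s)) w w≤

Σ<-cong : ∀ m {f g : ℕ → ℕ} → (∀ i → f i ≡ g i) → Σ< m f ≡ Σ< m g
Σ<-cong zero    eq = refl
Σ<-cong (suc m) eq = cong₂ _+_ (eq m) (Σ<-cong m eq)

ΣB-ΣW : ∀ u n s (f : Vec ℕ n → Vec Bool u → ℕ) → ΣB u (λ R → ΣW n s (λ w → f w R)) ≡ ΣW n s (λ w → ΣB u (f w))
ΣB-ΣW u zero    s f = refl
ΣB-ΣW u (suc n) s f = trans (ΣB-Σ< u (suc s) _) (Σ<-cong (suc s) (λ i → ΣB-ΣW u n s (f ∘ (i ∷_))))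

total≤ : ∀ {n s} (w : Vec ℕ n) → Bounded s w → total w ≤ n * s
total≤ []      []         = z≤n
total≤ (i ∷ w) (i≤s ∷ w≤) = +-mono-≤ i≤s (total≤ w w≤)

1+s≤2^s : ∀ s → suc s ≤ 2 ^ s
1+s≤2^s zero    = ≤-refl
1+s≤2^s (suc s) = ≤-trans (+-mono-≤ (>-nonZero⁻¹ (2 ^ s) {{m^n≢0 2 s}}) (1+s≤2^s s)) (≤-reflexive (cong (2 ^ s +_) (sym (+-identityʳ _))))

module _ (k : ℕ) .{{_ : NonZero k}} (n s : ℕ) .{{_ : NonZero n}} where

  -- Depends on w but not on z, since the error pattern is uniform for every z. The algorithm does
  -- not know it and tries every radius.
  radius : Vec ℕ n → ℕ
  radius w = proj₁ (lightOfSize-likely k w)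

  hitting : Assignment n → Vec ℕ n → Vec Bool n → Bool
  hitting z w a = lightOfSize k w (radius w) (errors a z)

  -- The number of pairs of a target and a weight that are not served by the centres read from `bs`.
  -- Summing these indicators is the union bound.
  badness : List Bool → ℕ
  badness bs = ΣB n (λ z → ΣW n s (λ w → missing (radius w) (hitting z w) (centres n (labels k n s) bs)))

  badness≡0 : ∀ bs → badness bs ≡ 0 → ∀ z w → Bounded s w →
              ∃[ a ] ∃[ r ] (a , r) ∈ centres n (labels k n s) bs × dH a z ≡ r × suc k * weight w (errors a z) ≤ total w
  badness≡0 bs eq z w w≤ with found (radius w) (hitting z w) (centres n (labels k n s) bs) (ΣW-positive n (ΣB-positive n eq z) w w≤)
  ... | a , a∈ , hit with ones (errors a z) ≡ᵇ radius w in size | light k w (errors a z) in weigh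
  ...   | true | true = a , radius w , a∈ , trans (sym (ones-errors a z)) (≡ᵇ⇒≡ _ _ (subst T (sym size) _)) ,
                        ≤ᵇ⇒≤ (suc k * weight w (errors a z)) (total w) (subst T (sym weigh) _)

  private
    M l X : ℕ
    M = 2 ^ n
    -- Each pair fails with probability at most 2 ^ -l. Of the exponent, n pays for the targets z, n
    -- * s for the (s + 1) ^ n weights, and the last n remains as the overall failure probability.
    l = n * (s + 2)
    X = n + (s + 2)

  factor-bound : ∀ W → W ≤ n * s → 4 * l * (suc W * suc n) ≤ X ^ 7
  factor-bound W W≤ = begin
    4 * l * (suc W * suc n)                    ≤⟨ *-mono-≤ (*-mono-≤ 4≤ (*-mono-≤ n≤ s+2≤)) (*-mono-≤ W≤′ 1+n≤) ⟩
    X * X * (X * X) * (X * X * X)              ≡⟨ solve 1 (λ x → x :* x :* (x :* x) :* (x :* x :* x) :≡ x :* (x :* (x :* (x :* (x :* (x :* (x :* con 1))))))) refl X ⟩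
    X ^ 7                                      ∎
    where
    open ≤-Reasoning
    n≤ : n ≤ X
    n≤ = m≤m+n n _
    s+2≤ : s + 2 ≤ X
    s+2≤ = m≤n+m _ n
    2≤ : 2 ≤ X
    2≤ = ≤-trans (m≤n+m 2 s) s+2≤
    4≤ : 4 ≤ X * X
    4≤ = *-mono-≤ 2≤ 2≤
    1+n≤ : suc n ≤ X
    1+n≤ = ≤-trans (≤-reflexive (+-comm 1 n)) (+-monoʳ-≤ n (≤-trans (s≤s z≤n) (m≤n+m 2 s)))
    W≤′ : suc W ≤ X * X
    W≤′ = begin
      suc W        ≤⟨ s≤s W≤ ⟩
      suc (n * s)  ≤⟨ s≤s (*-monoʳ-≤ n (≤-trans (m≤m+n s 2) s+2≤)) ⟩
      suc (n * X)  ≤⟨ +-monoˡ-≤ (n * X) (≤-trans (s≤s z≤n) 2≤) ⟩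
      suc n * X    ≤⟨ *-monoˡ-≤ X 1+n≤ ⟩
      X * X        ∎

  -- With P = suc (total w) * suc n, a uniform centre hits with probability at least (k + 1) ^ n * k
  -- ^ r / (P * (2 k) ^ n). So B / k ^ r centres hit B * (k + 1) ^ n / (P * (2 k) ^ n) times on
  -- average, which by `savings` and `factor-bound` is at least 4 * l.
  enough-centres : ∀ z w r → Bounded s w → r ≤ n →
    suc k ^ n * k ^ r ≤ suc (total w) * (suc n * (k ^ n * ΣB n (λ e → indicator (lightOfSize k w r e)))) →
    NonZero (hits r (λ a → lightOfSize k w r (errors a z))) ×
    2 * (l * 2 ^ n) ≤ occurrences r (labels k n s) * hits r (λ a → lightOfSize k w r (errors a z))
  -- Rounding B / k ^ r down loses less than one centre and so at most g ≤ 2 ^ n in the product;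
  -- having 4 * l instead of 2 * l makes up for this.
  enough-centres z w r w≤ r≤n likely = nonZero , +-cancelʳ-≤ g (2 * (l * M)) _ (begin
    2 * (l * M) + g                    ≤⟨ +-monoʳ-≤ (2 * (l * M)) (≤-trans g≤M (≤-trans (m≤n*m M l {{l≢0}}) (m≤m+n (l * M) _))) ⟩
    2 * (l * M) + 2 * (l * M)          ≡⟨ solve 2 (λ l m → con 2 :* (l :* m) :+ con 2 :* (l :* m) :≡ con 4 :* l :* m) refl l M ⟩
    4 * l * M                          ≤⟨ *-cancelʳ-≤ (4 * l * M) (suc q * g) (k ^ r) {{m^n≢0 k r}} key ⟩
    suc q * g                          ≡⟨ +-comm g (q * g) ⟩
    q * g + g                          ≤⟨ +-monoˡ-≤ g (*-monoˡ-≤ g (quotient≤occurrences k r (budget k n s) 0 [] (s≤s r≤n))) ⟩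
    occurrences r (labels k n s) * g + g ∎)
    where
    open ≤-Reasoning
    hit : Vec Bool n → Bool
    hit a = lightOfSize k w r (errors a z)
    g q B P : ℕ
    g = hits r hit
    q = quotient k (budget k n s) r
    B = budget k n s
    P = suc (total w) * suc n
    g≡ : g ≡ ΣB n (λ e → indicator (lightOfSize k w r e))
    g≡ = ΣB-errors z (λ e → indicator (lightOfSize k w r e))
    l≢0 : NonZero l
    l≢0 = m*n≢0 n (s + 2) {{it}} {{>-nonZero (≤-trans (s≤s z≤n) (m≤n+m 2 s))}}
    g≤M : g ≤ M
    g≤M = ≤-trans (m≤n+m g (misses r hit)) (≤-reflexive (misses+hits r hit))
    likely′ : suc k ^ n * k ^ r ≤ k ^ n * (g * P)
    likely′ = ≤-trans likely (≤-reflexive (trans (cong (λ x → suc (total w) * (suc n * (k ^ n * x))) (sym g≡))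
      (solve 4 (λ a b c d → a :* (b :* (c :* d)) :≡ c :* (d :* (a :* b))) refl (suc (total w)) (suc n) (k ^ n) g)))
    nonZero : NonZero g
    nonZero = ≢-nonZero λ g≡0 → ≢-nonZero⁻¹ (suc k ^ n * k ^ r) {{m*n≢0 _ _ {{m^n≢0 (suc k) n}} {{m^n≢0 k r}}}}
      (n≤0⇒n≡0 (≤-trans likely′ (≤-reflexive (trans (cong (λ x → k ^ n * (x * P)) g≡0) (*-zeroʳ (k ^ n))))))
    key : 4 * l * M * k ^ r ≤ suc q * g * k ^ r
    key = *-cancelʳ-≤ _ _ (P * k ^ n) {{m*n≢0 P (k ^ n) {{m*n≢0 (suc (total w)) (suc n)}} {{m^n≢0 k n}}}} (begin
      4 * l * M * k ^ r * (P * k ^ n)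
        ≡⟨ solve 5 (λ a m r p c → a :* m :* r :* (p :* c) :≡ a :* p :* (m :* c) :* r) refl (4 * l) M (k ^ r) P (k ^ n) ⟩
      4 * l * P * (M * k ^ n) * k ^ r
        ≤⟨ *-monoˡ-≤ (k ^ r) (*-monoˡ-≤ (M * k ^ n) (factor-bound (total w) (total≤ w w≤))) ⟩
      X ^ 7 * (M * k ^ n) * k ^ r
        ≡⟨ cong (λ x → X ^ 7 * x * k ^ r) (^-distribʳ-* 2 k n) ⟨
      X ^ 7 * (2 * k) ^ n * k ^ r
        ≤⟨ *-monoˡ-≤ (k ^ r) (*-monoʳ-≤ (X ^ 7) (savings k n)) ⟩
      X ^ 7 * ((2 ^ (k ∸ 1)) ^ blocks k n * suc k ^ n) * k ^ r
        ≡⟨ solve 4 (λ a b c d → a :* (b :* c) :* d :≡ a :* b :* (c :* d)) refl (X ^ 7) _ (suc k ^ n) (k ^ r) ⟩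
      B * (suc k ^ n * k ^ r)
        ≤⟨ *-mono-≤ (<⇒≤ (quotient-< k B r)) likely′ ⟩
      suc q * k ^ r * (k ^ n * (g * P))
        ≡⟨ solve 5 (λ q r c g p → q :* r :* (c :* (g :* p)) :≡ q :* g :* r :* (p :* c)) refl (suc q) (k ^ r) (k ^ n) g P ⟩
      suc q * g * k ^ r * (P * k ^ n) ∎)

  -- After exchanging the sums, every pair contributes its own failure probability, so the mean of
  -- the badness is at most 2 ^ -n.
  badness-rare : ΣB (length (labels k n s) * n) (badness ∘ toList) * 2 ^ n ≤ 2 ^ (length (labels k n s) * n)
  badness-rare = *-cancelʳ-≤ _ _ (M * (2 ^ s) ^ n) {{m*n≢0 M _ {{m^n≢0 2 n}} {{m^n≢0 (2 ^ s) n {{m^n≢0 2 s}}}}}} (begin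
    ΣB u (badness ∘ toList) * M * (M * (2 ^ s) ^ n)
      ≡⟨ trans (*-assoc (ΣB u (badness ∘ toList)) M _) (cong₂ _*_ exchange powers) ⟩
    ΣB n (λ z → ΣW n s (λ w → missingTotal (radius w) (hitting z w) Λ)) * 2 ^ l
      ≡⟨ *-comm _ (2 ^ l) ⟩
    2 ^ l * ΣB n (λ z → ΣW n s (λ w → missingTotal (radius w) (hitting z w) Λ))
      ≡⟨ trans (ΣB-cong n (λ z → ΣW-* n (2 ^ l) _)) (ΣB-* n (2 ^ l) _) ⟨
    ΣB n (λ z → ΣW n s (λ w → 2 ^ l * missingTotal (radius w) (hitting z w) Λ))
      ≤⟨ ΣB-mono n (λ z → ΣW-≤ n (bound z)) ⟩
    ΣB n (λ z → suc s ^ n * M ^ length Λ)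
      ≡⟨ ΣB-const n _ ⟩
    M * (suc s ^ n * M ^ length Λ)
      ≤⟨ *-monoʳ-≤ M (*-monoˡ-≤ (M ^ length Λ) (^-monoˡ-≤ n (1+s≤2^s s))) ⟩
    M * ((2 ^ s) ^ n * M ^ length Λ)
      ≡⟨ trans (sym (*-assoc M _ _)) (*-comm (M * (2 ^ s) ^ n) _) ⟩
    M ^ length Λ * (M * (2 ^ s) ^ n)
      ≡⟨ cong (_* (M * (2 ^ s) ^ n)) (trans (^-*-assoc 2 n (length Λ)) (cong (2 ^_) (*-comm n (length Λ)))) ⟩
    2 ^ u * (M * (2 ^ s) ^ n) ∎)
    where
    open ≤-Reasoning
    Λ = labels k n s
    u = length Λ * n
    ΣW-* : ∀ n c (f : Vec ℕ n → ℕ) → ΣW n s (λ w → c * f w) ≡ c * ΣW n s f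
    ΣW-* zero    c f = refl
    ΣW-* (suc n) c f = go (suc s)
      where
      go : ∀ m → Σ< m (λ i → ΣW n s (λ w → c * f (i ∷ w))) ≡ c * Σ< m (λ i → ΣW n s (λ w → f (i ∷ w)))
      go zero    = sym (*-zeroʳ c)
      go (suc m) = trans (cong₂ _+_ (ΣW-* n c _) (go m)) (sym (*-distribˡ-+ c _ _))
    exchange : ΣB u (badness ∘ toList) ≡ ΣB n (λ z → ΣW n s (λ w → missingTotal (radius w) (hitting z w) Λ))
    exchange = trans (ΣB-comm u n _) (ΣB-cong n (λ z → ΣB-ΣW u n s _))
    powers : M * (M * (2 ^ s) ^ n) ≡ 2 ^ l
    powers = trans (cong (λ x → M * (M * x)) (^-*-assoc 2 s n)) (trans (cong (M *_) (sym (^-distribˡ-+-* 2 n (s * n))))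
      (trans (sym (^-distribˡ-+-* 2 n (n + s * n))) (cong (2 ^_) (solve 2 (λ n s → n :+ (n :+ s :* n) :≡ n :* (s :+ con 2)) refl n s))))
    bound : ∀ z w → Bounded s w → 2 ^ l * missingTotal (radius w) (hitting z w) Λ ≤ M ^ length Λ
    bound z w w≤ =
      let _ , r≤n , likely = lightOfSize-likely k w
          nonZero , enough = enough-centres z w (radius w) w≤ r≤n likely
      in ≤-trans (≤-reflexive (*-comm (2 ^ l) _)) (missingTotal-≤ (radius w) (hitting z w) Λ l {{nonZero}} enough)

-- Codes for arithmetic, for preparing the centres and for the local search.

tails : ℕ → Expr → Expr
tails zero    e = e
tails (suc m) e = tails m (tl e)

numeral : ℕ → Expr
numeral zero    = nil
numeral (suc m) = cons nil (numeral m)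

eval-numeral : ∀ σ m → eval σ (numeral m) ≡ encodeℕ m
eval-numeral σ zero    = refl
eval-numeral σ (suc m) = cong (nil ∙_) (eval-numeral σ m)

eval-tails : ∀ σ m e {u} → eval σ e ≡ encodeℕ u → eval σ (tails m e) ≡ encodeℕ (u ∸ m)
eval-tails σ zero    e {u}     eq = eq
eval-tails σ (suc m) e {zero}  eq = trans (eval-tails σ m (tl e) {0} (cong right eq)) (cong encodeℕ (0∸n≡0 m))
eval-tails σ (suc m) e {suc u} eq = eval-tails σ m (tl e) (cong right eq)

plus : Code
plus = bind (while (ret (cons (var 0) (var 1))) (hd (var 0))
                   (ret (cons (tl (hd (var 0))) (cons nil (tl (var 0))))))
            (ret (tl (var 0)))

times : Code
times = bind (while (ret (cons nil (var 1))) (tl (var 0))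
                    (bind (call (cons (var 1) (cons (hd (var 0)) nil)) plus)
                          (ret (cons (var 0) (tl (tl (var 1)))))))
             (ret (hd (var 0)))

power : ℕ → Code
power zero    = ret (cons nil nil)
power (suc m) = bind (power m) (call (cons (var 0) (cons (var 1) nil)) times)

scale : ℕ → Code
scale k = bind (while (ret (cons (var 0) (var 1))) (tl (var 0))
                      (bind (call (cons (hd (var 0)) (cons (numeral (2 ^ (k ∸ 1))) nil)) times)
                            (ret (cons (var 0) (tails k (tl (var 1)))))))
               (ret (hd (var 0)))

-- In unary, a number is at least k when k - 1 tails of it still leave a node; this is the test of
-- the loop.
divide : ℕ → Code
divide k = bind (while (ret (cons nil (var 0))) (tails (k ∸ 1) (tl (var 0)))
                       (ret (cons (cons nil (hd (var 0))) (tails k (tl (var 0))))))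
                (ret (hd (var 0)))

copies : Code
copies = bind (while (ret (cons (var 0) (var 2))) (hd (var 0))
                     (ret (cons (tl (hd (var 0))) (cons (var 2) (tl (var 0))))))
              (ret (tl (var 0)))

-- Loop state: number of radii to come, current quotient, current radius, labels so far. Each radius
-- divides the quotient by k once more.
radii : ℕ → Code
radii k = bind (while (ret (cons (cons nil (var 1)) (cons (var 0) (cons nil nil)))) (hd (var 0))
                      (bind (call (cons (hd (tl (var 0))) (cons (hd (tl (tl (var 0)))) (cons (tl (tl (tl (var 0)))) nil))) copies)
                      (bind (call (cons (hd (tl (var 1))) nil) (divide k))
                            (ret (cons (tl (hd (var 2))) (cons (var 0) (cons (cons nil (hd (tl (tl (var 2))))) (var 1))))))))
               (ret (tl (tl (tl (var 0)))))

count : Code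
count = bind (while (ret (cons nil (var 0))) (tl (var 0))
                    (bind (call (cons (var 2) (cons (hd (var 0)) nil)) plus)
                          (ret (cons (var 0) (tl (tl (var 1)))))))
             (ret (hd (var 0)))

prepareRest : ℕ → Code
prepareRest k =
  bind (call (cons (var 0) (cons (var 4) nil)) (radii k))
  (bind (call (cons (var 0) (cons (var 5) nil)) count)
  (ret (cons (var 0) (cons nil (cons (var 6) (cons (var 7) (cons (var 8) (cons (var 1) nil))))))))

-- Environment: n, formula, s. The value begins with the number of coins to toss and an empty list
-- of bits, which is the form that `tossing` expects.
prepare : ℕ → Code
prepare k =
  bind (call (cons (var 2) (cons (cons nil (cons nil nil)) nil)) plus)
  (bind (call (cons (var 1) (cons (var 0) nil)) plus)
  (bind (call (cons (var 0) nil) (power 7))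
  (bind (call (cons (var 0) (cons (var 3) nil)) (scale k)) (prepareRest k))))

reversal : Code
reversal = bind (while (ret (cons (var 0) nil)) (hd (var 0))
                       (ret (cons (tl (hd (var 0))) (cons (hd (hd (var 0))) (tl (var 0))))))
                (ret (tl (var 0)))

variables : Code
variables = bind (while (ret (cons (var 0) nil)) (hd (var 0))
                        (ret (cons (tl (hd (var 0))) (cons (cons (tl (hd (var 0))) nil) (tl (var 0))))))
                 (ret (tl (var 0)))

taking : Code
taking = bind (while (ret (cons (var 1) (cons (var 0) nil))) (hd (var 0))
                     (ret (cons (tl (hd (var 0))) (cons (tl (hd (tl (var 0)))) (cons (hd (hd (tl (var 0)))) (tl (tl (var 0))))))))
         (bind (call (cons (tl (tl (var 0))) nil) reversal)
               (ret (cons (var 0) (hd (tl (var 1))))))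

-- Environment: bits, radii, n, s.
gathering : Code
gathering = bind (while (ret (cons (var 0) (cons (var 1) nil))) (hd (tl (var 0)))
                        (bind (call (cons (hd (var 0)) (cons (var 3) nil)) taking)
                              (ret (cons (tl (var 0)) (cons (tl (hd (tl (var 1))))
                                (cons (cons (hd (var 0)) (cons (hd (hd (tl (var 1)))) (var 5))) (tl (tl (var 1)))))))))
                 (ret (tl (tl (var 0))))

-- Environment: counter, formula, literals, tasks.
fillStep : Code
fillStep = bind (call (cons nil (cons (tl (var 0)) (cons (var 2) (cons (var 3) (cons (var 4) nil))))) search)
                (branch (var 0) (ret (cons (tl (hd (var 1))) (cons (hd (var 0)) (tl (var 1)))))
                                (ret (cons (tl (hd (var 1))) (tl (var 1)))))

filling : Code
filling = bind (while (ret (cons (var 0) nil)) (hd (var 0)) fillStep) (ret (tl (var 0)))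

appendLast : Code
appendLast = bind (call (cons (var 0) nil) reversal) (call (cons (cons (var 2) (var 0)) nil) reversal)

-- Environment: counter, solutions, formula, literals, tasks.
swapStep : Code
swapStep = branch (tl (var 0))
             (bind (call (cons (cons (hd (tl (var 0))) nil) (cons (tl (tl (var 0))) (cons (var 3) (cons (var 4) (cons (var 5) nil))))) search)
             (bind (call (cons (tl (tl (var 1))) (cons (hd (var 0)) nil)) appendLast)
                   (ret (cons (tl (hd (var 2))) (var 0)))))
             (ret (cons (tl (hd (var 0))) nil))

-- The set is a queue: an element is taken from the front and its replacement, possibly itself, goes
-- to the back, so that s consecutive rounds try every element.
swapping : Code
swapping = bind (while (ret (cons (var 0) (var 1))) (hd (var 0)) swapStep) (ret (tl (var 0)))

-- Environment: nil, bits, n, formula, s, radii.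
diversify : Code
diversify =
  bind (call (cons (var 2) nil) variables)
  (bind (call (cons (var 2) (cons (var 6) (cons (var 3) (cons (var 5) nil)))) gathering)
  (bind (call (cons (var 6) (cons (var 5) (cons (var 1) (cons (var 0) nil)))) filling)
  (bind (call (cons (var 7) (cons (cons nil (cons nil nil)) nil)) plus)
  (bind (call (cons (var 6) (cons (var 0) nil)) plus)
  -- The number of rounds is this cube times s: the cube exceeds s * (s * n), which bounds the sum
  -- of distances, and there are s rounds for each possible increase.
  (bind (call (cons (var 0) nil) (power 3))
  (bind (call (cons (var 10) (cons (var 0) nil)) times)
  (call (cons (var 0) (cons (var 4) (cons (var 10) (cons (var 6) (cons (var 5) nil))))) swapping)))))))

-- Correctness and cost of the preparation.

module Preparation (Z : ℕ) (2≤Z : 2 ≤ Z) where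
  open Routines Z 2≤Z

  return-≡ : ∀ {ρ} e {v γ} .{{_ : NonZero γ}} → eval (nth ρ) e ≡ v → ρ ⊢ ret e ⇓ v [ γ ]
  return-≡ e refl = return e

  calling-≡ : ∀ {ρ e c v ρ′ γ} .{{_ : NonZero γ}} → eval (nth ρ) e ≡ ρ′ → ρ′ ⊢ c ⇓ v [ γ ] → ρ ⊢ call e c ⇓ v [ γ ]
  calling-≡ refl p = calling p

  ≤γZ^10 : ∀ {i γ} → i ≤ γ → i ≤ γ * Z ^ 10
  ≤γZ^10 {γ = γ} le = ≤-trans le (m≤m*n γ (Z ^ 10) {{m^n≢0 Z 10}})

  i*γ≤ : ∀ {i γ} → i ≤ Z → i * γ ≤ γ * Z ^ 10
  i*γ≤ {i} {γ} i≤ = ≤-trans (≤-reflexive (*-comm i γ)) (*-monoʳ-≤ γ (≤-trans i≤ (m≤m*n Z (Z ^ 9) {{m^n≢0 Z 9}})))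

  i*1≤ : ∀ γ {i} → i ≤ γ * Z ^ 10 → i * 1 ≤ γ * Z ^ 10
  i*1≤ γ {i} le = ≤-trans (≤-reflexive (*-identityʳ i)) le

  plus-⇓ : ∀ {ρ γ} .{{_ : NonZero γ}} u v → u ≤ γ * Z ^ 10 → encodeℕ u ∙ encodeℕ v ∙ ρ ⊢ plus ⇓ encodeℕ (u + v) [ γ ]
  plus-⇓ {γ = γ} u v u≤ = looping (i*1≤ γ u≤) (return _) (loop′ u v refl) then return _
    where
    loop′ : ∀ {ρ} u v {w} → u + v ≡ w → ρ ⊢while hd (var 0) body loopBody plus from encodeℕ u ∙ encodeℕ v ⇓ nil ∙ encodeℕ w [ u × 1 ]
    loop′ zero    v refl = stop refl
    loop′ (suc u) v eq   = again refl (return _) (loop′ u (suc v) (trans (+-suc u v) eq))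

  times-⇓ : ∀ {ρ γ δ} .{{_ : NonZero γ}} .{{_ : NonZero δ}} u v → u ≤ δ * Z ^ 10 → v * δ ≤ γ * Z ^ 10 →
            encodeℕ u ∙ encodeℕ v ∙ ρ ⊢ times ⇓ encodeℕ (v * u) [ γ ]
  times-⇓ {δ = δ} u v u≤ v≤ = looping v≤ (return _) (loop′ v 0 (+-identityʳ (v * u))) then return _
    where
    loop′ : ∀ {ρ} v acc {w} → v * u + acc ≡ w →
            encodeℕ u ∙ ρ ⊢while tl (var 0) body loopBody times from encodeℕ acc ∙ encodeℕ v ⇓ encodeℕ w ∙ nil [ v × δ ]
    loop′ zero    acc refl = stop refl
    loop′ (suc v) acc eq   = again refl (calling (plus-⇓ u acc u≤) then return _) (loop′ v (u + acc) (trans rearrange eq))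
      where
      rearrange : v * u + (u + acc) ≡ u + v * u + acc
      rearrange = trans (sym (+-assoc (v * u) u acc)) (cong (_+ acc) (+-comm (v * u) u))

  power-⇓ : ∀ {ρ} X m → X ≤ Z → m ≤ 10 → encodeℕ X ∙ ρ ⊢ power m ⇓ encodeℕ (X ^ m) [ 1 ]
  power-⇓ X zero    X≤ m≤ = return _
  power-⇓ X (suc m) X≤ m≤ = power-⇓ X m X≤ (<⇒≤ m≤) then
    calling (times-⇓ (X ^ m) X X^m≤ (≤Z^10 X≤))
    where
    X^m≤ : X ^ m ≤ 1 * Z ^ 10
    X^m≤ = ≤-trans (^-monoˡ-≤ m X≤) (≤-trans (^-monoʳ-≤ Z (<⇒≤ m≤)) (≤-reflexive (sym (+-identityʳ _))))

  module _ (k : ℕ) (k≢0 : NonZero k) (2^k≤Z : 2 ^ (k ∸ 1) ≤ Z) (γ : ℕ) (γ≢0 : NonZero γ) where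
    instance
      k-nonZero : NonZero k
      k-nonZero = k≢0
      γ-nonZero : NonZero γ
      γ-nonZero = γ≢0

    scale-⇓ : ∀ {ρ} u n → n + k ≤ Z → (2 ^ (k ∸ 1)) ^ blocks k n * u ≤ γ →
              encodeℕ u ∙ encodeℕ n ∙ ρ ⊢ scale k ⇓ encodeℕ ((2 ^ (k ∸ 1)) ^ blocks k n * u) [ γ ]
    scale-⇓ {ρ} u n n+k≤Z B≤γ = looping (i*γ≤ blocks≤Z) (return _) (loop′ n n ≤-refl u refl B≤γ) then return _
      where
      blocks≤Z : blocks k n ≤ Z
      blocks≤Z = ≤-trans (m≤m*n (blocks k n) k) (≤-trans (blocks*k≤ k n) n+k≤Z)
      loop′ : ∀ {ρ} p m → m ≤ p → ∀ u {w} → (2 ^ (k ∸ 1)) ^ blocks k m * u ≡ w → w ≤ γ →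
              ρ ⊢while tl (var 0) body loopBody (scale k) from encodeℕ u ∙ encodeℕ m ⇓ encodeℕ w ∙ nil [ blocks k m × γ ]
      loop′ p zero m≤p u {w} eq w≤ rewrite blocks-0 k {{k≢0}} | trans (sym (+-identityʳ u)) eq = stop refl
      loop′ (suc p) (suc m) (s≤s m≤p) u {w} eq w≤ rewrite blocks-suc k m =
        again refl
          (calling-≡ (cong (λ t → encodeℕ u ∙ t ∙ nil) (eval-numeral _ (2 ^ (k ∸ 1))))
                     (times-⇓ {δ = γ} u (2 ^ (k ∸ 1)) (≤γZ^10 (≤-trans u≤w w≤)) (i*γ≤ 2^k≤Z)) then
           return-≡ _ (cong (encodeℕ (2 ^ (k ∸ 1) * u) ∙_) (eval-tails _ k (tl (var 1)) {suc m} refl)))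
          (loop′ p (suc m ∸ k) (≤-trans (∸-monoʳ-≤ (suc m) (>-nonZero⁻¹ k)) m≤p) (2 ^ (k ∸ 1) * u) (trans (rearrange (blocks k (suc m ∸ k))) eq) w≤)
        where
        rearrange : ∀ c → (2 ^ (k ∸ 1)) ^ c * (2 ^ (k ∸ 1) * u) ≡ 2 ^ (k ∸ 1) * (2 ^ (k ∸ 1)) ^ c * u
        rearrange c = solve 3 (λ a b u → a :* (b :* u) :≡ b :* a :* u) refl ((2 ^ (k ∸ 1)) ^ c) (2 ^ (k ∸ 1)) u
        -- The partial products only grow, so the bound on the final value covers all of them.
        u≤w : u ≤ w
        u≤w = ≤-trans (m≤n*m u (2 ^ (k ∸ 1) * (2 ^ (k ∸ 1)) ^ blocks k (suc m ∸ k))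
                        {{m^n≢0 (2 ^ (k ∸ 1)) (suc (blocks k (suc m ∸ k))) {{m^n≢0 2 (k ∸ 1)}}}}) (≤-reflexive eq)

    divide-⇓ : ∀ {ρ} u → u ≤ γ → encodeℕ u ∙ ρ ⊢ divide k ⇓ encodeℕ (u / k) [ γ ]
    divide-⇓ u u≤γ = looping (i*1≤ γ (≤γZ^10 (≤-trans (m/n≤m u k) u≤γ))) (return _) (proj₂ (loop′ u u ≤-refl 0 (+-identityʳ (u / k)))) then return _
      where
      loop′ : ∀ {ρ} p u → u ≤ p → ∀ q {w} → u / k + q ≡ w →
              ∃[ t ] ρ ⊢while tails (k ∸ 1) (tl (var 0)) body loopBody (divide k) from encodeℕ q ∙ encodeℕ u ⇓ encodeℕ w ∙ t [ u / k × 1 ]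
      loop′ p u u≤p q eq with k ≤? u
      loop′ zero    u u≤p q eq | yes k≤u = ⊥-elim (<⇒≱ (>-nonZero⁻¹ k) (≤-trans k≤u u≤p))
      loop′ p       u u≤p q eq | no  k≰u rewrite m<n⇒m/n≡0 {u} {k} (≰⇒> k≰u) | eq = encodeℕ u ,
        stop (cong isNode (trans (eval-tails _ (k ∸ 1) (tl (var 0)) {u} refl)
                                 (cong encodeℕ (m≤n⇒m∸n≡0 (∸-monoˡ-≤ 1 (≰⇒> k≰u))))))
      loop′ (suc p) u u≤p q eq | yes k≤u rewrite m/n≡1+[m∸n]/n {u} {k} k≤u
        with loop′ p (u ∸ k) (≤-trans (∸-monoʳ-≤ u (>-nonZero⁻¹ k)) (≤-trans (∸-monoˡ-≤ 1 u≤p) ≤-refl)) (suc q) (trans (+-suc ((u ∸ k) / k) q) eq)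
      ... | t , go = t , again
        (trans (cong isNode (eval-tails _ (k ∸ 1) (tl (var 0)) {u} refl)) (node (m<n⇒0<n∸m (≤-trans (≤-reflexive (suc[n∸1] k)) k≤u))))
        (return-≡ _ (cong (encodeℕ (suc q) ∙_) (eval-tails _ k (tl (var 0)) {u} refl))) go
        where
        suc[n∸1] : ∀ k .{{_ : NonZero k}} → suc (k ∸ 1) ≡ k
        suc[n∸1] (suc k) = refl
        node : ∀ {m} → 0 < m → isNode (encodeℕ m) ≡ true
        node (s≤s _) = refl

    copies-⇓ : ∀ {ρ} u r Λ → u ≤ γ → encodeℕ u ∙ encodeℕ r ∙ encodeNumbers Λ ∙ ρ ⊢ copies ⇓
               encodeNumbers (pushCopies u r Λ) [ γ ]
    copies-⇓ u r Λ u≤γ = looping (i*1≤ γ (≤γZ^10 u≤γ)) (return _) (loop′ u Λ) then return _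
      where
      loop′ : ∀ {ρ t} u Λ → t ∙ encodeℕ r ∙ ρ ⊢while hd (var 0) body loopBody copies
                from encodeℕ u ∙ encodeNumbers Λ ⇓ nil ∙ encodeNumbers (pushCopies u r Λ) [ u × 1 ]
      loop′ zero    Λ = stop refl
      loop′ (suc u) Λ = again refl (return _) (loop′ u (r ∷ Λ))

    radii-⇓ : ∀ {ρ} u n → suc n ≤ Z → u ≤ γ → encodeℕ u ∙ encodeℕ n ∙ ρ ⊢ radii k ⇓
              encodeNumbers (labelling k (suc n) u 0 []) [ γ ]
    radii-⇓ u n n<Z u≤γ = looping (i*γ≤ n<Z) (return _) (proj₂ (loop′ (suc n) u 0 [] u≤γ)) then return _
      where
      loop′ : ∀ {ρ} ν u r Λ → u ≤ γ → ∃[ t ] ρ ⊢while hd (var 0) body loopBody (radii k)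
                from encodeℕ ν ∙ encodeℕ u ∙ encodeℕ r ∙ encodeNumbers Λ ⇓
                     nil ∙ proj₁ t ∙ proj₂ t ∙ encodeNumbers (labelling k ν u r Λ) [ ν × γ ]
      loop′ zero    u r Λ u≤ = _ , stop refl
      loop′ (suc ν) u r Λ u≤ with loop′ ν (u / k) (suc r) (pushCopies u r Λ) (≤-trans (m/n≤m u k) u≤)
      ... | t , go = t , again refl (calling (copies-⇓ u r Λ u≤) then calling (divide-⇓ u u≤) then return _) go

    count-⇓ : ∀ {ρ} Λ n → n ≤ Z → length Λ ≤ γ * Z ^ 10 → encodeNumbers Λ ∙ encodeℕ n ∙ ρ ⊢ count ⇓
              encodeℕ (length Λ * n) [ γ ]
    count-⇓ Λ n n≤Z Λ≤ = looping (i*1≤ γ Λ≤) (return _) (loop′ Λ 0 (+-identityʳ (length Λ * n))) then return _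
      where
      loop′ : ∀ {ρ t} Λ acc {w} → length Λ * n + acc ≡ w → t ∙ encodeℕ n ∙ ρ ⊢while tl (var 0) body loopBody count
                from encodeℕ acc ∙ encodeNumbers Λ ⇓ encodeℕ w ∙ nil [ length Λ × 1 ]
      loop′ []      acc refl = stop refl
      loop′ (r ∷ Λ) acc eq = again refl
        (calling (plus-⇓ n acc (≤-trans (≤-reflexive (sym (*-identityʳ n))) (≤Z^10 n≤Z))) then return _)
        (loop′ Λ (n + acc) (trans (trans (sym (+-assoc (length Λ * n) n acc)) (cong (_+ acc) (+-comm (length Λ * n) n))) eq))

    prepare-⇓ : ∀ {ρ t} n s → suc (n + k) ≤ Z → n + (s + 2) ≤ Z → budget k n s ≤ γ → length (labels k n s) ≤ γ * Z ^ 10 →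
                encodeℕ n ∙ t ∙ encodeℕ s ∙ ρ ⊢ prepare k ⇓
                encodeℕ (length (labels k n s) * n) ∙ nil ∙ encodeℕ n ∙ t ∙ encodeℕ s ∙ encodeNumbers (labels k n s) ∙ nil [ γ ]
    prepare-⇓ n s n+k<Z X≤Z B≤γ Λ≤ =
      calling (plus-⇓ s 2 (poly≤ (≤-trans (m≤m+n s 2) (≤-trans (m≤n+m (s + 2) n) X≤Z)))) then
      calling (plus-⇓ n (s + 2) (poly≤ n≤Z)) then
      poly (calling (power-⇓ (n + (s + 2)) 7 X≤Z (m≤m+n 7 3))) then
      calling (scale-⇓ ((n + (s + 2)) ^ 7) n (<⇒≤ n+k<Z) (≤-trans (≤-reflexive swapped) B≤γ)) then
      rest (trans swapped refl)
      where
      n≤Z : n ≤ Z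
      n≤Z = ≤-trans (m≤m+n n k) (<⇒≤ n+k<Z)
      poly≤ : ∀ {i} → i ≤ Z → i ≤ γ * Z ^ 10
      poly≤ i≤Z = ≤-trans (≤-reflexive (sym (*-identityʳ _))) (≤-trans (≤Z^10 i≤Z) (*-monoˡ-≤ (Z ^ 10) (>-nonZero⁻¹ γ)))
      swapped : (2 ^ (k ∸ 1)) ^ blocks k n * (n + (s + 2)) ^ 7 ≡ budget k n s
      swapped = *-comm _ ((n + (s + 2)) ^ 7)
      rest : ∀ {ρ t t₁ t₂ t₃ B} → B ≡ budget k n s → encodeℕ B ∙ t₁ ∙ t₂ ∙ t₃ ∙ encodeℕ n ∙ t ∙ encodeℕ s ∙ ρ ⊢ prepareRest k ⇓
             encodeℕ (length (labels k n s) * n) ∙ nil ∙ encodeℕ n ∙ t ∙ encodeℕ s ∙ encodeNumbers (labels k n s) ∙ nil [ γ ]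
      rest refl = calling (radii-⇓ (budget k n s) n (≤-trans (s≤s (m≤m+n n k)) n+k<Z) B≤γ) then
                  calling (count-⇓ (labels k n s) n n≤Z Λ≤) then return _

-- Correctness and cost of gathering, filling and swapping.

encodeBits : List Bool → Tree
encodeBits bs = encodeList (map encodeBool bs)

literalsBelow : ∀ {n} m → m ≤ n → Clause n → Clause n
literalsBelow zero    m≤n C = C
literalsBelow (suc m) m<n C = literalsBelow m (<⇒≤ m<n) ((fromℕ< m<n , false) ∷ C)

-- A clause that mentions every variable, so that expanding a solution is the same operation as
-- branching on a falsified clause.
literals : ∀ n → Clause n
literals n = literalsBelow n ≤-refl []

length-literalsBelow : ∀ {n} m (m≤n : m ≤ n) C → length (literalsBelow m m≤n C) ≡ m + length C
length-literalsBelow zero    m≤n C = refl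
length-literalsBelow (suc m) m<n C = trans (length-literalsBelow m _ _) (+-suc m (length C))

length-literals : ∀ n → length (literals n) ≤ n
length-literals n = ≤-reflexive (trans (length-literalsBelow n ≤-refl []) (+-identityʳ n))

∈-literalsBelow-rest : ∀ {n} m (m≤n : m ≤ n) C {l} → l ∈ C → l ∈ literalsBelow m m≤n C
∈-literalsBelow-rest zero    m≤n C l∈ = l∈
∈-literalsBelow-rest (suc m) m<n C l∈ = ∈-literalsBelow-rest m _ _ (there l∈)

∈-literalsBelow : ∀ {n} m (m≤n : m ≤ n) C (x : Fin n) → toℕ x < m → (x , false) ∈ literalsBelow m m≤n C
∈-literalsBelow (suc m) m<n C x (s≤s x≤m) with m≤n⇒m<n∨m≡n x≤m
... | inj₁ x<m  = ∈-literalsBelow m _ _ x x<m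
... | inj₂ refl = ∈-literalsBelow-rest m _ _ (here (cong (_, false) (sym (fromℕ<-toℕ x m<n))))

∈-literals : ∀ {n} (x : Fin n) → ∃[ b ] (x , b) ∈ literals n
∈-literals x = false , ∈-literalsBelow _ ≤-refl [] x (toℕ<n x)

-- The pairs of `centres` as tasks, each with expansion budget s, a bound on the number of forbidden
-- solutions that a path can meet.
gathered : ∀ n → ℕ → List ℕ → List Bool → List (Task n) → List (Task n)
gathered n s []      bs st = st
gathered n s (r ∷ Λ) bs st = gathered n s Λ (dropBits n bs) ((takeBits n bs , r , s) ∷ st)

module Rounds {n : ℕ} (F : CNF n) (V : Clause n) (tasks : List (Task n)) where
  open Exploration F V

  -- Together with `Swaps`, a trace of the loops that keeps only what each search certifies; the
  -- analysis of the approximation can then ignore the machine.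
  data Fills : ℕ → List (Assignment n) → List (Assignment n) → Set where
    done  : ∀ {S} → Fills 0 S S
    grow  : ∀ {i S S′ z} → Improves S nothing (just z) → DominatesReach S tasks (just z) → Fills i (z ∷ S) S′ → Fills (suc i) S S′
    stuck : ∀ {i S S′} → DominatesReach S tasks nothing → Fills i S S′ → Fills (suc i) S S′

  data Swaps : ℕ → List (Assignment n) → List (Assignment n) → Set where
    done   : ∀ {S} → Swaps 0 S S
    rotate : ∀ {i y Y S′ z} → Improves Y (just y) (just z) → DominatesReach Y tasks (just z) → Swaps i (Y ++ [ z ]) S′ → Swaps (suc i) (y ∷ Y) S′
    empty  : ∀ {i S′} → Swaps i [] S′ → Swaps (suc i) [] S′

  length-Fills : ∀ {i S S′} → Fills i S S′ → length S′ ≤ i + length S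
  length-Fills done                 = ≤-refl
  length-Fills {suc i} (grow _ _ f) = ≤-trans (length-Fills f) (≤-reflexive (+-suc i _))
  length-Fills (stuck _ f)          = m≤n⇒m≤1+n (length-Fills f)

module Diversification (Z : ℕ) (2≤Z : 2 ≤ Z) (γ : ℕ) (γ≢0 : NonZero γ) where
  open Routines Z 2≤Z
  open Preparation Z 2≤Z hiding (k-nonZero; γ-nonZero)
  instance
    γ-nonZero : NonZero γ
    γ-nonZero = γ≢0

  yielding : ∀ {ρ c v w δ} → v ≡ w → ρ ⊢ c ⇓ v [ δ ] → ρ ⊢ c ⇓ w [ δ ]
  yielding refl p = p

  ending : ∀ {ρ e d v w w′ i δ} → w ≡ w′ → ρ ⊢while e body d from v ⇓ w [ i × δ ] → ρ ⊢while e body d from v ⇓ w′ [ i × δ ]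
  ending refl p = p

  reversal-⇓ : ∀ {ρ} ts → length ts ≤ Z → encodeList ts ∙ ρ ⊢ reversal ⇓ encodeList (reverse ts) [ 1 ]
  reversal-⇓ ts ts≤Z = looping (≤Z^10 ts≤Z) (return _) (loop′ ts []) then return _
    where
    loop′ : ∀ {ρ} ts us → ρ ⊢while hd (var 0) body loopBody reversal from encodeList ts ∙ encodeList us ⇓ nil ∙ encodeList (ts ʳ++ us) [ length ts × 1 ]
    loop′ []       us = stop refl
    loop′ (t ∷ ts) us = again refl (return _) (loop′ ts (t ∷ us))

  variables-⇓ : ∀ {ρ} n → n ≤ Z → encodeℕ n ∙ ρ ⊢ variables ⇓ encodeClause (literals n) [ 1 ]
  variables-⇓ n n≤Z = looping (≤Z^10 n≤Z) (return _) (loop′ n ≤-refl []) then return _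
    where
    loop′ : ∀ {ρ} m (m≤n : m ≤ n) C → ρ ⊢while hd (var 0) body loopBody variables
              from encodeℕ m ∙ encodeClause C ⇓ nil ∙ encodeClause (literalsBelow m m≤n C) [ m × 1 ]
    loop′ zero    m≤n C = stop refl
    loop′ (suc m) m<n C = again refl
      (return-≡ _ (cong (λ i → encodeℕ m ∙ (encodeℕ i ∙ nil) ∙ encodeClause C) (sym (toℕ-fromℕ< m<n))))
      (loop′ m (<⇒≤ m<n) ((fromℕ< m<n , false) ∷ C))

  taking-⇓ : ∀ {ρ} n bs → n ≤ Z → encodeBits bs ∙ encodeℕ n ∙ ρ ⊢ taking ⇓ encodeAssignment (takeBits n bs) ∙ encodeBits (dropBits n bs) [ 1 ]
  taking-⇓ n bs n≤Z = looping (≤Z^10 n≤Z) (return _) (loop′ n bs []) then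
    calling (reversal-⇓ (taken n bs []) (≤-trans (≤-reflexive (trans (length-taken n bs []) (+-identityʳ n))) n≤Z)) then
    return-≡ _ (cong (_∙ encodeBits (dropBits n bs)) (reverse-taken n bs))
    where
    taken : ℕ → List Bool → List Tree → List Tree
    taken zero    bs       ts = ts
    taken (suc n) []       ts = taken n [] (nil ∷ ts)
    taken (suc n) (b ∷ bs) ts = taken n bs (encodeBool b ∷ ts)
    length-taken : ∀ n bs ts → length (taken n bs ts) ≡ n + length ts
    length-taken zero    bs       ts = refl
    length-taken (suc n) []       ts = trans (length-taken n [] (nil ∷ ts)) (+-suc n (length ts))
    length-taken (suc n) (b ∷ bs) ts = trans (length-taken n bs (encodeBool b ∷ ts)) (+-suc n (length ts))
    elements : ∀ {n} → Assignment n → List Tree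
    elements a = map encodeBool (toList a)
    elements-≡ : ∀ {n} (a : Assignment n) → encodeList (elements a) ≡ encodeAssignment a
    elements-≡ []      = refl
    elements-≡ (b ∷ a) = cong (encodeBool b ∙_) (elements-≡ a)
    ʳ++-taken : ∀ n bs ts → reverse (taken n bs ts) ≡ ts ʳ++ elements (takeBits n bs)
    ʳ++-taken zero    bs       ts = refl
    ʳ++-taken (suc n) []       ts = ʳ++-taken n [] (nil ∷ ts)
    ʳ++-taken (suc n) (b ∷ bs) ts = ʳ++-taken n bs (encodeBool b ∷ ts)
    reverse-taken : ∀ n bs → encodeList (reverse (taken n bs [])) ≡ encodeAssignment (takeBits n bs)
    reverse-taken n bs = trans (cong encodeList (ʳ++-taken n bs [])) (elements-≡ (takeBits n bs))
    loop′ : ∀ {ρ} n bs ts → ρ ⊢while hd (var 0) body loopBody taking from encodeℕ n ∙ encodeBits bs ∙ encodeList ts ⇓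
              nil ∙ encodeBits (dropBits n bs) ∙ encodeList (taken n bs ts) [ n × 1 ]
    loop′ zero    bs       ts = stop refl
    loop′ (suc n) []       ts = again refl (return _) (ending (cong (λ bs → nil ∙ encodeBits bs ∙ encodeList (taken n [] (nil ∷ ts))) (dropBits-[] n)) (loop′ n [] (nil ∷ ts)))
      where
      dropBits-[] : ∀ n → dropBits n [] ≡ []
      dropBits-[] zero    = refl
      dropBits-[] (suc n) = refl
    loop′ (suc n) (b ∷ bs) ts = again refl (return _) (loop′ n bs (encodeBool b ∷ ts))

  gathering-⇓ : ∀ {ρ} n s Λ bs → n ≤ Z → length Λ ≤ γ * Z ^ 10 →
    encodeBits bs ∙ encodeNumbers Λ ∙ encodeℕ n ∙ encodeℕ s ∙ ρ ⊢ gathering ⇓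
    encodeTasks (gathered n s Λ bs []) [ γ ]
  gathering-⇓ n s Λ bs n≤Z Λ≤ = looping (i*1≤ γ Λ≤) (return _) (proj₂ (loop′ Λ bs [])) then return _
    where
    loop′ : ∀ {ρ t t′} Λ bs st → ∃[ u ] t ∙ t′ ∙ encodeℕ n ∙ encodeℕ s ∙ ρ ⊢while hd (tl (var 0)) body loopBody gathering
              from encodeBits bs ∙ encodeNumbers Λ ∙ encodeTasks st ⇓
              u ∙ nil ∙ encodeTasks (gathered n s Λ bs st) [ length Λ × 1 ]
    loop′ []      bs st = _ , stop refl
    loop′ (r ∷ Λ) bs st with loop′ Λ (dropBits n bs) ((takeBits n bs , r , s) ∷ st)
    ... | u , go = u , again refl (calling (taking-⇓ n bs n≤Z) then return _) go

  appendLast-⇓ : ∀ {n ρ} (Y : List (Assignment n)) z → suc (length Y) ≤ Z →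
                 encodeAssignments Y ∙ encodeAssignment z ∙ ρ ⊢ appendLast ⇓ encodeAssignments (Y ++ [ z ]) [ 1 ]
  appendLast-⇓ Y z Y<Z =
    calling (reversal-⇓ (map encodeAssignment Y) (≤-trans (≤-reflexive (length-map _ Y)) (<⇒≤ Y<Z))) then
    yielding (cong encodeList reversed)
      (calling (reversal-⇓ (encodeAssignment z ∷ reverse (map encodeAssignment Y))
        (≤-trans (≤-reflexive (cong suc (trans (length-reverse (map encodeAssignment Y)) (length-map _ Y)))) Y<Z)))
    where
    reversed : reverse (encodeAssignment z ∷ reverse (map encodeAssignment Y)) ≡ map encodeAssignment (Y ++ [ z ])
    reversed = trans (unfold-reverse _ (reverse (map encodeAssignment Y)))
      (trans (cong (_++ [ encodeAssignment z ]) (reverse-involutive (map encodeAssignment Y))) (sym (map-++ encodeAssignment Y [ z ])))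

  module _ {n k s : ℕ} (k≢0 : NonZero k) (F : CNF n) (F-width : F IsCNFOfWidth k) (tasks : List (Task n))
           (n≤Z : n ≤ Z) (F≤Z : length F ≤ Z) (k≤Z : k ≤ Z) (s≤Z : s ≤ Z) (tasks≤ : totalPotential k tasks ≤ γ * Z ^ 10) where
    open Rounds F (literals n) tasks

    SearchOutcome : List (Assignment n) → Maybe (Assignment n) → Set
    SearchOutcome Y best = ∃[ best′ ] Exploration.Improves F (literals n) Y best best′ ×
      Exploration.DominatesReach F (literals n) Y tasks best′ ×
      (∀ {ρ} → encodeBest best ∙ encodeAssignments Y ∙ encodeCNF F ∙ encodeClause (literals n) ∙
              encodeTasks tasks ∙ ρ ⊢ search ⇓ encodeBest best′ [ γ ])

    searching-⇓ : ∀ Y best → length Y ≤ s → SearchOutcome Y best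
    searching-⇓ Y best Y≤s = Searching.searching Z 2≤Z k≢0 F (literals n) Y n≤Z F≤Z k≤Z F-width (length-literals n)
      (≤-trans Y≤s s≤Z) scores tasks best tasks≤
      where
      scores : ∀ z → scoreOf z Y ≤ Z * Z
      scores z = ≤-trans (≤-reflexive (scoreOf≡distanceSum z Y)) (≤-trans (distanceSum≤ z Y) (*-mono-≤ (≤-trans Y≤s s≤Z) n≤Z))

    FillOutcome : ℕ → List (Assignment n) → Set
    FillOutcome i S = ∃[ S′ ] Fills i S S′ × (∀ {ρ t} →
      t ∙ encodeCNF F ∙ encodeClause (literals n) ∙ encodeTasks tasks ∙ ρ ⊢while hd (var 0) body fillStep
        from encodeℕ i ∙ encodeAssignments S ⇓ nil ∙ encodeAssignments S′ [ i × γ ])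

    fill-loop : ∀ i S → i + length S ≤ s → FillOutcome i S
    fill-loop zero    S le = S , done , stop refl
    fill-loop (suc i) S le = extend (searching-⇓ S nothing (≤-trans (m≤n+m _ (suc i)) le))
      where
      extend : SearchOutcome S nothing → FillOutcome (suc i) S
      extend (nothing , imp , dom , found) =
        let S′ , fills , go = fill-loop i S (<⇒≤ le) in
        S′ , stuck dom fills , again refl (calling found then no! refl (return _)) go
      extend (just z , imp , dom , found) =
        let S′ , fills , go = fill-loop i (z ∷ S) (≤-trans (≤-reflexive (+-suc i _)) le) in
        S′ , grow imp dom fills , again refl (calling found then yes! refl (return _)) go

    filling-⇓ : ∀ {i} → i ≤ s → ∃[ S ] Fills i [] S ×
      (∀ {ρ} → encodeℕ i ∙ encodeCNF F ∙ encodeClause (literals n) ∙ encodeTasks tasks ∙ ρ ⊢ filling ⇓ encodeAssignments S [ γ ])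
    filling-⇓ {i} i≤s =
      let S , fills , go = fill-loop i [] (≤-trans (≤-reflexive (+-identityʳ i)) i≤s) in
      S , fills , (looping (i*γ≤ (≤-trans i≤s s≤Z)) (return _) go then return _)

    SwapOutcome : ℕ → List (Assignment n) → Set
    SwapOutcome i S = ∃[ S′ ] Swaps i S S′ × (∀ {ρ t t′} →
      t ∙ t′ ∙ encodeCNF F ∙ encodeClause (literals n) ∙ encodeTasks tasks ∙ ρ ⊢while hd (var 0) body swapStep
        from encodeℕ i ∙ encodeAssignments S ⇓ nil ∙ encodeAssignments S′ [ i × γ ])

    swap-loop : ∀ i S → length S ≤ s → SwapOutcome i S
    swap-loop zero    S       le = S , done , stop refl
    swap-loop (suc i) []      le =
      let S′ , swaps , go = swap-loop i [] le in
      S′ , empty swaps , again refl (no! refl (return _)) go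
    swap-loop (suc i) (y ∷ Y) le = extend (searching-⇓ Y (just y) (<⇒≤ le))
      where
      extend : SearchOutcome Y (just y) → SwapOutcome (suc i) (y ∷ Y)
      extend (nothing , inj₁ () , _)
      extend (nothing , inj₂ (_ , () , _) , _)
      extend (just z , imp , dom , found) =
        let S′ , swaps , go = swap-loop i (Y ++ [ z ]) (≤-trans (≤-reflexive (trans (length-++ Y) (+-comm (length Y) 1))) le) in
        S′ , rotate imp dom swaps ,
        again refl (yes! refl (calling found then poly (calling (appendLast-⇓ Y z (≤-trans le s≤Z))) then return _)) go

    swapping-⇓ : ∀ {i} S → i ≤ Z ^ 10 → length S ≤ s → ∃[ S′ ] Swaps i S S′ ×
      (∀ {ρ} → encodeℕ i ∙ encodeAssignments S ∙ encodeCNF F ∙ encodeClause (literals n) ∙ encodeTasks tasks ∙ ρ ⊢ swapping ⇓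
               encodeAssignments S′ [ γ ])
    swapping-⇓ {i} S i≤ S≤s =
      let S′ , swaps , go = swap-loop i S S≤s in
      S′ , swaps , (looping (≤-trans (≤-reflexive (*-comm i γ)) (*-monoʳ-≤ γ i≤)) (return _) go then return _)

  ≤1*Z^10 : ∀ {i} → i ≤ Z ^ 10 → i ≤ 1 * Z ^ 10
  ≤1*Z^10 i≤ = ≤-trans i≤ (≤-reflexive (sym (*-identityˡ (Z ^ 10))))

  ≤γ*Z^10 : ∀ {i} → i ≤ Z ^ 10 → i ≤ γ * Z ^ 10
  ≤γ*Z^10 i≤ = ≤-trans i≤ (m≤n*m (Z ^ 10) γ)

  Z≤Z^10 : Z ≤ Z ^ 10
  Z≤Z^10 = m≤m*n Z (Z ^ 9) {{m^n≢0 Z 9}}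

  cube≤ : ∀ {x} → x ≤ Z → x ^ 3 ≤ Z ^ 3
  cube≤ = ^-monoˡ-≤ 3

  cube*≤ : ∀ {x s} → x ≤ Z → s ≤ Z → x ^ 3 * s ≤ Z ^ 10
  cube*≤ {x} {s} x≤Z s≤Z = begin
    x ^ 3 * s      ≤⟨ *-mono-≤ (cube≤ x≤Z) s≤Z ⟩
    Z ^ 3 * Z      ≡⟨ *-comm (Z ^ 3) Z ⟩
    Z ^ 4          ≤⟨ ^-monoʳ-≤ Z (m≤m+n 4 6) ⟩
    Z ^ 10         ∎
    where open ≤-Reasoning

  diversify-⇓ : ∀ {n k s} (k≢0 : NonZero k) (F : CNF n) → F IsCNFOfWidth k → ∀ Λ bs → n + (s + 2) ≤ Z → length F ≤ Z → k ≤ Z →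
    length Λ ≤ γ * Z ^ 10 → totalPotential k (gathered n s Λ bs []) ≤ γ * Z ^ 10 →
    let open Rounds F (literals n) (gathered n s Λ bs []) in
    ∃[ S₁ ] ∃[ S₂ ] Fills s [] S₁ × Swaps ((n + (s + 2)) ^ 3 * s) S₁ S₂ ×
      (∀ {ρ} → nil ∙ encodeBits bs ∙ encodeℕ n ∙ encodeCNF F ∙ encodeℕ s ∙ encodeNumbers Λ ∙ ρ ⊢ diversify ⇓ encodeAssignments S₂ [ γ ])
  diversify-⇓ {n} {k} {s} k≢0 F F-width Λ bs X≤Z F≤Z k≤Z Λ≤ tasks≤ = result
    where
    n≤Z : n ≤ Z
    n≤Z = ≤-trans (m≤m+n n _) X≤Z
    s≤Z : s ≤ Z
    s≤Z = ≤-trans (≤-trans (m≤m+n s 2) (m≤n+m (s + 2) n)) X≤Z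
    open Rounds F (literals n) (gathered n s Λ bs [])
    result : ∃[ S₁ ] ∃[ S₂ ] Fills s [] S₁ × Swaps ((n + (s + 2)) ^ 3 * s) S₁ S₂ ×
      (∀ {ρ} → nil ∙ encodeBits bs ∙ encodeℕ n ∙ encodeCNF F ∙ encodeℕ s ∙ encodeNumbers Λ ∙ ρ ⊢ diversify ⇓ encodeAssignments S₂ [ γ ])
    result =
      let S₁ , fills , filled = filling-⇓ {s = s} k≢0 F F-width (gathered n s Λ bs []) n≤Z F≤Z k≤Z s≤Z tasks≤ ≤-refl
          S₂ , swaps , swapped = swapping-⇓ {s = s} k≢0 F F-width (gathered n s Λ bs []) n≤Z F≤Z k≤Z s≤Z tasks≤
             {i = (n + (s + 2)) ^ 3 * s} S₁ (cube*≤ X≤Z s≤Z) (≤-trans (length-Fills fills) (≤-reflexive (+-identityʳ s))) in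
      S₁ , S₂ , fills , swaps ,
      (poly (calling (variables-⇓ n n≤Z)) then calling (gathering-⇓ n s Λ bs n≤Z Λ≤) then calling filled then
       calling (plus-⇓ s 2 (≤γ*Z^10 (≤-trans s≤Z Z≤Z^10))) then calling (plus-⇓ n (s + 2) (≤γ*Z^10 (≤-trans n≤Z Z≤Z^10))) then
       poly (calling (power-⇓ (n + (s + 2)) 3 X≤Z (m≤m+n 3 7))) then
       calling (times-⇓ {δ = 1} s ((n + (s + 2)) ^ 3) (≤1*Z^10 (≤-trans s≤Z Z≤Z^10))
                        (i*1≤ γ (≤γ*Z^10 (≤-trans (cube≤ X≤Z) (^-monoʳ-≤ Z (m≤m+n 3 7)))))) then
       calling swapped)

-- Tossing coins: u ∙ bits ∙ ρ becomes nil ∙ more bits ∙ ρ, with one coin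
-- used in every fourth step.
tossing : Program
tossing = loop (hd (var 0)) (toss 2 ⨾ 0 := cons (tl (hd (var 0))) (cons (cons (var 2) (hd (tl (var 0)))) (tl (tl (var 0)))))

-- An iteration consists of test, sequencing, toss and assignment, so the third of its coins is
-- kept. The final single step is the failing test.
tossed : ∀ u → Vec Bool (u * 4 + 1) → List Bool → List Bool
tossed zero    r                   bs = bs
tossed (suc u) (_ ∷ _ ∷ b ∷ _ ∷ r) bs = tossed u r (b ∷ bs)

tossing-runs : ∀ {ps ρ} u bs σ → σ 0 ≡ encodeℕ u ∙ encodeBits bs ∙ ρ → (r : Vec Bool (u * 4 + 1)) →
               ∃[ σ′ ] steps r (tossing ∷ ps , σ) ≡ (ps , σ′) × σ′ 0 ≡ nil ∙ encodeBits (tossed u r bs) ∙ ρ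
tossing-runs zero    bs σ σ0 (b ∷ []) rewrite σ0 = σ , refl , σ0
tossing-runs {ps} (suc u) bs σ σ0 (_ ∷ _ ∷ b ∷ _ ∷ r) rewrite cong (isNode ∘ left) σ0 =
  tossing-runs {ps} u (b ∷ bs) _ (cong (λ t → right (left t) ∙ (encodeBool b ∙ left (right t)) ∙ right (right t)) σ0) r

-- The three coins ignored in each iteration average out, and consing reverses the order of the kept
-- ones.
ΣB-tossed : ∀ u bs (f : List Bool → ℕ) → ΣB (u * 4 + 1) (λ r → f (tossed u r bs)) * 2 ^ u ≡ 2 ^ (u * 4 + 1) * ΣB u (λ e → f (toList e ʳ++ bs))
ΣB-tossed zero    bs f = trans (*-identityʳ _) (cong (f bs +_) (sym (+-identityʳ (f bs))))
ΣB-tossed (suc u) bs f = begin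
  ΣB (4 + (u * 4 + 1)) (λ r → f (tossed (suc u) r bs)) * (2 * 2 ^ u)
    ≡⟨ solve 3 (λ x y p → ((((x :+ x) :+ (y :+ y)) :+ ((x :+ x) :+ (y :+ y))) :+ (((x :+ x) :+ (y :+ y)) :+ ((x :+ x) :+ (y :+ y)))) :* (con 2 :* p)
         :≡ con 16 :* (x :* p :+ y :* p)) refl (X false) (X true) (2 ^ u) ⟩
  16 * (X false * 2 ^ u + X true * 2 ^ u)
    ≡⟨ cong (16 *_) (cong₂ _+_ (ΣB-tossed u (false ∷ bs) f) (ΣB-tossed u (true ∷ bs) f)) ⟩
  16 * (2 ^ (u * 4 + 1) * Y false + 2 ^ (u * 4 + 1) * Y true)
    ≡⟨ solve 3 (λ p x y → con 16 :* (p :* x :+ p :* y) :≡ con 2 :* (con 2 :* (con 2 :* (con 2 :* p))) :* (x :+ y)) refl (2 ^ (u * 4 + 1)) (Y false) (Y true) ⟩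
  2 ^ (suc u * 4 + 1) * ΣB (suc u) (λ e → f (toList e ʳ++ bs)) ∎
  where
  open ≡-Reasoning
  X Y : Bool → ℕ
  X b = ΣB (u * 4 + 1) (λ r → f (tossed u r (b ∷ bs)))
  Y b = ΣB u (λ e → f (toList e ʳ++ (b ∷ bs)))

ΣB-snoc : ∀ u bs (f : List Bool → ℕ) →
          ΣB u (λ e → f (toList e ++ false ∷ bs)) + ΣB u (λ e → f (toList e ++ true ∷ bs)) ≡ ΣB (suc u) (λ e → f (toList e ++ bs))
ΣB-snoc zero    bs f = refl
ΣB-snoc (suc u) bs f = trans (+-interchange (ΣB u (λ e → f (false ∷ toList e ++ false ∷ bs))) _ _ _)
  (cong₂ _+_ (ΣB-snoc u bs (f ∘ (false ∷_))) (ΣB-snoc u bs (f ∘ (true ∷_))))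

ΣB-reverse : ∀ u bs (f : List Bool → ℕ) → ΣB u (λ e → f (toList e ʳ++ bs)) ≡ ΣB u (λ e → f (toList e ++ bs))
ΣB-reverse zero    bs f = refl
ΣB-reverse (suc u) bs f = trans (cong₂ _+_ (ΣB-reverse u (false ∷ bs) f) (ΣB-reverse u (true ∷ bs) f)) (ΣB-snoc u bs f)

suffix : ∀ {A : Set} a {m} → Vec A (a + m) → Vec A m
suffix zero    r       = r
suffix (suc a) (_ ∷ r) = suffix a r

prefix : ∀ {A : Set} b {c} → Vec A (b + c) → Vec A b
prefix zero    r       = []
prefix (suc b) (x ∷ r) = x ∷ prefix b r

-- A run in three stretches, of which only the middle one looks at its coins.
steps-through : ∀ a b {c} (r : Vec Bool (a + (b + c))) {κ κ₁ κ₂ κ₃} → κ ↦[ a ] κ₁ →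
                steps (prefix b (suffix a r)) κ₁ ≡ κ₂ → κ₂ ↦[ c ] κ₃ → steps r κ ≡ κ₃
steps-through zero    zero    r       p refl q rewrite p [] = q r
steps-through zero    (suc b) (x ∷ r) {κ} p eq q = steps-through zero b r stay (trans (cong (λ κ → steps (prefix b r) (step x κ)) (p [])) eq) q
steps-through (suc a) b       (x ∷ r) p eq q = steps-through a b r (λ r′ → p (x ∷ r′)) eq q

ΣB-suffix : ∀ a m f → ΣB (a + m) (f ∘ suffix a) ≡ 2 ^ a * ΣB m f
ΣB-suffix zero    m f = sym (+-identityʳ _)
ΣB-suffix (suc a) m f = trans (cong₂ _+_ (ΣB-suffix a m f) (ΣB-suffix a m f))
  (solve 2 (λ p x → p :* x :+ p :* x :≡ con 2 :* p :* x) refl (2 ^ a) (ΣB m f))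

ΣB-prefix : ∀ b c f → ΣB (b + c) (f ∘ prefix b) ≡ ΣB b f * 2 ^ c
ΣB-prefix zero    c f = trans (ΣB-const c (f [])) (*-comm (2 ^ c) _)
ΣB-prefix (suc b) c f = trans (cong₂ _+_ (ΣB-prefix b c _) (ΣB-prefix b c _)) (sym (*-distribʳ-+ (2 ^ c) (ΣB b (f ∘ (false ∷_))) _))

halted : ∀ {t σ} → ([] , σ) ↦[ t ] ([] , σ)
halted []      = refl
halted (b ∷ r) = halted r

halted-by : ∀ {κ σ t T} → t ≤ T → κ ↦[ t ] ([] , σ) → κ ↦[ T ] ([] , σ)
halted-by {t = t} t≤T go with m≤n⇒∃[o]m+o≡n t≤T
... | d , refl = go ▸ halted

-- The whole run and the distribution of the bits it uses.

-- The first assignment closes the input triple with nil, which makes it an environment.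
algorithm : ℕ → Program
algorithm k = 0 := cons (hd (var 0)) (cons (hd (tl (var 0))) (cons (tl (tl (var 0))) nil)) ⨾
              compile (prepare k) ⨾ tossing ⨾ compile diversify

module Execution (Z : ℕ) (2≤Z : 2 ≤ Z) (γ : ℕ) (γ≢0 : NonZero γ) {n k s : ℕ} (k≢0 : NonZero k) (F : CNF n) (F-width : F IsCNFOfWidth k)
                 (X≤Z : n + (s + 2) ≤ Z) (F≤Z : length F ≤ Z) (n+k<Z : suc (n + k) ≤ Z) (2^k≤Z : 2 ^ (k ∸ 1) ≤ Z)
                 (B≤γ : budget k {{k≢0}} n s ≤ γ) (Λ≤ : length (labels k {{k≢0}} n s) ≤ γ * Z ^ 10)
                 (tasks≤ : ∀ bs → totalPotential k (gathered n s (labels k {{k≢0}} n s) bs []) ≤ γ * Z ^ 10) where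
  open Routines Z 2≤Z using (_⊢_⇓_[_])
  open _⊢_⇓_[_] using (cost)
  open Preparation Z 2≤Z using (prepare-⇓)
  open Diversification Z 2≤Z γ γ≢0 using (diversify-⇓)

  Λ : List ℕ
  Λ = labels k {{k≢0}} n s

  u : ℕ
  u = length Λ * n

  tasksFrom : List Bool → List (Task n)
  tasksFrom bs = gathered n s Λ bs []

  Outputs : List Bool → List (Assignment n) → Set
  Outputs bs S = ∃[ S₁ ] Rounds.Fills F (literals n) (tasksFrom bs) s [] S₁ ×
                         Rounds.Swaps F (literals n) (tasksFrom bs) ((n + (s + 2)) ^ 3 * s) S₁ S

  -- The number of steps is the same for all coins. The equation about every f says that the
  -- extracted bits are uniformly distributed.
  Executions : Set
  Executions = ∃[ t ] t ≤ 5 + (γ * Z ^ deg (prepare k) + (u * 4 + γ * Z ^ deg diversify)) × ∃[ bits ]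
    (∀ f → ΣB t (f ∘ bits) * 2 ^ u ≡ 2 ^ t * ΣB u (f ∘ toList)) ×
    (∀ r → ∃[ S ] Outputs (bits r) S × run {t} (algorithm k) (encodeInput F s) r ≡ just (encodeAssignments S))

  σ₀ : Store
  σ₀ = update 0 (encodeℕ n ∙ encodeCNF F ∙ encodeℕ s ∙ nil) (update 0 (encodeInput F s) (λ _ → nil))

  ρ₁ : Tree
  ρ₁ = encodeℕ n ∙ encodeCNF F ∙ encodeℕ s ∙ encodeNumbers Λ ∙ nil

  Prepared : Set
  Prepared = ∃[ t ] ∃[ σ ] t ≤ γ * Z ^ deg (prepare k) × σ 0 ≡ encodeℕ u ∙ nil ∙ ρ₁ × σ 1 ≡ σ₀ 1 ×
    (compile (prepare k) ∷ (tossing ⨾ compile diversify) ∷ [] , σ₀) ↦[ t ] ((tossing ⨾ compile diversify) ∷ [] , σ)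

  Diversified : List Bool → Store → Set
  Diversified bs σ = ∃[ S ] Outputs bs S × ∃[ t ] ∃[ σ′ ] t ≤ γ * Z ^ deg diversify × σ′ 0 ≡ encodeAssignments S ×
    (compile diversify ∷ [] , σ) ↦[ t ] ([] , σ′)

  abstract
    prepared : Prepared
    prepared = execute (cost (prepare-⇓ k k≢0 2^k≤Z γ γ≢0 n s n+k<Z X≤Z B≤γ Λ≤)) refl

    diversified : ∀ bs σ → σ 0 ≡ nil ∙ encodeBits bs ∙ ρ₁ → Diversified bs σ
    diversified bs σ σ0 =
      let S₁ , S , fills , swaps , div = diversify-⇓ k≢0 F F-width Λ bs X≤Z F≤Z (≤-trans (m≤n+m k (suc n)) n+k<Z) Λ≤ (tasks≤ bs)
          t , σ′ , t≤ , σ′0 , _ , go = execute (cost div) σ0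
      in S , (S₁ , fills , swaps) , t , σ′ , t≤ , σ′0 , go

  executing : Prepared → Executions
  executing (t₁ , σ₁ , t₁≤ , σ₁0 , _ , go₁) = t , t≤ , bits , uniform , outcome
    where
    a b c t : ℕ
    a = 3 + (t₁ + 1)
    b = u * 4 + 1
    -- The length of this last stretch may depend on the tossed bits. Its bound is used instead; the
    -- machine idles after halting.
    c = γ * Z ^ deg diversify
    t = a + (b + c)
    t≤ : t ≤ 5 + (γ * Z ^ deg (prepare k) + (u * 4 + c))
    t≤ = ≤-trans (≤-reflexive (solve 3 (λ p q r → con 3 :+ (p :+ con 1) :+ (q :+ con 1 :+ r) :≡ con 5 :+ (p :+ (q :+ r))) refl t₁ (u * 4) c))
                 (+-monoʳ-≤ 5 (+-monoˡ-≤ (u * 4 + c) t₁≤))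
    bits : Vec Bool t → List Bool
    bits r = tossed u (prefix b (suffix a {b + c} r)) []
    uniform : ∀ f → ΣB t (f ∘ bits) * 2 ^ u ≡ 2 ^ t * ΣB u (f ∘ toList)
    uniform f = begin
      ΣB t (f ∘ bits) * 2 ^ u
        ≡⟨ cong (_* 2 ^ u) (trans (ΣB-suffix a (b + c) _) (cong (2 ^ a *_) (ΣB-prefix b c (λ r → f (tossed u r []))))) ⟩
      2 ^ a * (ΣB b (λ r → f (tossed u r [])) * 2 ^ c) * 2 ^ u
        ≡⟨ solve 4 (λ p q r s → p :* (q :* r) :* s :≡ p :* (q :* s :* r)) refl (2 ^ a) (ΣB b (λ r → f (tossed u r []))) (2 ^ c) (2 ^ u) ⟩
      2 ^ a * (ΣB b (λ r → f (tossed u r [])) * 2 ^ u * 2 ^ c)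
        ≡⟨ cong (λ x → 2 ^ a * (x * 2 ^ c)) (trans (ΣB-tossed u [] f) (cong (2 ^ b *_) (trans (ΣB-reverse u [] f) (ΣB-cong u (λ e → cong f (++-identityʳ (toList e))))))) ⟩
      2 ^ a * (2 ^ b * ΣB u (f ∘ toList) * 2 ^ c)
        ≡⟨ solve 4 (λ p q r s → p :* (q :* r :* s) :≡ p :* (q :* s) :* r) refl (2 ^ a) (2 ^ b) (ΣB u (f ∘ toList)) (2 ^ c) ⟩
      2 ^ a * (2 ^ b * 2 ^ c) * ΣB u (f ∘ toList)
        ≡⟨ cong (_* ΣB u (f ∘ toList)) (trans (cong (2 ^ a *_) (sym (^-distribˡ-+-* 2 b c))) (sym (^-distribˡ-+-* 2 a (b + c)))) ⟩
      2 ^ t * ΣB u (f ∘ toList) ∎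
      where open ≡-Reasoning
    start : initial (algorithm k) (encodeInput F s) ↦[ a ] (tossing ∷ compile diversify ∷ [] , σ₁)
    start = (λ _ → refl) ▹ (λ _ → refl) ▹ (λ _ → refl) ▹ go₁ ▸ (λ _ → refl) ▹ stay
    outcome : ∀ r → ∃[ S ] Outputs (bits r) S × run {t} (algorithm k) (encodeInput F s) r ≡ just (encodeAssignments S)
    outcome r =
      let σ₂ , go₂ , σ₂0 = tossing-runs {compile diversify ∷ []} u [] σ₁ σ₁0 (prefix b (suffix a {b + c} r))
          S , outputs , t₂ , σ₃ , t₂≤ , σ₃0 , go₃ = diversified (bits r) σ₂ σ₂0
      in S , outputs , trans (cong output (steps-through a b r start go₂ (halted-by t₂≤ go₃))) (cong just σ₃0)

  abstract
    executions : Executions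
    executions = executing prepared

-- Double sums of distances

Σ[] : ∀ {A : Set} → List A → (A → ℕ) → ℕ
Σ[] xs f = sum (map f xs)

module _ {A : Set} where

  Σ[]-mono : ∀ (xs : List A) {f g} → (∀ {x} → x ∈ xs → f x ≤ g x) → Σ[] xs f ≤ Σ[] xs g
  Σ[]-mono []       le = z≤n
  Σ[]-mono (x ∷ xs) le = +-mono-≤ (le (here refl)) (Σ[]-mono xs (le ∘ there))

  Σ[]-cong : ∀ (xs : List A) {f g} → (∀ x → f x ≡ g x) → Σ[] xs f ≡ Σ[] xs g
  Σ[]-cong []       eq = refl
  Σ[]-cong (x ∷ xs) eq = cong₂ _+_ (eq x) (Σ[]-cong xs eq)

  Σ[]-+ : ∀ (xs : List A) (f g : A → ℕ) → Σ[] xs (λ x → f x + g x) ≡ Σ[] xs f + Σ[] xs g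
  Σ[]-+ []       f g = refl
  Σ[]-+ (x ∷ xs) f g = trans (cong (f x + g x +_) (Σ[]-+ xs f g)) (+-interchange (f x) (g x) _ _)

  Σ[]-* : ∀ (xs : List A) c (f : A → ℕ) → Σ[] xs (λ x → c * f x) ≡ c * Σ[] xs f
  Σ[]-* []       c f = sym (*-zeroʳ c)
  Σ[]-* (x ∷ xs) c f = trans (cong (c * f x +_) (Σ[]-* xs c f)) (sym (*-distribˡ-+ c (f x) _))

  Σ[]-const : ∀ (xs : List A) c → Σ[] xs (λ _ → c) ≡ length xs * c
  Σ[]-const []       c = refl
  Σ[]-const (x ∷ xs) c = cong (c +_) (Σ[]-const xs c)

  Σ[]-↭ : ∀ {xs ys : List A} (f : A → ℕ) → xs ↭ ys → Σ[] xs f ≡ Σ[] ys f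
  Σ[]-↭ f p = sum-↭ (map⁺ f p)

  Σ[]-split : ∀ {P : Pred A 0ℓ} (P? : Decidable P) xs f → Σ[] xs f ≡ Σ[] (filter P? xs) f + Σ[] (filter (¬? ∘ P?) xs) f
  Σ[]-split P? []       f = refl
  Σ[]-split P? (x ∷ xs) f with P? x
  ... | yes _ = trans (cong (f x +_) (Σ[]-split P? xs f)) (sym (+-assoc (f x) _ _))
  ... | no  _ = trans (cong (f x +_) (Σ[]-split P? xs f)) (x∙yz≡y∙xz (f x) (Σ[] (filter P? xs) f) _)
    where
    x∙yz≡y∙xz : ∀ a b c → a + (b + c) ≡ b + (a + c)
    x∙yz≡y∙xz a b c = trans (sym (+-assoc a b c)) (trans (cong (_+ c) (+-comm a b)) (+-assoc b a c))

Σ[]-swap : ∀ {A B : Set} (xs : List A) (ys : List B) (f : A → B → ℕ) →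
           Σ[] xs (λ x → Σ[] ys (f x)) ≡ Σ[] ys (λ y → Σ[] xs (λ x → f x y))
Σ[]-swap []       ys f = sym (trans (Σ[]-const ys 0) (*-zeroʳ (length ys)))
Σ[]-swap (x ∷ xs) ys f = trans (cong (Σ[] ys (f x) +_) (Σ[]-swap xs ys f)) (sym (Σ[]-+ ys (f x) _))

module _ {n : ℕ} where

  -- Over ordered pairs, so that `D S S` is twice `sumPD S`.
  D : List (Assignment n) → List (Assignment n) → ℕ
  D A B = Σ[] A (λ a → distanceSum a B)

  D-sym : ∀ A B → D A B ≡ D B A
  D-sym A B = trans (Σ[]-swap A B dH) (Σ[]-cong B (λ b → Σ[]-cong A (λ a → dH-sym a b)))

  distanceSum-↭ : ∀ (a : Assignment n) {B C} → B ↭ C → distanceSum a B ≡ distanceSum a C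
  distanceSum-↭ a = Σ[]-↭ (dH a)

  D-↭ : ∀ {A B : List (Assignment n)} → A ↭ B → D A A ≡ D B B
  D-↭ {A} {B} p = trans (Σ[]-↭ (λ a → distanceSum a A) p) (Σ[]-cong B (λ b → distanceSum-↭ b p))

  D-∷ : ∀ x A → D (x ∷ A) (x ∷ A) ≡ D A A + 2 * distanceSum x A
  D-∷ x A = begin
    dH x x + distanceSum x A + Σ[] A (λ a → dH a x + distanceSum a A)
      ≡⟨ cong₂ (λ p q → p + distanceSum x A + q) (dH-refl x) (Σ[]-+ A (λ a → dH a x) _) ⟩
    distanceSum x A + (Σ[] A (λ a → dH a x) + D A A)
      ≡⟨ cong (λ p → distanceSum x A + (p + D A A)) (Σ[]-cong A (λ a → dH-sym a x)) ⟩
    distanceSum x A + (distanceSum x A + D A A)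
      ≡⟨ solve 2 (λ p q → p :+ (p :+ q) :≡ q :+ con 2 :* p) refl (distanceSum x A) (D A A) ⟩
    D A A + 2 * distanceSum x A ∎
    where open ≡-Reasoning

  sum-cartesianProductWith : ∀ (A B : List (Assignment n)) → sum (cartesianProductWith dH A B) ≡ D A B
  sum-cartesianProductWith []      B = refl
  sum-cartesianProductWith (a ∷ A) B = trans (sum-++ (map (dH a) B) _) (cong (distanceSum a B +_) (sum-cartesianProductWith A B))

  triangle-through : ∀ x A B → D A B ≤ length B * distanceSum x A + length A * distanceSum x B
  triangle-through x A B = begin
    D A B                                                       ≤⟨ Σ[]-mono A (λ {a} _ → Σ[]-mono B (λ {b} _ → dH-triangle a x b)) ⟩
    Σ[] A (λ a → Σ[] B (λ b → dH a x + dH x b))                 ≡⟨ Σ[]-cong A (λ a → trans (Σ[]-+ B _ _) (cong (_+ distanceSum x B) (Σ[]-const B (dH a x)))) ⟩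
    Σ[] A (λ a → length B * dH a x + distanceSum x B)           ≡⟨ trans (Σ[]-+ A _ _) (cong₂ _+_ (Σ[]-* A (length B) _) (Σ[]-const A _)) ⟩
    length B * Σ[] A (λ a → dH a x) + length A * distanceSum x B ≡⟨ cong (λ p → length B * p + length A * distanceSum x B) (Σ[]-cong A (λ a → dH-sym a x)) ⟩
    length B * distanceSum x A + length A * distanceSum x B     ∎
    where open ≤-Reasoning

  -- The triangle inequality through x for all ordered pairs of distinct positions in O: each
  -- distance from x occurs 2 * (length O - 1) times. Leaving out the diagonal saves the term 2 *
  -- distanceSum x O, which matters for the constant.
  star-bound : ∀ x O → D O O + 2 * distanceSum x O ≤ 2 * length O * distanceSum x O
  star-bound x []      = z≤n
  star-bound x (o ∷ O) = begin
    D (o ∷ O) (o ∷ O) + 2 * (d + t)                  ≡⟨ cong (_+ 2 * (d + t)) (D-∷ o O) ⟩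
    D O O + 2 * distanceSum o O + 2 * (d + t)        ≤⟨ +-monoˡ-≤ (2 * (d + t)) (+-monoʳ-≤ (D O O) (*-monoʳ-≤ 2 spoke)) ⟩
    D O O + 2 * (length O * d + t) + 2 * (d + t)     ≡⟨ solve 4 (λ w l d t → w :+ con 2 :* (l :* d :+ t) :+ con 2 :* (d :+ t) :≡ w :+ con 2 :* t :+ (con 2 :* (l :* d) :+ con 2 :* (d :+ t))) refl (D O O) (length O) d t ⟩
    D O O + 2 * t + (2 * (length O * d) + 2 * (d + t)) ≤⟨ +-monoˡ-≤ _ (star-bound x O) ⟩
    2 * length O * t + (2 * (length O * d) + 2 * (d + t)) ≡⟨ solve 3 (λ l d t → con 2 :* l :* t :+ (con 2 :* (l :* d) :+ con 2 :* (d :+ t)) :≡ con 2 :* (con 1 :+ l) :* (d :+ t)) refl (length O) d t ⟩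
    2 * suc (length O) * (d + t)                     ∎
    where
    open ≤-Reasoning
    d t : ℕ
    d = dH x o
    t = distanceSum x O
    spoke : distanceSum o O ≤ length O * d + t
    spoke = begin
      Σ[] O (dH o)                    ≤⟨ Σ[]-mono O (λ {y} _ → dH-triangle o x y) ⟩
      Σ[] O (λ y → dH o x + dH x y)   ≡⟨ trans (Σ[]-+ O _ _) (cong (_+ t) (trans (Σ[]-const O _) (cong (length O *_) (dH-sym o x)))) ⟩
      length O * d + t                ∎

-- The Hamming metric is of negative type: in each coordinate the defect is
-- twice the square of the difference of the numbers of ones.

bitD : List Bool → List Bool → ℕ
bitD bs cs = Σ[] bs (λ b → Σ[] cs (δ b))

#true #false : List Bool → ℕ
#true  bs = Σ[] bs (δ false)
#false bs = Σ[] bs (δ true)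

#true+#false : ∀ bs → #true bs + #false bs ≡ length bs
#true+#false bs = trans (sym (Σ[]-+ bs _ _)) (trans (Σ[]-cong bs (λ { true → refl ; false → refl })) (trans (Σ[]-const bs 1) (*-identityʳ _)))

bitD-≡ : ∀ bs cs → bitD bs cs ≡ #true bs * #false cs + #false bs * #true cs
bitD-≡ []           cs = refl
bitD-≡ (true ∷ bs)  cs = trans (cong (#false cs +_) (bitD-≡ bs cs)) (sym (+-assoc (#false cs) _ _))
bitD-≡ (false ∷ bs) cs = trans (cong (#true cs +_) (bitD-≡ bs cs))
  (solve 4 (λ p q r s → s :+ (p :* r :+ q :* s) :≡ p :* r :+ (s :+ q :* s)) refl (#true bs) (#false bs) (#false cs) (#true cs))

bitD-negative-type : ∀ bs cs → length bs ≡ length cs → bitD bs bs + bitD cs cs ≤ 2 * bitD bs cs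
bitD-negative-type bs cs eq = subst₃ (bitD-≡ bs bs) (bitD-≡ cs cs) (bitD-≡ bs cs)
  (go (≤-total (#true bs) (#true cs)) (trans (#true+#false bs) (trans eq (sym (#true+#false cs)))))
  where
  subst₃ : ∀ {a b c a′ b′ c′} → a ≡ a′ → b ≡ b′ → c ≡ c′ → a′ + b′ ≤ 2 * c′ → a + b ≤ 2 * c
  subst₃ refl refl refl le = le
  go : ∀ {t f t′ f′} → t ≤ t′ ⊎ t′ ≤ t → t + f ≡ t′ + f′ → (t * f + f * t) + (t′ * f′ + f′ * t′) ≤ 2 * (t * f′ + f * t′)
  go {t} {f} {_} {f′} (inj₁ t≤t′) eq with m≤n⇒∃[o]m+o≡n t≤t′
  ... | e , refl with +-cancelˡ-≡ t f (e + f′) (trans eq (+-assoc t e f′))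
  ...   | refl = ≤-trans (m≤m+n _ (2 * (e * e))) (≤-reflexive (solve 3 (λ t e f →
            (t :* (e :+ f) :+ (e :+ f) :* t) :+ ((t :+ e) :* f :+ f :* (t :+ e)) :+ con 2 :* (e :* e) :≡ con 2 :* (t :* f :+ (e :+ f) :* (t :+ e))) refl t e f′))
  go {_} {f} {t′} {f′} (inj₂ t′≤t) eq with m≤n⇒∃[o]m+o≡n t′≤t
  ... | e , refl with +-cancelˡ-≡ t′ (e + f) f′ (trans (sym (+-assoc t′ e f)) eq)
  ...   | refl = ≤-trans (m≤m+n _ (2 * (e * e))) (≤-reflexive (solve 3 (λ t e f →
            ((t :+ e) :* f :+ f :* (t :+ e)) :+ (t :* (e :+ f) :+ (e :+ f) :* t) :+ con 2 :* (e :* e) :≡ con 2 :* ((t :+ e) :* (e :+ f) :+ f :* t)) refl t′ e f))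

D-split : ∀ {n} (A B : List (Assignment (suc n))) → D A B ≡ bitD (map Vec.head A) (map Vec.head B) + D (map Vec.tail A) (map Vec.tail B)
D-split []      B = refl
D-split (a ∷ A) B = trans (cong₂ _+_ (row a B) (D-split A B)) (+-interchange (Σ[] (map Vec.head B) (δ (Vec.head a))) _ _ _)
  where
  row : ∀ {n} (a : Assignment (suc n)) B → distanceSum a B ≡ Σ[] (map Vec.head B) (δ (Vec.head a)) + distanceSum (Vec.tail a) (map Vec.tail B)
  row a       []            = refl
  row (b ∷ a) ((c ∷ z) ∷ B) = trans (cong₂ _+_ (dH-∷ b c a z) (row (b ∷ a) B)) (+-interchange (δ b c) _ _ _)

negative-type : ∀ {n} (A B : List (Assignment n)) → length A ≡ length B → D A A + D B B ≤ 2 * D A B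
negative-type {zero}  A B eq = ≤-trans (≤-reflexive (cong₂ _+_ (zeros A A) (zeros B B))) z≤n
  where
  zeros : ∀ A B → D {0} A B ≡ 0
  zeros A B = trans (Σ[]-cong A (λ { [] → trans (Σ[]-cong B (λ { [] → refl })) (trans (Σ[]-const B 0) (*-zeroʳ (length B))) })) (trans (Σ[]-const A 0) (*-zeroʳ (length A)))
negative-type {suc n} A B eq = begin
  D A A + D B B
    ≡⟨ cong₂ _+_ (D-split A A) (D-split B B) ⟩
  (bitD hA hA + D tA tA) + (bitD hB hB + D tB tB)
    ≡⟨ +-interchange (bitD hA hA) _ _ _ ⟩
  (bitD hA hA + bitD hB hB) + (D tA tA + D tB tB)
    ≤⟨ +-mono-≤ (bitD-negative-type hA hB (trans (length-map _ A) (trans eq (sym (length-map _ B)))))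
                (negative-type tA tB (trans (length-map _ A) (trans eq (sym (length-map _ B))))) ⟩
  2 * bitD hA hB + 2 * D tA tB
    ≡⟨ trans (cong (2 *_) (D-split A B)) (*-distribˡ-+ 2 (bitD hA hB) _) ⟨
  2 * D A B ∎
  where
  open ≤-Reasoning
  hA = map Vec.head A
  hB = map Vec.head B
  tA = map Vec.tail A
  tB = map Vec.tail B

-- Locally optimal sets of solutions

_∈?_ : ∀ {n} (z : Assignment n) (A : List (Assignment n)) → Dec (z ∈ A)
_∈?_ {n} = DecMembership._∈?_ (VecP.≡-dec {n = n} BoolP._≟_)

-- Up to the factor (k - 1) / (k + 1), replacing x by the solution o does not
-- increase the sum of distances.
Unswappable : ∀ {n} → ℕ → (Assignment n → Set) → List (Assignment n) → Assignment n → Set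
Unswappable k Sol S x = ∀ o → Sol o → o ∉ S → (k ∸ 1) * distanceSum o S ≤ suc k * distanceSum x S + (k ∸ 1) * dH o x

-- The two ratios with denominators cleared: they are (k - 1) / (2 (k + 1)) and, after multiplying
-- numerator and denominator by (k + 3) s, (k - 1) (s - 1) / ((k + 3) s + (k - 1)).
record Ratios {n : ℕ} (k : ℕ) (S O : List (Assignment n)) : Set where
  constructor ratios
  field
    small : (k ∸ 1) * D O O ≤ 2 * suc k * D S S
    large : (k ∸ 1) * (length S ∸ 1) * D O O ≤ ((k + 3) * length S + (k ∸ 1)) * D S S

-- Eliminates the cross sum d: from (k - 1) (s - 1) d ≤ (k + 1) s e and e + o ≤ 2 d, the coefficient
-- of e becomes 2 (k + 1) s - (k - 1) (s - 1), which equals (k + 3) s + (k - 1).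
combine : ∀ k s e o d → (k ∸ 1) * (s * d) ≤ suc k * (s * e) + (k ∸ 1) * d → e + o ≤ 2 * d →
          (k ∸ 1) * (s ∸ 1) * o ≤ ((k + 3) * s + (k ∸ 1)) * e
combine zero    s       e o d cross neg = z≤n
combine (suc k) zero    e o d cross neg = ≤-trans (≤-reflexive (cong (_* o) (*-zeroʳ k))) z≤n
combine (suc k) (suc s) e o d cross neg = +-cancelʳ-≤ (k * (s * e) + 2 * (k * d)) _ _ (begin
  k * s * o + (k * (s * e) + 2 * (k * d))
    ≡⟨ solve 5 (λ k s o e d → k :* s :* o :+ (k :* (s :* e) :+ con 2 :* (k :* d)) :≡ k :* (s :* (e :+ o)) :+ con 2 :* (k :* d)) refl k s o e d ⟩
  k * (s * (e + o)) + 2 * (k * d)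
    ≤⟨ +-monoˡ-≤ (2 * (k * d)) (*-monoʳ-≤ k (*-monoʳ-≤ s neg)) ⟩
  k * (s * (2 * d)) + 2 * (k * d)
    ≡⟨ solve 3 (λ k s d → k :* (s :* (con 2 :* d)) :+ con 2 :* (k :* d) :≡ con 2 :* (k :* ((con 1 :+ s) :* d))) refl k s d ⟩
  2 * (k * (suc s * d))
    ≤⟨ *-monoʳ-≤ 2 cross ⟩
  2 * (suc (suc k) * (suc s * e) + k * d)
    ≡⟨ solve 4 (λ k s e d → con 2 :* ((con 2 :+ k) :* ((con 1 :+ s) :* e) :+ k :* d)
         :≡ ((con 1 :+ k :+ con 3) :* (con 1 :+ s) :+ k) :* e :+ (k :* (s :* e) :+ con 2 :* (k :* d))) refl k s e d ⟩
  ((suc k + 3) * suc s + k) * e + (k * (s * e) + 2 * (k * d)) ∎)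
  where open ≤-Reasoning

module LocalOptimum {n k : ℕ} {Sol : Assignment n → Set} {S O : List (Assignment n)}
                    (S! : Unique S) (O! : Unique O) (O-sol : All Sol O) (∣S∣≡∣O∣ : length S ≡ length O)
                    (optimal : ∀ {x} → x ∈ S → Unswappable k Sol S x) where

  A Y P A′ : List (Assignment n)
  A  = filter (_∈? O) S
  Y  = filter (¬? ∘ (_∈? O)) S
  A′ = filter (_∈? S) O
  P  = filter (¬? ∘ (_∈? S)) O

  A↭A′ : A ↭ A′
  A↭A′ = ∼bag⇒↭ (unique∧set⇒bag (UniqueP.filter⁺ (_∈? O) S!) (UniqueP.filter⁺ (_∈? S) O!) (mk⇔ to from))
    where
    to : ∀ {z} → z ∈ A → z ∈ A′
    to z∈ with ∈-filter⁻ (_∈? O) {xs = S} z∈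
    ... | z∈S , z∈O = ∈-filter⁺ (_∈? S) z∈O z∈S
    from : ∀ {z} → z ∈ A′ → z ∈ A
    from z∈ with ∈-filter⁻ (_∈? S) {xs = O} z∈
    ... | z∈O , z∈S = ∈-filter⁺ (_∈? O) z∈S z∈O

  q : ℕ
  q = length Y

  ΣS : ∀ f → Σ[] S f ≡ Σ[] A f + Σ[] Y f
  ΣS = Σ[]-split (_∈? O) S

  ΣO : ∀ f → Σ[] O f ≡ Σ[] A f + Σ[] P f
  ΣO f = trans (Σ[]-split (_∈? S) O f) (cong (_+ Σ[] P f) (sym (Σ[]-↭ f A↭A′)))

  ∣S∣ : length S ≡ length A + q
  ∣S∣ = trans (sym (card S)) (trans (ΣS (λ _ → 1)) (cong₂ _+_ (card A) (card Y)))
    where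
    card : ∀ (B : List (Assignment n)) → Σ[] B (λ _ → 1) ≡ length B
    card B = trans (Σ[]-const B 1) (*-identityʳ _)

  ∣P∣≡q : length P ≡ q
  ∣P∣≡q = +-cancelˡ-≡ (length A) _ _ (trans (sym (trans (sym (card O)) (trans (ΣO (λ _ → 1)) (cong₂ _+_ (card A) (card P))))) (trans (sym ∣S∣≡∣O∣) ∣S∣))
    where
    card : ∀ (B : List (Assignment n)) → Σ[] B (λ _ → 1) ≡ length B
    card B = trans (Σ[]-const B 1) (*-identityʳ _)

  swap-one : ∀ {y} → y ∈ Y → (k ∸ 1) * D P S ≤ suc k * (q * distanceSum y S) + (k ∸ 1) * distanceSum y P
  swap-one {y} y∈Y = begin
    (k ∸ 1) * D P S
      ≡⟨ Σ[]-* P (k ∸ 1) _ ⟨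
    Σ[] P (λ o → (k ∸ 1) * distanceSum o S)
      ≤⟨ Σ[]-mono P (λ o∈P → optimal (proj₁ (∈-filter⁻ (¬? ∘ (_∈? O)) {xs = S} y∈Y)) _
           (AllP.lookup O-sol (proj₁ (∈-filter⁻ (¬? ∘ (_∈? S)) {xs = O} o∈P))) (proj₂ (∈-filter⁻ (¬? ∘ (_∈? S)) {xs = O} o∈P))) ⟩
    Σ[] P (λ o → suc k * distanceSum y S + (k ∸ 1) * dH o y)
      ≡⟨ trans (Σ[]-+ P _ _) (cong₂ _+_ (Σ[]-const P _) (Σ[]-* P (k ∸ 1) _)) ⟩
    length P * (suc k * distanceSum y S) + (k ∸ 1) * Σ[] P (λ o → dH o y)
      ≡⟨ cong₂ (λ p t → p * (suc k * distanceSum y S) + (k ∸ 1) * t) ∣P∣≡q (Σ[]-cong P (λ o → dH-sym o y)) ⟩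
    q * (suc k * distanceSum y S) + (k ∸ 1) * distanceSum y P
      ≡⟨ cong (_+ (k ∸ 1) * distanceSum y P) (solve 3 (λ a b c → a :* (b :* c) :≡ b :* (a :* c)) refl q (suc k) (distanceSum y S)) ⟩
    suc k * (q * distanceSum y S) + (k ∸ 1) * distanceSum y P ∎
    where open ≤-Reasoning

  swap-all : (k ∸ 1) * (q * D P S) ≤ suc k * (q * D Y S) + (k ∸ 1) * D Y P
  swap-all = begin
    (k ∸ 1) * (q * D P S)
      ≡⟨ solve 3 (λ a b c → a :* (b :* c) :≡ b :* (a :* c)) refl (k ∸ 1) q (D P S) ⟩
    q * ((k ∸ 1) * D P S)
      ≡⟨ Σ[]-const Y _ ⟨
    Σ[] Y (λ _ → (k ∸ 1) * D P S)
      ≤⟨ Σ[]-mono Y swap-one ⟩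
    Σ[] Y (λ y → suc k * (q * distanceSum y S) + (k ∸ 1) * distanceSum y P)
      ≡⟨ trans (Σ[]-+ Y _ _) (cong₂ _+_ (trans (Σ[]-* Y (suc k) _) (cong (suc k *_) (Σ[]-* Y q _))) (Σ[]-* Y (k ∸ 1) _)) ⟩
    suc k * (q * D Y S) + (k ∸ 1) * D Y P ∎
    where open ≤-Reasoning

  k-1≤1+k : k ∸ 1 ≤ suc k
  k-1≤1+k = ≤-trans (m∸n≤m k 1) (n≤1+n k)

  -- Adds the common elements to `swap-all`. No swap inequality exists for them, but k - 1 ≤ k + 1
  -- is enough, as they occur on both sides.
  swap-total : (k ∸ 1) * (q * D O S) ≤ suc k * (q * D S S) + (k ∸ 1) * D Y P
  swap-total = begin
    (k ∸ 1) * (q * D O S)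
      ≡⟨ cong (λ d → (k ∸ 1) * (q * d)) (ΣO _) ⟩
    (k ∸ 1) * (q * (D A S + D P S))
      ≡⟨ solve 4 (λ a b c d → a :* (b :* (c :+ d)) :≡ a :* (b :* c) :+ a :* (b :* d)) refl (k ∸ 1) q (D A S) (D P S) ⟩
    (k ∸ 1) * (q * D A S) + (k ∸ 1) * (q * D P S)
      ≤⟨ +-mono-≤ (*-monoˡ-≤ (q * D A S) k-1≤1+k) swap-all ⟩
    suc k * (q * D A S) + (suc k * (q * D Y S) + (k ∸ 1) * D Y P)
      ≡⟨ solve 5 (λ a b c d e → a :* (b :* c) :+ (a :* (b :* d) :+ e) :≡ a :* (b :* (c :+ d)) :+ e) refl (suc k) q (D A S) (D Y S) ((k ∸ 1) * D Y P) ⟩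
    suc k * (q * (D A S + D Y S)) + (k ∸ 1) * D Y P
      ≡⟨ cong (λ d → suc k * (q * d) + (k ∸ 1) * D Y P) (ΣS _) ⟨
    suc k * (q * D S S) + (k ∸ 1) * D Y P ∎
    where open ≤-Reasoning

  -- Averaging the triangle inequality over the common elements A.
  detour : length S * D Y P ≤ q * D O S
  detour = begin
    length S * D Y P                                      ≡⟨ cong (_* D Y P) ∣S∣ ⟩
    (length A + q) * D Y P                                ≡⟨ *-distribʳ-+ (D Y P) (length A) q ⟩
    length A * D Y P + q * D Y P                          ≡⟨ cong (_+ q * D Y P) (Σ[]-const A _) ⟨
    Σ[] A (λ _ → D Y P) + q * D Y P                       ≤⟨ +-monoˡ-≤ (q * D Y P) (Σ[]-mono A (λ {a} _ → triangle-through a Y P)) ⟩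
    Σ[] A (λ a → length P * distanceSum a Y + q * distanceSum a P) + q * D Y P
      ≡⟨ cong (_+ q * D Y P) (trans (Σ[]-+ A _ _) (cong₂ _+_ (trans (Σ[]-* A (length P) _) (cong (_* D A Y) ∣P∣≡q)) (Σ[]-* A q _))) ⟩
    q * D A Y + q * D A P + q * D Y P                     ≡⟨ solve 4 (λ q a b c → q :* a :+ q :* b :+ q :* c :≡ q :* (a :+ (b :+ c))) refl q (D A Y) (D A P) (D Y P) ⟩
    q * (D A Y + (D A P + D Y P))                         ≤⟨ *-monoʳ-≤ q cross ⟩
    q * D O S                                             ∎
    where
    open ≤-Reasoning
    cross : D A Y + (D A P + D Y P) ≤ D O S
    cross = begin
      D A Y + (D A P + D Y P)                  ≤⟨ m≤n+m _ (D A A) ⟩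
      D A A + (D A Y + (D A P + D Y P))        ≡⟨ cong₂ (λ s t → D A A + (D A Y + (s + t))) (D-sym A P) (D-sym Y P) ⟩
      D A A + (D A Y + (D P A + D P Y))        ≡⟨ +-assoc (D A A) _ _ ⟨
      D A A + D A Y + (D P A + D P Y)          ≡⟨ cong₂ _+_ (Σ[]-+ A _ _) (Σ[]-+ P _ _) ⟨
      Σ[] A (λ o → distanceSum o A + distanceSum o Y) + Σ[] P (λ o → distanceSum o A + distanceSum o Y)
        ≡⟨ cong₂ _+_ (Σ[]-cong A (λ o → ΣS (dH o))) (Σ[]-cong P (λ o → ΣS (dH o))) ⟨
      D A S + D P S                            ≡⟨ ΣO _ ⟨
      D O S                                    ∎

  -- For disjoint S and O this is `swap-all`. In general, s times `swap-total` together with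
  -- `detour` is q times the claim, and q can be cancelled unless it is zero.
  cross-bound : (k ∸ 1) * (length S * D O S) ≤ suc k * (length S * D S S) + (k ∸ 1) * D O S
  cross-bound with q in q≡
  ... | suc q′ = *-cancelˡ-≤ (suc q′) (begin
    suc q′ * ((k ∸ 1) * (s * d))
      ≡⟨ solve 4 (λ q a s d → q :* (a :* (s :* d)) :≡ s :* (a :* (q :* d))) refl (suc q′) (k ∸ 1) s d ⟩
    s * ((k ∸ 1) * (suc q′ * d))
      ≤⟨ *-monoʳ-≤ s (subst (λ q → (k ∸ 1) * (q * D O S) ≤ suc k * (q * D S S) + (k ∸ 1) * D Y P) q≡ swap-total) ⟩
    s * (suc k * (suc q′ * D S S) + (k ∸ 1) * D Y P)
      ≡⟨ solve 6 (λ s b q e a t → s :* (b :* (q :* e) :+ a :* t) :≡ q :* (b :* (s :* e)) :+ a :* (s :* t)) refl s (suc k) (suc q′) (D S S) (k ∸ 1) (D Y P) ⟩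
    suc q′ * (suc k * (s * D S S)) + (k ∸ 1) * (s * D Y P)
      ≤⟨ +-monoʳ-≤ (suc q′ * (suc k * (s * D S S))) (*-monoʳ-≤ (k ∸ 1) (subst (λ q → s * D Y P ≤ q * D O S) q≡ detour)) ⟩
    suc q′ * (suc k * (s * D S S)) + (k ∸ 1) * (suc q′ * d)
      ≡⟨ solve 4 (λ q x a d → q :* x :+ a :* (q :* d) :≡ q :* (x :+ a :* d)) refl (suc q′) (suc k * (s * D S S)) (k ∸ 1) d ⟩
    suc q′ * (suc k * (s * D S S) + (k ∸ 1) * d) ∎)
    where
    open ≤-Reasoning
    s d : ℕ
    s = length S
    d = D O S
  -- Then S and O have the same elements and both double sums agree.
  ... | zero = ≤-trans (*-mono-≤ k-1≤1+k (*-monoʳ-≤ (length S) (≤-trans (≤-reflexive (ΣO _)) (≤-trans (+-monoʳ-≤ (D A S) (≤-reflexive P-empty)) (≤-trans (+-monoʳ-≤ (D A S) z≤n) (≤-reflexive (sym (ΣS _)))))))) (m≤m+n _ _)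
    where
    P-empty : D P S ≡ 0
    P-empty with P | trans ∣P∣≡q q≡
    ... | [] | _ = refl

  ratios-hold : .{{_ : NonZero (length S)}} → Ratios k S O
  ratios-hold = ratios small large
    where
    open ≤-Reasoning
    s d : ℕ
    s = length S
    d = D O S
    -- `star-bound` summed over x in S gives s * D O O ≤ 2 (s - 1) d. The factor s - 1 is the one in
    -- (k - 1) (s - 1) d ≤ (k + 1) s * D S S, so that it cancels and the first ratio does not depend
    -- on s.
    stars : s * D O O + 2 * d ≤ 2 * s * d
    stars = begin
      s * D O O + 2 * D O S
        ≡⟨ cong₂ _+_ (Σ[]-const S _) (trans (Σ[]-* S 2 _) (cong (2 *_) (D-sym S O))) ⟨
      Σ[] S (λ _ → D O O) + Σ[] S (λ x → 2 * distanceSum x O)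
        ≡⟨ Σ[]-+ S _ _ ⟨
      Σ[] S (λ x → D O O + 2 * distanceSum x O)
        ≤⟨ Σ[]-mono S (λ {x} _ → star-bound x O) ⟩
      Σ[] S (λ x → 2 * length O * distanceSum x O)
        ≡⟨ trans (Σ[]-* S (2 * length O) _) (cong₂ (λ l e → 2 * l * e) (sym ∣S∣≡∣O∣) (D-sym S O)) ⟩
      2 * s * d ∎
    small : (k ∸ 1) * D O O ≤ 2 * suc k * D S S
    small = *-cancelˡ-≤ s (+-cancelʳ-≤ (2 * ((k ∸ 1) * d)) _ _ (begin
      s * ((k ∸ 1) * D O O) + 2 * ((k ∸ 1) * d)
        ≡⟨ solve 4 (λ s a o d → s :* (a :* o) :+ con 2 :* (a :* d) :≡ a :* (s :* o :+ con 2 :* d)) refl s (k ∸ 1) (D O O) d ⟩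
      (k ∸ 1) * (s * D O O + 2 * d)
        ≤⟨ *-monoʳ-≤ (k ∸ 1) stars ⟩
      (k ∸ 1) * (2 * s * d)
        ≡⟨ solve 3 (λ a s d → a :* (con 2 :* s :* d) :≡ con 2 :* (a :* (s :* d))) refl (k ∸ 1) s d ⟩
      2 * ((k ∸ 1) * (s * d))
        ≤⟨ *-monoʳ-≤ 2 cross-bound ⟩
      2 * (suc k * (s * D S S) + (k ∸ 1) * d)
        ≡⟨ solve 4 (λ b s e x → con 2 :* (b :* (s :* e) :+ x) :≡ s :* (con 2 :* b :* e) :+ con 2 :* x) refl (suc k) s (D S S) ((k ∸ 1) * d) ⟩
      s * (2 * suc k * D S S) + 2 * ((k ∸ 1) * d) ∎))
    large : (k ∸ 1) * (s ∸ 1) * D O O ≤ ((k + 3) * s + (k ∸ 1)) * D S S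
    large = combine k s (D S S) (D O O) d cross-bound (≤-trans (negative-type S O ∣S∣≡∣O∣) (≤-reflexive (cong (2 *_) (D-sym S O))))

-- Lists without repetitions, and bounds on weights and tasks.

Unique-resp-↭ : ∀ {A : Set} {xs ys : List A} → xs ↭ ys → Unique xs → Unique ys
Unique-resp-↭ {A} p = PermSetoid.Unique-resp-↭ (setoid A) (↭⇒↭ₛ p)

unique-⊆-length : ∀ {A : Set} {xs ys : List A} → Unique xs → (∀ {x} → x ∈ xs → x ∈ ys) → length xs ≤ length ys
unique-⊆-length {xs = []}     _          sub = z≤n
unique-⊆-length {xs = x ∷ xs} (x∉ ∷ xs!) sub with ∈-∃++ (sub (here refl))
... | ys₁ , ys₂ , refl = ≤-trans (s≤s (unique-⊆-length xs! sub′)) (≤-reflexive (sym (↭-length (shift x ys₁ ys₂))))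
  where
  sub′ : ∀ {y} → y ∈ xs → y ∈ ys₁ ++ ys₂
  sub′ y∈ with ∈-resp-↭ (shift x ys₁ ys₂) (sub (there y∈))
  ... | here refl = ⊥-elim (AllP.lookup x∉ y∈ refl)
  ... | there y∈′ = y∈′

Ω-unique : ∀ {n} (F : CNF n) → Unique (Ω F)
Ω-unique F = UniqueP.filter⁺ (_⊨? F) (bitVectors-unique _)
  where
  bitVectors-unique : ∀ n → Unique (bitVectors n)
  bitVectors-unique zero    = [] ∷ []
  bitVectors-unique (suc n) = UniqueP.cartesianProductWith⁺ _∷_ VecP.∷-injective (((λ ()) ∷ []) ∷ [] ∷ []) (bitVectors-unique n)

solution-outside : ∀ {n} (F : CNF n) S → length S < length (Ω F) → ∃[ o ] o ⊨ F × o ∉ S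
solution-outside F S lt = scan (Ω F) (λ z∈ → z∈) (λ sub → <⇒≱ lt (unique-⊆-length (Ω-unique F) sub))
  where
  scan : ∀ zs → (∀ {z} → z ∈ zs → z ∈ Ω F) → ¬ (∀ {z} → z ∈ zs → z ∈ S) → ∃[ o ] o ⊨ F × o ∉ S
  scan []       zs⊆ ¬sub = ⊥-elim (¬sub λ ())
  scan (z ∷ zs) zs⊆ ¬sub with z ∈? S
  ... | no z∉S  = z , proj₂ (∈-filter⁻ (_⊨? F) {xs = bitVectors _} (zs⊆ (here refl))) , z∉S
  ... | yes z∈S = scan zs (zs⊆ ∘ there) λ sub → ¬sub λ { (here refl) → z∈S ; (there z∈) → sub z∈ }

weights-bounded : ∀ {n} (z : Assignment n) Y {s} → length Y ≤ s → Bounded s (weights z Y)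
weights-bounded z Y Y≤s = VecAll.map (λ w≤ → ≤-trans w≤ Y≤s) (go z Y)
  where
  zeros : ∀ n → Bounded 0 (replicate n 0)
  zeros zero    = []
  zeros (suc n) = z≤n ∷ zeros n
  add : ∀ {n l} (z y : Assignment n) (u : Vec ℕ n) → Bounded l u → Bounded (suc l) (zipWith _+_ (differences z y) u)
  add []      []      []      []         = []
  add (b ∷ z) (c ∷ y) (i ∷ u) (i≤ ∷ u≤) = +-mono-≤ (δ≤1 b c) i≤ ∷ add z y u u≤
    where
    δ≤1 : ∀ b c → δ b c ≤ 1
    δ≤1 true  true  = z≤n
    δ≤1 true  false = ≤-refl
    δ≤1 false true  = ≤-refl
    δ≤1 false false = z≤n
  go : ∀ {n} (z : Assignment n) Y → Bounded (length Y) (weights z Y)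
  go z []      = zeros _
  go z (y ∷ Y) = add z y (weights z Y) (go z Y)

∈-gathered-stack : ∀ n s Λ bs st {t : Task n} → t ∈ st → t ∈ gathered n s Λ bs st
∈-gathered-stack n s []      bs st t∈ = t∈
∈-gathered-stack n s (r ∷ Λ) bs st t∈ = ∈-gathered-stack n s Λ (dropBits n bs) _ (there t∈)

∈-gathered : ∀ n s Λ bs st {a r} → (a , r) ∈ centres n Λ bs → (a , r , s) ∈ gathered n s Λ bs st
∈-gathered n s (r ∷ Λ) bs st (here refl) = ∈-gathered-stack n s Λ (dropBits n bs) _ (here refl)
∈-gathered n s (r ∷ Λ) bs st (there a∈)  = ∈-gathered n s Λ (dropBits n bs) _ a∈

-- Filling and swapping when the centres are good.

module Analysis {n : ℕ} (k s : ℕ) (F : CNF n) (tasks : List (Task n)) where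
  open Exploration F (literals n)
  open Rounds F (literals n) tasks

  -- All that is asked of the random centres. The quantification over every small Y matters, because
  -- the sets that arise in the run depend on the centres themselves.
  Good : Set
  Good = ∀ {Y z} → length Y ≤ s → z ⊨ F → z ∉ Y → ∃[ c ] ∃[ a ] ∃[ r ] ∃[ j ] (a , r , j) ∈ tasks × Reach Y r j a c × Admissible Y c ×
         (k ∸ 1) * distanceSum z Y ≤ suc k * distanceSum c Y

  Valid : List (Assignment n) → Set
  Valid S = All (_⊨ F) S × Unique S

  Valid-↭ : ∀ {S S′} → S ↭ S′ → Valid S → Valid S′
  Valid-↭ p (S⊨ , S!) = All-resp-↭ p S⊨ , Unique-resp-↭ p S!

  admissible : ∀ {Y z} → Admissible Y z → z ⊨ F × z ∉ Y
  admissible {Y} {z} (F✓ , z∉) = falsifiedClause-nothing F z F✓ , memberOf-false z Y z∉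

  Valid-∷ : ∀ {Y z} → Admissible Y z → Valid Y → Valid (z ∷ Y)
  Valid-∷ adm (Y⊨ , Y!) with admissible adm
  ... | z⊨F , z∉Y = z⊨F ∷ Y⊨ , AllP.tabulate (λ y∈ z≡y → z∉Y (subst (_∈ _) (sym z≡y) y∈)) ∷ Y!

  dominates-all : Good → ∀ {Y z′} → length Y ≤ s → DominatesReach Y tasks (just z′) → ∀ {z} → z ⊨ F → z ∉ Y →
                  (k ∸ 1) * distanceSum z Y ≤ suc k * distanceSum z′ Y
  dominates-all good {Y} {z′} Y≤s dom z⊨F z∉Y with good Y≤s z⊨F z∉Y
  ... | c , a , r , j , t∈ , reach , adm , ratio with dom t∈ reach adm refl
  ...   | _ , refl , le = ≤-trans ratio (*-monoʳ-≤ (suc k)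
    (≤-trans (≤-reflexive (sym (scoreOf≡distanceSum c Y))) (≤-trans le (≤-reflexive (scoreOf≡distanceSum z′ Y)))))

  Fills-valid : ∀ {i S S′} → Fills i S S′ → Valid S → Valid S′
  Fills-valid done                                   v = v
  Fills-valid (grow (inj₂ (_ , refl , adm , _)) _ f) v = Fills-valid f (Valid-∷ adm v)
  Fills-valid (stuck _ f)                            v = Fills-valid f v

  Fills-length : Good → s ≤ length (Ω F) → ∀ {i S S′} → Fills i S S′ → i + length S ≤ s → length S′ ≡ i + length S
  Fills-length good s≤Ω done le = refl
  Fills-length good s≤Ω {suc i} (grow _ _ f) le = trans (Fills-length good s≤Ω f (≤-trans (≤-reflexive (+-suc i _)) le)) (+-suc i _)
  -- A search cannot fail: as S is smaller than Ω F, some solution lies outside it, so an admissible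
  -- one is reachable.
  Fills-length good s≤Ω {suc i} {S} (stuck dom f) le
    with solution-outside F S (≤-trans (s≤s (m≤n+m (length S) i)) (≤-trans le s≤Ω))
  ... | o , o⊨F , o∉S with good (≤-trans (m≤n+m _ (suc i)) le) o⊨F o∉S
  ...   | c , a , r , j , t∈ , reach , adm , _ with dom t∈ reach adm refl
  ...     | _ , () , _

  rotation : ∀ y (Y : List (Assignment n)) → y ∷ Y ↭ Y ++ [ y ]
  rotation y Y = ++-comm [ y ] Y

  D-last : ∀ z Y → D (Y ++ [ z ]) (Y ++ [ z ]) ≡ D Y Y + 2 * distanceSum z Y
  D-last z Y = trans (sym (D-↭ (rotation z Y))) (D-∷ z Y)

  improves-score : ∀ {y z} Y → Improves Y (just y) (just z) → z ≡ y ⊎ (Admissible Y z × distanceSum y Y < distanceSum z Y)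
  improves-score Y (inj₁ refl) = inj₁ refl
  improves-score {y} {z} Y (inj₂ (_ , refl , adm , lt)) =
    inj₂ (adm , subst₂ _<_ (scoreOf≡distanceSum y Y) (scoreOf≡distanceSum z Y) (lt refl))

  swap-valid : ∀ {y z} Y → Improves Y (just y) (just z) → Valid (y ∷ Y) → Valid (Y ++ [ z ])
  swap-valid {y} {z} Y imp v@(_ ∷ Y⊨ , _ ∷ Y!) with improves-score Y imp
  ... | inj₁ refl       = Valid-↭ (rotation z Y) v
  ... | inj₂ (adm , _)  = Valid-↭ (rotation z Y) (Valid-∷ adm (Y⊨ , Y!))

  swap-mono : ∀ {y z} Y → Improves Y (just y) (just z) → D (y ∷ Y) (y ∷ Y) ≤ D (Y ++ [ z ]) (Y ++ [ z ])
  swap-mono {y} {z} Y imp = subst₂ _≤_ (sym (D-∷ y Y)) (sym (D-last z Y)) (+-monoʳ-≤ (D Y Y) (*-monoʳ-≤ 2 (le (improves-score Y imp))))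
    where
    le : z ≡ y ⊎ (Admissible Y z × distanceSum y Y < distanceSum z Y) → distanceSum y Y ≤ distanceSum z Y
    le (inj₁ refl)     = ≤-refl
    le (inj₂ (_ , lt)) = <⇒≤ lt

  swap-strict : ∀ y z Y → distanceSum y Y < distanceSum z Y → D (y ∷ Y) (y ∷ Y) < D (Y ++ [ z ]) (Y ++ [ z ])
  swap-strict y z Y lt = subst₂ _<_ (sym (D-∷ y Y)) (sym (D-last z Y)) (+-monoʳ-< (D Y Y) (*-monoʳ-< 2 lt))

  length-last : ∀ (Y : List (Assignment n)) z → length (Y ++ [ z ]) ≡ suc (length Y)
  length-last Y z = trans (length-++ Y) (+-comm (length Y) 1)

  Swaps-valid : ∀ {i S S′} → Swaps i S S′ → Valid S → Valid S′
  Swaps-valid done             v = v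
  Swaps-valid (rotate {Y = Y} imp _ f) v = Swaps-valid f (swap-valid Y imp v)
  Swaps-valid (empty f)        v = Swaps-valid f v

  Swaps-length : ∀ {i S S′} → Swaps i S S′ → length S′ ≡ length S
  Swaps-length done                       = refl
  Swaps-length (rotate {Y = Y} imp _ f) = trans (Swaps-length f) (length-last Y _)
  Swaps-length (empty f)                  = Swaps-length f

  Swaps-mono : ∀ {i S S′} → Swaps i S S′ → D S S ≤ D S′ S′
  Swaps-mono done             = ≤-refl
  Swaps-mono (rotate {Y = Y} imp _ f) = ≤-trans (swap-mono Y imp) (Swaps-mono f)
  Swaps-mono (empty f)        = Swaps-mono f

  unswappable-↭ : ∀ {S S′ x} → S ↭ S′ → Unswappable k (_⊨ F) S x → Unswappable k (_⊨ F) S′ x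
  unswappable-↭ {S} {S′} {x} p opt o o⊨F o∉S′ =
    subst₂ (λ d e → (k ∸ 1) * d ≤ suc k * e + (k ∸ 1) * dH o x) (distanceSum-↭ o p) (distanceSum-↭ x p)
           (opt o o⊨F (λ o∈S → o∉S′ (∈-resp-↭ p o∈S)))

  -- The search compares sums over Y, from which y has been removed; the term dH o y accounts for
  -- the distance between o and the element it would replace.
  unswappable-head : Good → ∀ {y Y} → length Y ≤ s → DominatesReach Y tasks (just y) → Unswappable k (_⊨ F) (y ∷ Y) y
  unswappable-head good {y} {Y} Y≤s dom o o⊨F o∉S = begin
    (k ∸ 1) * (dH o y + distanceSum o Y)                    ≡⟨ *-distribˡ-+ (k ∸ 1) (dH o y) _ ⟩
    (k ∸ 1) * dH o y + (k ∸ 1) * distanceSum o Y            ≤⟨ +-monoʳ-≤ ((k ∸ 1) * dH o y) (dominates-all good Y≤s dom o⊨F (o∉S ∘ there)) ⟩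
    (k ∸ 1) * dH o y + suc k * distanceSum y Y              ≡⟨ +-comm ((k ∸ 1) * dH o y) _ ⟩
    suc k * distanceSum y Y + (k ∸ 1) * dH o y              ≤⟨ +-monoˡ-≤ _ (*-monoʳ-≤ (suc k) (m≤n+m (distanceSum y Y) (dH y y))) ⟩
    suc k * (dH y y + distanceSum y Y) + (k ∸ 1) * dH o y   ∎
    where open ≤-Reasoning

  -- Stated for a number e in place of the sum of a particular set, so that it carries over from a
  -- locally optimal set to the result of later swaps, which never decrease the sum.
  Guarantee : ℕ → Set
  Guarantee e = ∀ O → Valid O → length O ≡ s →
    (k ∸ 1) * D O O ≤ 2 * suc k * e × (k ∸ 1) * (s ∸ 1) * D O O ≤ ((k + 3) * s + (k ∸ 1)) * e

  guarantee-mono : ∀ {d e} → d ≤ e → Guarantee d → Guarantee e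
  guarantee-mono d≤e g O v eq with g O v eq
  ... | small , large = ≤-trans small (*-monoʳ-≤ (2 * suc k) d≤e) , ≤-trans large (*-monoʳ-≤ ((k + 3) * s + (k ∸ 1)) d≤e)

  locally-optimal : .{{_ : NonZero s}} → ∀ {S} → Valid S → length S ≡ s → All (Unswappable k (_⊨ F) S) S → Guarantee (D S S)
  locally-optimal {S} (_ , S!) refl opt O (O⊨ , O!) eq = Ratios.small r , Ratios.large r
    where
    r : Ratios k S O
    r = LocalOptimum.ratios-hold {k = k} S! O! O⊨ (sym eq) (λ x∈ → AllP.lookup opt x∈)

  -- In s consecutive rounds the sum increases, unless all s elements turn
  -- out to be unswappable; here xs are those already seen, ys those to come.
  progress : Good → .{{_ : NonZero s}} → ∀ m i ys xs {S′} → length (ys ++ xs) ≡ s → Valid (ys ++ xs) →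
             All (Unswappable k (_⊨ F) (ys ++ xs)) xs → length ys + m * s ≤ i → Swaps i (ys ++ xs) S′ →
             D (ys ++ xs) (ys ++ xs) + suc m ≤ D S′ S′ ⊎ Guarantee (D S′ S′)
  progress good m i [] xs ∣S∣ v opt le swaps = inj₂ (guarantee-mono (Swaps-mono swaps) (locally-optimal v ∣S∣ opt))
  progress good m (suc i) (y ∷ ys) xs ∣S∣ v opt (s≤s le) (rotate {z = z} imp dom swaps) with improves-score (ys ++ xs) imp
  -- The element is kept and so turns out to be unswappable. The set is only rotated, hence those
  -- already seen stay unswappable.
  ... | inj₁ refl = subst (λ d → d + suc m ≤ _ ⊎ Guarantee _) (sym (trans (D-↭ perm) (cong₂ D assoc assoc)))
      (progress good m i ys (xs ++ [ z ]) (trans (cong length (sym assoc)) (trans (sym (↭-length perm)) ∣S∣))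
        (subst Valid assoc (Valid-↭ perm v))
        (All-resp-↭ (rotation z xs) (transfer (unswappable-head good short dom) ∷ AllP.map transfer opt))
        le (subst (λ S → Swaps i S _) assoc swaps))
      where
      perm : z ∷ ys ++ xs ↭ (ys ++ xs) ++ [ z ]
      perm = rotation z (ys ++ xs)
      assoc : (ys ++ xs) ++ [ z ] ≡ ys ++ (xs ++ [ z ])
      assoc = ++-assoc ys xs [ z ]
      transfer : ∀ {x} → Unswappable k (_⊨ F) (z ∷ ys ++ xs) x → Unswappable k (_⊨ F) (ys ++ (xs ++ [ z ])) x
      transfer {x} opt = subst (λ S → Unswappable k (_⊨ F) S x) assoc (unswappable-↭ perm opt)
      short : length (ys ++ xs) ≤ s
      short = ≤-trans (n≤1+n _) (≤-reflexive ∣S∣)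
  progress good zero (suc i) (y ∷ ys) xs ∣S∣ v opt (s≤s le) (rotate {z = z} imp dom swaps) | inj₂ (adm , lt) =
    inj₁ (≤-trans (≤-reflexive (+-comm (D (y ∷ ys ++ xs) (y ∷ ys ++ xs)) 1)) (≤-trans (swap-strict y z (ys ++ xs) lt) (Swaps-mono swaps)))
  -- An improvement: all s elements are to come again, which uses up one of the remaining batches of
  -- s rounds.
  progress good (suc m) (suc i) (y ∷ ys) xs {S′} ∣S∣ v opt (s≤s le) (rotate {z = z} imp dom swaps) | inj₂ (adm , lt)
    with progress good m i ((ys ++ xs) ++ [ z ]) [] {S′} (trans (cong length (++-identityʳ ((ys ++ xs) ++ [ z ]))) length′)
           (subst Valid (sym (++-identityʳ ((ys ++ xs) ++ [ z ]))) (swap-valid (ys ++ xs) imp v)) []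
           (≤-trans (≤-reflexive (cong (_+ m * s) length′)) (≤-trans (m≤n+m _ (length ys)) le))
           (subst (λ S → Swaps i S S′) (sym (++-identityʳ ((ys ++ xs) ++ [ z ]))) swaps)
    where
    length′ : length ((ys ++ xs) ++ [ z ]) ≡ s
    length′ = trans (length-last (ys ++ xs) z) ∣S∣
  ... | inj₂ g    = inj₂ g
  ... | inj₁ gain = inj₁ (≤-trans (≤-reflexive (+-suc (D (y ∷ ys ++ xs) (y ∷ ys ++ xs)) (suc m)))
                      (≤-trans (+-monoˡ-≤ (suc m) (swap-strict y z (ys ++ xs) lt)) (subst (λ S → D S S + suc m ≤ D S′ S′) (++-identityʳ ((ys ++ xs) ++ [ z ])) gain)))

  D≤ : ∀ S → D S S ≤ length S * (length S * n)
  D≤ S = ≤-trans (Σ[]-mono S (λ {x} _ → distanceSum≤ x S)) (≤-reflexive (Σ[]-const S _))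

  swaps-guarantee : Good → .{{_ : NonZero s}} → ∀ {i S S′} → length S ≡ s → Valid S → suc (s * (s * n)) * s ≤ i → Swaps i S S′ →
                    Guarantee (D S′ S′)
  swaps-guarantee good {i} {S} {S′} ∣S∣ v enough swaps
    -- The sum of distances is at most s * (s * n), so it cannot grow by one more than that; this
    -- leaves the guarantee.
    with progress good (s * (s * n)) i S [] (trans (cong length (++-identityʳ S)) ∣S∣) (subst Valid (sym (++-identityʳ S)) v) []
           (≤-trans (≤-reflexive (cong (_+ s * (s * n) * s) ∣S∣)) enough) (subst (λ S → Swaps i S S′) (sym (++-identityʳ S)) swaps)
  ... | inj₂ g    = g
  ... | inj₁ gain = ⊥-elim (1+n≰n (≤-trans (≤-trans (m≤n+m _ (D (S ++ []) (S ++ []))) gain)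
                      (≤-trans (D≤ S′) (≤-reflexive (cong (λ l → l * (l * n)) (trans (Swaps-length swaps) ∣S∣))))))

-- The choice of a centre depends on Y only through `weights z Y`, whose entries are at most s. This
-- is why bounded weights can stand for the sets Y in the union bound.
badness≡0⇒good : ∀ k .{{_ : NonZero k}} {n} s .{{_ : NonZero n}} (F : CNF n) bs → badness k n s bs ≡ 0 →
                 Analysis.Good k s F (gathered n s (labels k n s) bs [])
badness≡0⇒good k {n} s F bs bad {Y} {z} Y≤s z⊨F z∉Y
  with badness≡0 k n s bs bad z (weights z Y) (weights-bounded z Y Y≤s)
... | a , r , a∈ , dist , light
  with reach-near F (literals n) Y ∈-literals z⊨F z∉Y r s a (≤-reflexive dist) (≤-trans (nearby≤length z _ Y) Y≤s)
...   | c , reach , adm , near = c , a , r , s , ∈-gathered n s (labels k n s) bs [] a∈ , reach , adm ,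
        distanceSum-ratio k a z c Y (≤-trans near (≤-reflexive (sym dist))) light

-- From inequalities of natural numbers to the rational ratios.

fraction : (a b : ℕ) .{{_ : NonZero b}} → ℚ
fraction a b = pos a /ℚ b

fraction-≤ : ∀ a b c d .{{_ : NonZero b}} .{{_ : NonZero d}} → a * d ≤ c * b → fraction a b ℚ.≤ fraction c d
fraction-≤ a (suc b) c (suc d) le = ℚP.toℚᵘ-cancel-≤
  (ℚᵘP.≤-respˡ-≃ (ℚᵘP.≃-sym (ℚP.toℚᵘ-fromℚᵘ (mkℚᵘ (pos a) b)))
  (ℚᵘP.≤-respʳ-≃ (ℚᵘP.≃-sym (ℚP.toℚᵘ-fromℚᵘ (mkℚᵘ (pos c) d)))
  (*≤* (subst₂ ℤ._≤_ (ℤP.pos-* a (suc d)) (ℤP.pos-* c (suc b)) (ℤ.+≤+ le)))))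

fraction-≡ : ∀ a b c d .{{_ : NonZero b}} .{{_ : NonZero d}} → a * d ≡ c * b → fraction a b ≡ fraction c d
fraction-≡ a b c d eq = ℚP.≤-antisym (fraction-≤ a b c d (≤-reflexive eq)) (fraction-≤ c d a b (≤-reflexive (sym eq)))

fraction-* : ∀ a b c d .{{_ : NonZero b}} .{{_ : NonZero d}} .{{_ : NonZero (b * d)}} →
             fraction a b ℚ.* fraction c d ≡ fraction (a * c) (b * d)
fraction-* a (suc b) c (suc d) = ℚP.toℚᵘ-injective (ℚᵘP.≃-trans (ℚP.toℚᵘ-homo-* (fraction a (suc b)) (fraction c (suc d)))
  (ℚᵘP.≃-trans (ℚᵘP.*-cong (ℚP.toℚᵘ-fromℚᵘ (mkℚᵘ (pos a) b)) (ℚP.toℚᵘ-fromℚᵘ (mkℚᵘ (pos c) d)))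
  (ℚᵘP.≃-trans (*≡* (cong (ℤ._* pos (suc b * suc d)) (sym (ℤP.pos-* a c)))) (ℚᵘP.≃-sym (ℚP.toℚᵘ-fromℚᵘ (mkℚᵘ (pos (a * c)) (d + b * suc d)))))))

fraction-+ : ∀ a b c d .{{_ : NonZero b}} .{{_ : NonZero d}} .{{_ : NonZero (b * d)}} →
             fraction a b ℚ.+ fraction c d ≡ fraction (a * d + c * b) (b * d)
fraction-+ a (suc b) c (suc d) = ℚP.toℚᵘ-injective (ℚᵘP.≃-trans (ℚP.toℚᵘ-homo-+ (fraction a (suc b)) (fraction c (suc d)))
  (ℚᵘP.≃-trans (ℚᵘP.+-cong (ℚP.toℚᵘ-fromℚᵘ (mkℚᵘ (pos a) b)) (ℚP.toℚᵘ-fromℚᵘ (mkℚᵘ (pos c) d)))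
  (ℚᵘP.≃-trans (*≡* (cong (ℤ._* pos (suc b * suc d)) (trans (cong₂ ℤ._+_ (sym (ℤP.pos-* a (suc d))) (sym (ℤP.pos-* c (suc b)))) (sym (ℤP.pos-+ (a * suc d) (c * suc b))))))
    (ℚᵘP.≃-sym (ℚP.toℚᵘ-fromℚᵘ (mkℚᵘ (pos (a * suc d + c * suc b)) (d + b * suc d)))))))

x+y≡z⇒z-y≡x : ∀ x y z → x ℚ.+ y ≡ z → z ℚ.- y ≡ x
x+y≡z⇒z-y≡x x y z refl = trans (ℚP.+-assoc x y (ℚ.- y)) (trans (cong (x ℚ.+_) (ℚP.+-inverseʳ y)) (ℚP.+-identityʳ x))

1-fraction : ∀ a b .{{_ : NonZero b}} → a ≤ b → 1ℚ ℚ.- fraction a b ≡ fraction (b ∸ a) b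
1-fraction a b a≤b = x+y≡z⇒z-y≡x (fraction (b ∸ a) b) (fraction a b) 1ℚ
  (trans (fraction-+ (b ∸ a) b a b {{it}} {{it}} {{m*n≢0 b b}})
         (fraction-≡ ((b ∸ a) * b + a * b) (b * b) 1 1 {{m*n≢0 b b}} (trans (*-identityʳ _) (trans (sym (*-distribʳ-+ b (b ∸ a) a)) (trans (cong (_* b) (m∸n+n≡m a≤b)) (sym (*-identityˡ (b * b))))))))

subsetsOfSize-subset : ∀ {A : Set} s (xs : List A) {O} → O ∈ subsetsOfSize s xs → ∀ {z} → z ∈ O → z ∈ xs
subsetsOfSize-subset zero    xs       (here refl) ()
subsetsOfSize-subset (suc s) (x ∷ xs) O∈ z∈ with ∈-++⁻ (map (x ∷_) (subsetsOfSize s xs)) O∈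
... | inj₂ O∈′ = there (subsetsOfSize-subset (suc s) xs O∈′ z∈)
... | inj₁ O∈′ with ∈-map⁻ (x ∷_) O∈′
subsetsOfSize-subset (suc s) (x ∷ xs) O∈ (here refl) | inj₁ _ | O′ , O′∈ , refl = here refl
subsetsOfSize-subset (suc s) (x ∷ xs) O∈ (there z∈)  | inj₁ _ | O′ , O′∈ , refl = there (subsetsOfSize-subset s xs O′∈ z∈)

subsetsOfSize-length : ∀ {A : Set} s (xs : List A) {O} → O ∈ subsetsOfSize s xs → length O ≡ s
subsetsOfSize-length zero    xs       (here refl) = refl
subsetsOfSize-length (suc s) (x ∷ xs) O∈ with ∈-++⁻ (map (x ∷_) (subsetsOfSize s xs)) O∈
... | inj₂ O∈′ = subsetsOfSize-length (suc s) xs O∈′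
... | inj₁ O∈′ with ∈-map⁻ (x ∷_) O∈′
...   | O′ , O′∈ , refl = cong suc (subsetsOfSize-length s xs O′∈)

subsetsOfSize-unique : ∀ {A : Set} s (xs : List A) {O} → O ∈ subsetsOfSize s xs → Unique xs → Unique O
subsetsOfSize-unique zero    xs       (here refl) xs! = []
subsetsOfSize-unique (suc s) (x ∷ xs) O∈ (x∉ ∷ xs!) with ∈-++⁻ (map (x ∷_) (subsetsOfSize s xs)) O∈
... | inj₂ O∈′ = subsetsOfSize-unique (suc s) xs O∈′ xs!
... | inj₁ O∈′ with ∈-map⁻ (x ∷_) O∈′
...   | O′ , O′∈ , refl = AllP.tabulate (λ z∈ → AllP.lookup x∉ (subsetsOfSize-subset s xs O′∈ z∈)) ∷ subsetsOfSize-unique s xs O′∈ xs!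

sumPD-fraction : ∀ {n} (S : List (Assignment n)) → sumPD S ≡ fraction (1 * D S S) 2
sumPD-fraction S = trans (cong (λ d → ½ ℚ.* fraction d 1) (sum-cartesianProductWith S S)) (fraction-* 1 2 (D S S) 1)

-- A maximum is one of its arguments, so the claim reduces to single values and to the default 0.
*-foldr-⊔-≤ : ∀ {A : Set} (f : A → ℚ) ρ x → 0ℚ ℚ.≤ x → ∀ xs → (∀ y → y ∈ xs → ρ ℚ.* f y ℚ.≤ x) → ρ ℚ.* foldr ℚ._⊔_ 0ℚ (map f xs) ℚ.≤ x
*-foldr-⊔-≤ f ρ x 0≤x []       le = ℚP.≤-trans (ℚP.≤-reflexive (ℚP.*-zeroʳ ρ)) 0≤x
*-foldr-⊔-≤ f ρ x 0≤x (y ∷ xs) le = selected (ℚP.⊔-sel (f y) m)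
  where
  m : ℚ
  m = foldr ℚ._⊔_ 0ℚ (map f xs)
  selected : ∀ {q} → q ≡ f y ⊎ q ≡ m → ρ ℚ.* q ℚ.≤ x
  selected (inj₁ refl) = le y (here refl)
  selected (inj₂ refl) = *-foldr-⊔-≤ f ρ x 0≤x xs (λ z → le z ∘ there)

ratioSmall-bound : ∀ k .{{_ : NonZero k}} o e → (k ∸ 1) * o ≤ 2 * suc k * e → ratioSmall k ℚ.* fraction (1 * o) 2 ℚ.≤ fraction (1 * e) 2
ratioSmall-bound k@(suc k′) o e le = ℚP.≤-trans (ℚP.≤-reflexive eq) (fraction-≤ (1 * k′ * (1 * o)) (2 * suc k * 2) (1 * e) 2 (begin
  1 * k′ * (1 * o) * 2          ≡⟨ solve 2 (λ k o → con 1 :* k :* (con 1 :* o) :* con 2 :≡ con 2 :* (k :* o)) refl k′ o ⟩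
  2 * (k′ * o)                  ≤⟨ *-monoʳ-≤ 2 le ⟩
  2 * (2 * suc k * e)           ≡⟨ solve 2 (λ k e → con 2 :* (con 2 :* k :* e) :≡ con 1 :* e :* (con 2 :* k :* con 2)) refl (suc k) e ⟩
  1 * e * (2 * suc k * 2)       ∎))
  where
  open ≤-Reasoning
  eq : ratioSmall k ℚ.* fraction (1 * o) 2 ≡ fraction (1 * k′ * (1 * o)) (2 * suc k * 2)
  eq = trans (cong (λ x → ½ ℚ.* x ℚ.* fraction (1 * o) 2) (1-fraction 2 (suc k) (s≤s (s≤s z≤n))))
      (trans (cong (ℚ._* fraction (1 * o) 2) (fraction-* 1 2 k′ (suc k))) (fraction-* (1 * k′) (2 * suc k) (1 * o) 2))

ratioLarge-bound : ∀ k s .{{_ : NonZero k}} .{{_ : NonZero s}} o e → (k ∸ 1) * (s ∸ 1) * o ≤ ((k + 3) * s + (k ∸ 1)) * e →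
                   ratioLarge k s ℚ.* fraction (1 * o) 2 ℚ.≤ fraction (1 * e) 2
ratioLarge-bound k@(suc k′) s@(suc s′) o e le = ℚP.*-cancelʳ-≤-pos y {{y>0}} (begin
  β k ℚ.* (x ℚ.÷ y) ℚ.* fo ℚ.* y             ≡⟨ rearrange ⟩
  β k ℚ.* x ℚ.* fo                           ≡⟨ cong (λ q → β k ℚ.* q ℚ.* fo) (1-fraction 1 s (s≤s z≤n)) ⟩
  fraction k′ (3 + k) ℚ.* fraction s′ s ℚ.* fo ≡⟨ trans (cong (ℚ._* fo) (fraction-* k′ (3 + k) s′ s)) (fraction-* (k′ * s′) ((3 + k) * s) (1 * o) 2) ⟩
  fraction (k′ * s′ * (1 * o)) ((3 + k) * s * 2) ≤⟨ fraction-≤ (k′ * s′ * (1 * o)) ((3 + k) * s * 2) (1 * e * (1 * ((3 + k) * s) + k′ * 1 * 1)) (2 * (1 * ((3 + k) * s))) key ⟩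
  fraction (1 * e * (1 * ((3 + k) * s) + k′ * 1 * 1)) (2 * (1 * ((3 + k) * s))) ≡⟨ fraction-* (1 * e) 2 (1 * ((3 + k) * s) + k′ * 1 * 1) (1 * ((3 + k) * s)) ⟨
  fraction (1 * e) 2 ℚ.* fraction (1 * ((3 + k) * s) + k′ * 1 * 1) (1 * ((3 + k) * s)) ≡⟨ cong (fraction (1 * e) 2 ℚ.*_) y≡ ⟨
  fraction (1 * e) 2 ℚ.* y                   ∎)
  where
  open ℚP.≤-Reasoning
  x y fo : ℚ
  x = 1ℚ ℚ.- fraction 1 s
  y = 1ℚ ℚ.+ β k ℚ.* fraction 1 s
  fo = fraction (1 * o) 2
  y≡ : y ≡ fraction (1 * ((3 + k) * s) + k′ * 1 * 1) (1 * ((3 + k) * s))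
  y≡ = trans (cong (1ℚ ℚ.+_) (fraction-* k′ (3 + k) 1 s)) (fraction-+ 1 1 (k′ * 1) ((3 + k) * s))
  y>0 : ℚ.Positive y
  y>0 = subst ℚ.Positive (sym y≡) (ℚ.positive (ℚP.<-≤-trans {0ℚ} {fraction 1 1} (ℚ.*<* (ℤ.+<+ (s≤s z≤n)))
    (fraction-≤ 1 1 (1 * ((3 + k) * s) + k′ * 1 * 1) (1 * ((3 + k) * s)) (≤-trans (≤-reflexive (*-identityˡ _)) (≤-trans (m≤m+n _ (k′ * 1 * 1)) (≤-reflexive (sym (*-identityʳ _))))))))
  instance
    y≢0 : ℚ.NonZero y
    y≢0 = 1+β/s≢0 k s
  rearrange : β k ℚ.* (x ℚ.÷ y) ℚ.* fo ℚ.* y ≡ β k ℚ.* x ℚ.* fo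
  rearrange = begin-equality
    β k ℚ.* (x ℚ.* ℚ.1/ y) ℚ.* fo ℚ.* y     ≡⟨ cong (λ p → p ℚ.* fo ℚ.* y) (ℚP.*-assoc (β k) x (ℚ.1/ y)) ⟨
    β k ℚ.* x ℚ.* ℚ.1/ y ℚ.* fo ℚ.* y       ≡⟨ ℚP.*-assoc (β k ℚ.* x ℚ.* ℚ.1/ y) fo y ⟩
    β k ℚ.* x ℚ.* ℚ.1/ y ℚ.* (fo ℚ.* y)     ≡⟨ cong (β k ℚ.* x ℚ.* ℚ.1/ y ℚ.*_) (ℚP.*-comm fo y) ⟩
    β k ℚ.* x ℚ.* ℚ.1/ y ℚ.* (y ℚ.* fo)     ≡⟨ ℚP.*-assoc (β k ℚ.* x) (ℚ.1/ y) (y ℚ.* fo) ⟩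
    β k ℚ.* x ℚ.* (ℚ.1/ y ℚ.* (y ℚ.* fo))   ≡⟨ cong (β k ℚ.* x ℚ.*_) (trans (sym (ℚP.*-assoc (ℚ.1/ y) y fo)) (trans (cong (ℚ._* fo) (ℚP.*-inverseˡ y)) (ℚP.*-identityˡ fo))) ⟩
    β k ℚ.* x ℚ.* fo                         ∎
  key : k′ * s′ * (1 * o) * (2 * (1 * ((3 + k) * s))) ≤ 1 * e * (1 * ((3 + k) * s) + k′ * 1 * 1) * ((3 + k) * s * 2)
  key = ≤-trans (≤-reflexive (solve 3 (λ a o b → a :* (con 1 :* o) :* (con 2 :* (con 1 :* b)) :≡ a :* o :* (b :* con 2)) refl (k′ * s′) o ((3 + k) * s)))
    (≤-trans (*-monoˡ-≤ ((3 + k) * s * 2) le)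
    (≤-reflexive (cong (_* ((3 + k) * s * 2)) (trans (cong (λ m → (m * s + k′) * e) (+-comm k 3))
      (solve 3 (λ a b e → (a :+ b) :* e :≡ con 1 :* e :* (con 1 :* a :+ b :* con 1 :* con 1)) refl ((3 + k) * s) k′ e)))))

guarantee⇒diverse : ∀ k (3≤k : 3 ≤ k) .{{_ : NonZero k}} {n} (F : CNF n) s .{{_ : NonZero s}} tasks S →
  Analysis.Valid k s F tasks S → length S ≡ s → Analysis.Guarantee k s F tasks (D S S) → IsDiverse k 3≤k F s S
guarantee⇒diverse k 3≤k F s tasks S (S⊨ , S!) ∣S∣ guarantee = S⊨ , S! , ∣S∣ ,
  (λ _ → *-foldr-⊔-≤ sumPD (ratioSmall k) (sumPD S) 0≤ (subsetsOfSize s (Ω F)) (λ O O∈ →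
     transport (ratioSmall k) O (ratioSmall-bound k (D O O) (D S S) (proj₁ (guaranteed O O∈))))) ,
  (λ _ → *-foldr-⊔-≤ sumPD (ratioLarge k s) (sumPD S) 0≤ (subsetsOfSize s (Ω F)) (λ O O∈ →
     transport (ratioLarge k s) O (ratioLarge-bound k s (D O O) (D S S) (proj₂ (guaranteed O O∈)))))
  where
  0≤ : 0ℚ ℚ.≤ sumPD S
  0≤ = subst (0ℚ ℚ.≤_) (sym (sumPD-fraction S)) (fraction-≤ 0 1 (1 * D S S) 2 z≤n)
  guaranteed : ∀ O → O ∈ subsetsOfSize s (Ω F) →
    (k ∸ 1) * D O O ≤ 2 * suc k * D S S × (k ∸ 1) * (s ∸ 1) * D O O ≤ ((k + 3) * s + (k ∸ 1)) * D S S
  guaranteed O O∈ = guarantee O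
    (AllP.tabulate (λ z∈ → proj₂ (∈-filter⁻ (_⊨? F) {xs = bitVectors _} (subsetsOfSize-subset s (Ω F) O∈ z∈))) ,
     subsetsOfSize-unique s (Ω F) O∈ (Ω-unique F))
    (subsetsOfSize-length s (Ω F) O∈)
  transport : ∀ ρ O → ρ ℚ.* fraction (1 * D O O) 2 ℚ.≤ fraction (1 * D S S) 2 → ρ ℚ.* sumPD O ℚ.≤ sumPD S
  transport ρ O = subst₂ (λ p q → ρ ℚ.* p ℚ.≤ q) (sym (sumPD-fraction O)) (sym (sumPD-fraction S))

decode-encode : ∀ {n} (z : Assignment n) → decodeAssignment n (encodeAssignment z) ≡ z
decode-encode []          = refl
decode-encode (true ∷ z)  = cong (true ∷_) (decode-encode z)
decode-encode (false ∷ z) = cong (false ∷_) (decode-encode z)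

decode-encodes : ∀ {n} (S : List (Assignment n)) → decodeAssignments n (encodeAssignments S) ≡ S
decode-encodes []      = refl
decode-encodes (z ∷ S) = cong₂ _∷_ (decode-encode z) (decode-encodes S)

length≤powerSum : ∀ k .{{_ : NonZero k}} Λ → length Λ ≤ powerSum k Λ
length≤powerSum k []      = z≤n
length≤powerSum k (r ∷ Λ) = +-mono-≤ (>-nonZero⁻¹ (k ^ r) {{m^n≢0 k r}}) (length≤powerSum k Λ)

totalPotential-gathered : ∀ k n s Λ bs (st : List (Task n)) → All (_< suc n) Λ →
  totalPotential k (gathered n s Λ bs st) ≤ suc n * (powerSum k Λ * suc n ^ s) + totalPotential k st
totalPotential-gathered k n s []      bs st []         = m≤n+m _ (suc n * 0)
totalPotential-gathered k n s (r ∷ Λ) bs st (r< ∷ Λ<) = begin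
  totalPotential k (gathered n s Λ (dropBits n bs) ((takeBits n bs , r , s) ∷ st))
    ≤⟨ totalPotential-gathered k n s Λ (dropBits n bs) _ Λ< ⟩
  suc n * (powerSum k Λ * suc n ^ s) + (suc r * (k ^ r * suc n ^ s) + totalPotential k st)
    ≤⟨ +-monoʳ-≤ (suc n * (powerSum k Λ * suc n ^ s)) (+-monoˡ-≤ (totalPotential k st) (*-monoˡ-≤ (k ^ r * suc n ^ s) r<)) ⟩
  suc n * (powerSum k Λ * suc n ^ s) + (suc n * (k ^ r * suc n ^ s) + totalPotential k st)
    ≡⟨ solve 5 (λ a p q x t → a :* (p :* x) :+ (a :* (q :* x) :+ t) :≡ a :* ((q :+ p) :* x) :+ t) refl (suc n) (powerSum k Λ) (k ^ r) (suc n ^ s) (totalPotential k st) ⟩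
  suc n * ((k ^ r + powerSum k Λ) * suc n ^ s) + totalPotential k st ∎
  where open ≤-Reasoning

geometric : ∀ Z γ v a b .{{_ : NonZero γ}} → 2 ≤ Z → v ≤ γ * (4 * Z ^ 11) →
            5 + (γ * Z ^ a + (v + γ * Z ^ b)) ≤ γ * Z ^ (4 + (a + (b + 11)))
geometric Z γ v a b 2≤Z v≤ = begin
  5 + (γ * Z ^ a + (v + γ * Z ^ b))
    ≤⟨ +-mono-≤ (m≤n*m 5 γ) (+-monoʳ-≤ (γ * Z ^ a) (+-monoˡ-≤ (γ * Z ^ b) v≤)) ⟩
  γ * 5 + (γ * Z ^ a + (γ * (4 * Z ^ 11) + γ * Z ^ b))
    ≡⟨ solve 4 (λ g x y z → g :* con 5 :+ (g :* x :+ (g :* y :+ g :* z)) :≡ g :* (con 5 :+ (x :+ (y :+ z)))) refl γ (Z ^ a) (4 * Z ^ 11) (Z ^ b) ⟩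
  γ * (5 + (Z ^ a + (4 * Z ^ 11 + Z ^ b)))
    ≤⟨ *-monoʳ-≤ γ (+-mono-≤ (m≤m*n 5 (Z ^ e) {{m^n≢0 Z e}}) (+-mono-≤ (up (m≤m+n a _)) (+-mono-≤ (*-monoʳ-≤ 4 (up (≤-trans (m≤n+m 11 b) (m≤n+m (b + 11) a)))) (up (≤-trans (m≤m+n b 11) (m≤n+m (b + 11) a)))))) ⟩
  γ * (5 * Z ^ e + (Z ^ e + (4 * Z ^ e + Z ^ e)))
    ≤⟨ *-monoʳ-≤ γ (≤-trans (≤-reflexive (solve 1 (λ x → con 5 :* x :+ (x :+ (con 4 :* x :+ x)) :≡ con 11 :* x) refl (Z ^ e))) (*-monoˡ-≤ (Z ^ e) (m≤m+n 11 5))) ⟩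
  γ * (2 ^ 4 * Z ^ e)
    ≤⟨ *-monoʳ-≤ γ (*-monoˡ-≤ (Z ^ e) (^-monoˡ-≤ 4 2≤Z)) ⟩
  γ * (Z ^ 4 * Z ^ e)
    ≡⟨ cong (γ *_) (^-distribˡ-+-* Z 4 e) ⟨
  γ * Z ^ (4 + e) ∎
  where
  open ≤-Reasoning
  instance
    Z≢0 : NonZero Z
    Z≢0 = >-nonZero (≤-trans (s≤s z≤n) 2≤Z)
  e : ℕ
  e = a + (b + 11)
  up : ∀ {d} → d ≤ e → Z ^ d ≤ Z ^ e
  up = ^-monoʳ-≤ Z

abstract
  timeDegree : ℕ → ℕ
  timeDegree k = 4 + (deg (prepare k) + (deg diversify + 11))

  within-timeDegree : ∀ k {Z γ v t} .{{_ : NonZero γ}} → 2 ≤ Z → v ≤ γ * (4 * Z ^ 11) →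
    t ≤ 5 + (γ * Z ^ deg (prepare k) + (v + γ * Z ^ deg diversify)) → t ≤ γ * Z ^ timeDegree k
  within-timeDegree k {Z} {γ} {v} 2≤Z v≤ t≤ = ≤-trans t≤ (geometric Z γ v (deg (prepare k)) (deg diversify) 2≤Z v≤)

indicator-or : ∀ {P : Set} (P? : Dec P) m → (m ≡ 0 → P) → 1 ≤ indicator (does P?) + m
indicator-or (yes _) m       p = s≤s z≤n
indicator-or (no ¬p) zero    p = ⊥-elim (¬p (p refl))
indicator-or (no _)  (suc m) p = s≤s z≤n

just-any : ∀ {P : Tree → Set} {m x} → m ≡ just x → P x → MaybeAny.Any P m
just-any refl p = just p

-- Running time and success probability for one instance.

module Run (k : ℕ) (3≤k : 3 ≤ k) {n : ℕ} (F : CNF n) (F-width : F IsCNFOfWidth k) (s : ℕ) (1≤s : 1 ≤ s) where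

  instance
    k≢0 : NonZero k
    k≢0 = >-nonZero (≤-trans (s≤s z≤n) 3≤k)
    s≢0 : NonZero s
    s≢0 = >-nonZero 1≤s

  Z γ : ℕ
  Z = n + (s + 2) + (length F + (suc k + 2 ^ (k ∸ 1)))
  -- The second factor is the price of passing up to s solutions on the way; it is 2 ^ o(n) when s
  -- log n = o(n). All other costs are a power of Z.
  γ = budget k n s * suc n ^ s

  X≤Z : n + (s + 2) ≤ Z
  X≤Z = m≤m+n _ _

  2≤Z : 2 ≤ Z
  2≤Z = ≤-trans (≤-trans (m≤n+m 2 s) (m≤n+m (s + 2) n)) X≤Z

  F≤Z : length F ≤ Z
  F≤Z = ≤-trans (m≤m+n _ _) (m≤n+m _ (n + (s + 2)))

  n+k<Z : suc (n + k) ≤ Z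
  n+k<Z = ≤-trans (≤-reflexive (sym (+-suc n k)))
    (+-mono-≤ (m≤m+n n _) (≤-trans (m≤m+n (suc k) _) (m≤n+m _ (length F))))

  2^k≤Z : 2 ^ (k ∸ 1) ≤ Z
  2^k≤Z = ≤-trans (m≤n+m _ (suc k)) (≤-trans (m≤n+m _ (length F)) (m≤n+m _ (n + (s + 2))))

  1+n≤Z : suc n ≤ Z
  1+n≤Z = ≤-trans (s≤s (m≤m+n n k)) n+k<Z

  budget≢0 : NonZero (budget k n s)
  budget≢0 = m*n≢0 _ _ {{m^n≢0 (n + (s + 2)) 7 {{>-nonZero (≤-trans (s≤s z≤n) (≤-trans (m≤n+m 2 s) (m≤n+m (s + 2) n)))}}}}
                       {{m^n≢0 (2 ^ (k ∸ 1)) (blocks k n) {{m^n≢0 2 (k ∸ 1)}}}}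

  γ≢0 : NonZero γ
  γ≢0 = m*n≢0 _ _ {{budget≢0}} {{m^n≢0 (suc n) s}}

  B≤γ : budget k n s ≤ γ
  B≤γ = m≤m*n _ (suc n ^ s) {{m^n≢0 (suc n) s}}

  powerSum≤ : powerSum k (labels k n s) ≤ suc n * budget k n s
  powerSum≤ = ≤-trans (powerSum-labelling k (suc n) (budget k n s) 0 [] (≤-reflexive (*-identityʳ _))) (≤-reflexive (+-identityʳ _))

  Λ≤Zγ : length (labels k n s) ≤ Z * γ
  Λ≤Zγ = ≤-trans (length≤powerSum k (labels k n s)) (≤-trans powerSum≤ (*-mono-≤ 1+n≤Z B≤γ))

  Z^≢0 : ∀ d → NonZero (Z ^ d)
  Z^≢0 d = m^n≢0 Z d {{>-nonZero (≤-trans (s≤s z≤n) 2≤Z)}}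

  Λ≤ : length (labels k n s) ≤ γ * Z ^ 10
  Λ≤ = ≤-trans Λ≤Zγ (≤-trans (≤-reflexive (*-comm Z γ)) (*-monoʳ-≤ γ (m≤m*n Z (Z ^ 9) {{Z^≢0 9}})))

  tasks≤ : ∀ bs → totalPotential k (gathered n s (labels k n s) bs []) ≤ γ * Z ^ 10
  tasks≤ bs = begin
    totalPotential k (gathered n s (labels k n s) bs [])
      ≤⟨ totalPotential-gathered k n s (labels k n s) bs [] (labels<-labelling k (suc n) (budget k n s) 0 [] ≤-refl []) ⟩
    suc n * (powerSum k (labels k n s) * suc n ^ s) + 0
      ≡⟨ +-identityʳ _ ⟩
    suc n * (powerSum k (labels k n s) * suc n ^ s)
      ≤⟨ *-monoʳ-≤ (suc n) (*-monoˡ-≤ (suc n ^ s) powerSum≤) ⟩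
    suc n * (suc n * budget k n s * suc n ^ s)
      ≡⟨ solve 3 (λ a b c → a :* (a :* b :* c) :≡ b :* c :* (a :* a)) refl (suc n) (budget k n s) (suc n ^ s) ⟩
    γ * (suc n * suc n)
      ≤⟨ *-monoʳ-≤ γ (≤-trans (*-mono-≤ 1+n≤Z 1+n≤Z) (*-monoʳ-≤ Z (m≤m*n Z (Z ^ 8) {{Z^≢0 8}}))) ⟩
    γ * Z ^ 10 ∎
    where open ≤-Reasoning

  open Execution Z 2≤Z γ γ≢0 {s = s} k≢0 F F-width X≤Z F≤Z n+k<Z 2^k≤Z B≤γ Λ≤ tasks≤ public

  time : ℕ
  time = proj₁ executions

  time≤ : time ≤ γ * Z ^ timeDegree k
  time≤ = within-timeDegree k {{γ≢0}} 2≤Z u≤ (proj₁ (proj₂ executions))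
    where
    open ≤-Reasoning
    u≤ : u * 4 ≤ γ * (4 * Z ^ 11)
    u≤ = begin
      length (labels k n s) * n * 4   ≤⟨ *-monoˡ-≤ 4 (*-mono-≤ Λ≤ (≤-trans (n≤1+n n) 1+n≤Z)) ⟩
      γ * Z ^ 10 * Z * 4              ≡⟨ solve 3 (λ g x z → g :* x :* z :* con 4 :≡ g :* (con 4 :* (z :* x))) refl γ (Z ^ 10) Z ⟩
      γ * (4 * Z ^ 11)                ∎

  bits : Vec Bool time → List Bool
  bits = proj₁ (proj₂ (proj₂ executions))

  bits-uniform : ∀ f → ΣB time (f ∘ bits) * 2 ^ u ≡ 2 ^ time * ΣB u (f ∘ toList)
  bits-uniform = proj₁ (proj₂ (proj₂ (proj₂ executions)))

  runs-to : ∀ r → ∃[ S ] Outputs (bits r) S × run (algorithm k) (encodeInput F s) r ≡ just (encodeAssignments S)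
  runs-to = proj₂ (proj₂ (proj₂ (proj₂ executions)))

  halts : HaltsWithin (algorithm k) (encodeInput F s) time
  halts r = just-any (proj₂ (proj₂ (runs-to r))) tt

  module _ .{{_ : NonZero n}} (s≤Ω : s ≤ length (Ω F)) where

    succeeds : ∀ r → badness k n s (bits r) ≡ 0 → Succeeds k 3≤k F s (algorithm k) r
    succeeds r bad =
      let S , (S₁ , fills , swaps) , eq = runs-to r in just-any eq (subst (IsDiverse k 3≤k F s) (sym (decode-encodes S)) (diverse fills swaps))
      where
      tasks = tasksFrom (bits r)
      open Analysis k s F tasks
      rounds : suc (s * (s * n)) * s ≤ (n + (s + 2)) ^ 3 * s
      rounds = *-monoˡ-≤ s (begin
        suc (s * (s * n))       ≤⟨ +-monoˡ-≤ (s * (s * n)) (>-nonZero⁻¹ (s * s) {{m*n≢0 s s}}) ⟩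
        s * s + s * (s * n)     ≡⟨ solve 2 (λ s n → s :* s :+ s :* (s :* n) :≡ s :* (s :* ((con 1 :+ n) :* con 1))) refl s n ⟩
        s * (s * (suc n * 1))   ≤⟨ *-mono-≤ s≤X (*-mono-≤ s≤X (*-monoˡ-≤ 1 1+n≤X)) ⟩
        (n + (s + 2)) ^ 3       ∎)
        where
        open ≤-Reasoning
        s≤X : s ≤ n + (s + 2)
        s≤X = ≤-trans (m≤m+n s 2) (m≤n+m (s + 2) n)
        1+n≤X : suc n ≤ n + (s + 2)
        1+n≤X = ≤-trans (≤-reflexive (+-comm 1 n)) (+-monoʳ-≤ n (≤-trans (s≤s z≤n) (m≤n+m 2 s)))
      diverse : ∀ {S₁ S} → Rounds.Fills F (literals n) tasks s [] S₁ → Rounds.Swaps F (literals n) tasks ((n + (s + 2)) ^ 3 * s) S₁ S → IsDiverse k 3≤k F s S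
      diverse {S₁} {S} fills swaps = guarantee⇒diverse k 3≤k F s tasks S (Swaps-valid swaps valid₁) (trans (Swaps-length swaps) ∣S₁∣)
                                       (swaps-guarantee (badness≡0⇒good k s F (bits r) bad) ∣S₁∣ valid₁ rounds swaps)
        where
        valid₁ : Valid S₁
        valid₁ = Fills-valid fills ([] , [])
        ∣S₁∣ : length S₁ ≡ s
        ∣S₁∣ = trans (Fills-length (badness≡0⇒good k s F (bits r) bad) s≤Ω fills (≤-reflexive (+-identityʳ s))) (+-identityʳ s)

    successes : ℕ
    successes = length (filter (succeeds? k 3≤k F s (algorithm k)) (bitVectors time))

    failures : ℕ
    failures = ΣB time (badness k n s ∘ bits)

    failures-rare : failures * 2 ^ n ≤ 2 ^ time
    failures-rare = *-cancelʳ-≤ _ _ (2 ^ u) {{m^n≢0 2 u}} (begin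
      failures * 2 ^ n * 2 ^ u
        ≡⟨ solve 3 (λ a b c → a :* b :* c :≡ a :* c :* b) refl failures (2 ^ n) (2 ^ u) ⟩
      failures * 2 ^ u * 2 ^ n
        ≡⟨ cong (_* 2 ^ n) (bits-uniform (badness k n s)) ⟩
      2 ^ time * ΣB u (badness k n s ∘ toList) * 2 ^ n
        ≡⟨ *-assoc (2 ^ time) _ _ ⟩
      2 ^ time * (ΣB u (badness k n s ∘ toList) * 2 ^ n)
        ≤⟨ *-monoʳ-≤ (2 ^ time) (badness-rare k n s) ⟩
      2 ^ time * 2 ^ u ∎)
      where open ≤-Reasoning

    -- Markov's inequality for the badness, which is at least 1 whenever the run does not succeed.
    successes+failures : 2 ^ time ≤ successes + failures
    successes+failures = begin
      2 ^ time
        ≡⟨ trans (ΣB-const time 1) (*-identityʳ _) ⟨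
      ΣB time (λ _ → 1)
        ≤⟨ ΣB-mono time either ⟩
      ΣB time (λ r → indicator (does (succeeds? k 3≤k F s (algorithm k) r)) + badness k n s (bits r))
        ≡⟨ ΣB-+ time _ _ ⟩
      ΣB time (λ r → indicator (does (succeeds? k 3≤k F s (algorithm k) r))) + failures
        ≡⟨ cong (_+ failures) (length-filter-bitVectors time (succeeds? k 3≤k F s (algorithm k))) ⟨
      successes + failures ∎
      where
      open ≤-Reasoning
      either : ∀ r → 1 ≤ indicator (does (succeeds? k 3≤k F s (algorithm k) r)) + badness k n s (bits r)
      either r = indicator-or (succeeds? k 3≤k F s (algorithm k) r) (badness k n s (bits r)) (succeeds r)

-- Logarithms and the asymptotic statements.

n≤2^⌈log₂n⌉ : ∀ n → n ≤ 2 ^ ⌈log₂ n ⌉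
n≤2^⌈log₂n⌉ n = go n n ≤-refl
  where
  go : ∀ p n → n ≤ p → n ≤ 2 ^ ⌈log₂ n ⌉
  go p       zero          _   = z≤n
  go p       (suc zero)    _   = ≤-refl
  go (suc p) n@(suc (suc m)) n≤p = begin
    n                                       ≡⟨ ⌊n/2⌋+⌈n/2⌉≡n n ⟨
    ⌊ n /2⌋ + ⌈ n /2⌉                       ≤⟨ +-monoˡ-≤ ⌈ n /2⌉ (⌊n/2⌋≤⌈n/2⌉ n) ⟩
    ⌈ n /2⌉ + ⌈ n /2⌉                       ≡⟨ cong (⌈ n /2⌉ +_) (+-identityʳ ⌈ n /2⌉) ⟨
    2 * ⌈ n /2⌉                             ≤⟨ *-monoʳ-≤ 2 (go p ⌈ n /2⌉ (≤-trans (≤-pred (⌈n/2⌉<n m)) (≤-pred n≤p))) ⟩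
    2 * 2 ^ ⌈log₂ ⌈ n /2⌉ ⌉                 ≡⟨ cong (λ l → 2 * 2 ^ l) (⌈log₂⌈n/2⌉⌉≡⌈log₂n⌉∸1 n) ⟩
    2 ^ suc (⌈log₂ n ⌉ ∸ 1)                 ≡⟨ cong (2 ^_) (m+[n∸m]≡n {1} (⌈log₂⌉-mono-≤ {2} {n} (s≤s (s≤s z≤n)))) ⟩
    2 ^ ⌈log₂ n ⌉                           ∎
    where open ≤-Reasoning

1+n≤2^[1+⌈log₂n⌉] : ∀ n → suc n ≤ 2 ^ suc ⌈log₂ n ⌉
1+n≤2^[1+⌈log₂n⌉] n = ≤-trans (+-mono-≤ (>-nonZero⁻¹ _ {{m^n≢0 2 ⌈log₂ n ⌉}}) (n≤2^⌈log₂n⌉ n))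
  (≤-reflexive (cong (2 ^ ⌈log₂ n ⌉ +_) (sym (+-identityʳ _))))

module _ (k : ℕ) (3≤k : 3 ≤ k) where

  part₁ : ∀ (c : ℕ) (ε : ℚ) → 0ℚ <ℚ ε →
          ∃[ N ] ∀ n → N ≤ n →
          (F : CNF n) → F IsCNFOfWidth k → length F ≤ n ^ c →
          (s : ℕ) .{{_ : NonZero s}} → Satisfiable F → s ≤ length (Ω F) →
          ∃[ t ] Pr {t} (succeeds? k 3≤k F s (algorithm k)) ≥ℚ 1ℚ - ε
  -- The failure probability is at most 2 ^ -n. For n > d this is at most 1 / (d + 1), and hence at
  -- most ε = (p + 1) / (d + 1).
  part₁ c ε@(mkℚ +[1+ p ] d _) 0<ε = suc d , λ n d<n F F-width _ s _ s≤Ω → likely n d<n F F-width s s≤Ω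
    where
    likely : ∀ n → suc d ≤ n → (F : CNF n) → F IsCNFOfWidth k → (s : ℕ) .{{_ : NonZero s}} → s ≤ length (Ω F) →
             ∃[ t ] Pr {t} (succeeds? k 3≤k F s (algorithm k)) ≥ℚ 1ℚ - ε
    likely n d<n F F-width s s≤Ω = time , (begin
      1ℚ - ε                                  ≤⟨ ℚP.+-monoʳ-≤ 1ℚ (ℚP.neg-antimono-≤ ε≥) ⟩
      1ℚ - fraction 1 (suc d)                 ≡⟨ 1-fraction 1 (suc d) (s≤s z≤n) ⟩
      fraction d (suc d)                      ≤⟨ fraction-≤ d (suc d) σ (2 ^ time) {{it}} {{2^t≢0}} bound ⟩
      fraction σ (2 ^ time) {{2^t≢0}}         ∎)
      where
      open Run k 3≤k F F-width s (>-nonZero⁻¹ s)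
      open ℚP.≤-Reasoning
      n≢0 : NonZero n
      n≢0 = >-nonZero (≤-trans (s≤s z≤n) d<n)
      2^t≢0 : NonZero (2 ^ time)
      2^t≢0 = m^n≢0 2 time
      σ φ : ℕ
      σ = successes {{n≢0}} s≤Ω
      φ = failures {{n≢0}} s≤Ω
      ε≥ : fraction 1 (suc d) ℚ.≤ ε
      ε≥ = subst (fraction 1 (suc d) ℚ.≤_) (ℚP.↥p/↧p≡p ε) (fraction-≤ 1 (suc d) (suc p) (suc d) (*-monoˡ-≤ (suc d) (s≤s (z≤n {p}))))
      bound : d * 2 ^ time ≤ σ * suc d
      bound = +-cancelˡ-≤ (2 ^ time) _ _ (≤-trans (*-monoʳ-≤ (suc d) (successes+failures {{n≢0}} s≤Ω))
        (≤-trans (≤-reflexive (solve 3 (λ d s f → d :* (s :+ f) :≡ f :* d :+ s :* d) refl (suc d) σ φ))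
        (+-monoˡ-≤ (σ * suc d) (≤-trans (*-monoʳ-≤ φ (≤-trans d<n (≤-trans (n≤1+n n) (1+s≤2^s n)))) (failures-rare {{n≢0}} s≤Ω)))))
  part₁ c (mkℚ (pos 0) d _)      (ℚ.*<* (ℤ.+<+ ()))
  part₁ c (mkℚ ℤ.-[1+ p ] d _) (ℚ.*<* ())

  exponent K : ℕ
  -- The 7 is the power in `budget`.
  exponent = 7 + timeDegree k
  K = suc k + 2 ^ (k ∸ 1)

  -- Puts s into a power of two, whose fixed powers go into 2 ^ o(n), so that the polynomial factor
  -- depends on n alone; for small n nothing bounds s in terms of n.
  size-bound : ∀ c n s m → m ≤ n ^ c → n + (s + 2) + (m + K) ≤ 8 * K * (suc n ^ suc c * 2 ^ s)
  size-bound c n s m m≤ = begin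
    n + (s + 2) + (m + K)                          ≤⟨ +-mono-≤ (sum≤ n (s + 2) (≤-trans (s≤s z≤n) (m≤n+m 2 s))) (sum≤ m K (s≤s z≤n)) ⟩
    suc n * (s + 2) + suc m * K                    ≤⟨ +-mono-≤ (*-monoʳ-≤ (suc n) s+2≤) (*-monoˡ-≤ K m<) ⟩
    suc n * (2 * 2 ^ s) + 2 * suc n ^ c * K        ≤⟨ +-mono-≤ (m≤m*n P Q {{Q≢0}}) (m≤n*m Q P {{P≢0}}) ⟩
    P * Q + P * Q                                  ≡⟨ solve 4 (λ a b x y → a :* (con 2 :* b) :* (con 2 :* x :* y) :+ a :* (con 2 :* b) :* (con 2 :* x :* y) :≡ con 8 :* y :* (a :* x :* b)) refl (suc n) (2 ^ s) (suc n ^ c) K ⟩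
    8 * K * (suc n ^ suc c * 2 ^ s)                ∎
    where
    open ≤-Reasoning
    P Q : ℕ
    P = suc n * (2 * 2 ^ s)
    Q = 2 * suc n ^ c * K
    P≢0 : NonZero P
    P≢0 = m*n≢0 (suc n) _ {{it}} {{m^n≢0 2 (suc s)}}
    Q≢0 : NonZero Q
    Q≢0 = m*n≢0 _ K {{m*n≢0 2 (suc n ^ c) {{it}} {{m^n≢0 (suc n) c}}}}
    sum≤ : ∀ a b → 1 ≤ b → a + b ≤ suc a * b
    sum≤ a b 1≤b = ≤-trans (≤-reflexive (+-comm a b)) (+-monoʳ-≤ b (m≤m*n a b {{>-nonZero 1≤b}}))
    s+2≤ : s + 2 ≤ 2 * 2 ^ s
    s+2≤ = ≤-trans (≤-reflexive (+-comm s 2)) (1+s≤2^s (suc s))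
    m< : suc m ≤ 2 * suc n ^ c
    m< = ≤-trans (+-mono-≤ (>-nonZero⁻¹ (suc n ^ c) {{m^n≢0 (suc n) c}}) (≤-trans m≤ (^-monoˡ-≤ c (n≤1+n n))))
                 (≤-reflexive (cong (_+_ (suc n ^ c)) (sym (+-identityʳ _))))

  -- The exponent of two that collects suc n ^ s and the powers of 2 ^ s from `size-bound`.
  overheads : (ℕ → ℕ) → ℕ → ℕ
  overheads s n = s n * (suc ⌈log₂ n ⌉ + exponent)

  overheads-o : ∀ s → (λ n → s n * ⌈log₂ n ⌉) ∈o id → overheads s ∈o id
  overheads-o s s∈o q with s∈o (q * (2 + exponent))
  -- From n = 2 on the logarithm is at least 1, so the constant summands are at most a multiple of
  -- it.
  ... | N , small = N ⊔ 2 , λ n N≤n → begin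
    q * (s n * (suc ⌈log₂ n ⌉ + exponent))
      ≤⟨ *-monoʳ-≤ q (*-monoʳ-≤ (s n) (log-dominates n (≤-trans (m≤n⊔m N 2) N≤n))) ⟩
    q * (s n * ((2 + exponent) * ⌈log₂ n ⌉))
      ≡⟨ solve 4 (λ q s e l → q :* (s :* (e :* l)) :≡ q :* e :* (s :* l)) refl q (s n) (2 + exponent) ⌈log₂ n ⌉ ⟩
    q * (2 + exponent) * (s n * ⌈log₂ n ⌉)
      ≤⟨ small n (≤-trans (m≤m⊔n N 2) N≤n) ⟩
    n ∎
    where
    open ≤-Reasoning
    log-dominates : ∀ n → 2 ≤ n → suc ⌈log₂ n ⌉ + exponent ≤ (2 + exponent) * ⌈log₂ n ⌉
    log-dominates n 2≤n with ⌈log₂ n ⌉ | ⌈log₂⌉-mono-≤ 2≤n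
    ... | suc l | _ = ≤-trans (≤-reflexive (solve 2 (λ l e → con 2 :+ l :+ e :≡ (con 2 :+ e) :+ l) refl l exponent))
                        (≤-trans (+-monoʳ-≤ (2 + exponent) (m≤n*m l (2 + exponent))) (≤-reflexive (sym (*-suc (2 + exponent) l))))

  part₂ : ∀ (c : ℕ) (s : ℕ → ℕ) → (∀ n → 1 ≤ s n) → (λ n → s n * ⌈log₂ n ⌉) ∈o id →
          ∃[ C ] ∃[ d ] ∃[ g ] g ∈o id ×
          (∀ n (F : CNF n) → F IsCNFOfWidth k → length F ≤ n ^ c →
            ∃[ T ] T ^ k ≤ (C * suc n ^ d) ^ k * 2 ^ ((k ∸ 1) * n + k * g n)
                 × HaltsWithin (algorithm k) (encodeInput F (s n)) T)
  -- The factor 2 ^ (k - 1) in C pays for rounding n / k up: `blocks k n` * k may exceed n by k.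
  part₂ c s 1≤s s∈o = 2 ^ (k ∸ 1) * (8 * K) ^ exponent , suc c * exponent , overheads s , overheads-o s s∈o , bounded
    where
    bounded : ∀ n (F : CNF n) → F IsCNFOfWidth k → length F ≤ n ^ c →
      ∃[ T ] T ^ k ≤ (2 ^ (k ∸ 1) * (8 * K) ^ exponent * suc n ^ (suc c * exponent)) ^ k * 2 ^ ((k ∸ 1) * n + k * overheads s n)
           × HaltsWithin (algorithm k) (encodeInput F (s n)) T
    bounded n F F-width F≤ = time , bound , halts
      where
      open Run k 3≤k F F-width (s n) (1≤s n)
      open ≤-Reasoning
      E C₁ R G : ℕ
      E = (2 ^ (k ∸ 1)) ^ blocks k n
      C₁ = (8 * K) ^ exponent
      R = suc n ^ (suc c * exponent)
      G = overheads s n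
      Z^≤ : Z ^ exponent ≤ C₁ * (R * 2 ^ (s n * exponent))
      Z^≤ = begin
        Z ^ exponent
          ≤⟨ ^-monoˡ-≤ exponent (size-bound c n (s n) (length F) F≤) ⟩
        (8 * K * (suc n ^ suc c * 2 ^ s n)) ^ exponent
          ≡⟨ trans (^-distribʳ-* (8 * K) (suc n ^ suc c * 2 ^ s n) exponent) (cong (C₁ *_) (^-distribʳ-* (suc n ^ suc c) (2 ^ s n) exponent)) ⟩
        C₁ * ((suc n ^ suc c) ^ exponent * (2 ^ s n) ^ exponent)
          ≡⟨ cong (C₁ *_) (cong₂ _*_ (^-*-assoc (suc n) (suc c) exponent) (^-*-assoc 2 (s n) exponent)) ⟩
        C₁ * (R * 2 ^ (s n * exponent)) ∎
      T≤ : time ≤ E * (C₁ * R * 2 ^ G)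
      T≤ = begin
        time
          ≤⟨ time≤ ⟩
        (n + (s n + 2)) ^ 7 * E * suc n ^ s n * Z ^ timeDegree k
          ≤⟨ *-monoˡ-≤ (Z ^ timeDegree k) (*-monoˡ-≤ (suc n ^ s n) (*-monoˡ-≤ E (^-monoˡ-≤ 7 X≤Z))) ⟩
        Z ^ 7 * E * suc n ^ s n * Z ^ timeDegree k
          ≡⟨ trans (solve 4 (λ z e a y → z :* e :* a :* y :≡ e :* (a :* (z :* y))) refl (Z ^ 7) E (suc n ^ s n) (Z ^ timeDegree k)) (cong (λ z → E * (suc n ^ s n * z)) (sym (^-distribˡ-+-* Z 7 (timeDegree k)))) ⟩
        E * (suc n ^ s n * Z ^ exponent)
          ≤⟨ *-monoʳ-≤ E (*-mono-≤ (^-monoˡ-≤ (s n) (1+n≤2^[1+⌈log₂n⌉] n)) Z^≤) ⟩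
        E * ((2 ^ suc ⌈log₂ n ⌉) ^ s n * (C₁ * (R * 2 ^ (s n * exponent))))
          ≡⟨ cong (λ x → E * (x * (C₁ * (R * 2 ^ (s n * exponent))))) (trans (^-*-assoc 2 (suc ⌈log₂ n ⌉) (s n)) (cong (2 ^_) (*-comm (suc ⌈log₂ n ⌉) (s n)))) ⟩
        E * (2 ^ (s n * suc ⌈log₂ n ⌉) * (C₁ * (R * 2 ^ (s n * exponent))))
          ≡⟨ cong (E *_) (solve 4 (λ a c r b → a :* (c :* (r :* b)) :≡ c :* r :* (a :* b)) refl (2 ^ (s n * suc ⌈log₂ n ⌉)) C₁ R (2 ^ (s n * exponent))) ⟩
        E * (C₁ * R * (2 ^ (s n * suc ⌈log₂ n ⌉) * 2 ^ (s n * exponent)))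
          ≡⟨ cong (λ x → E * (C₁ * R * x)) (trans (sym (^-distribˡ-+-* 2 (s n * suc ⌈log₂ n ⌉) (s n * exponent))) (cong (2 ^_) (sym (*-distribˡ-+ (s n) (suc ⌈log₂ n ⌉) exponent)))) ⟩
        E * (C₁ * R * 2 ^ G) ∎
      E^k≤ : E ^ k ≤ 2 ^ ((k ∸ 1) * n) * (2 ^ (k ∸ 1)) ^ k
      E^k≤ = begin
        E ^ k                                         ≡⟨ ^-*-assoc (2 ^ (k ∸ 1)) (blocks k n) k ⟩
        (2 ^ (k ∸ 1)) ^ (blocks k n * k)              ≤⟨ ^-monoʳ-≤ (2 ^ (k ∸ 1)) {{m^n≢0 2 (k ∸ 1)}} (blocks*k≤ k n) ⟩
        (2 ^ (k ∸ 1)) ^ (n + k)                       ≡⟨ ^-distribˡ-+-* (2 ^ (k ∸ 1)) n k ⟩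
        (2 ^ (k ∸ 1)) ^ n * (2 ^ (k ∸ 1)) ^ k         ≡⟨ cong (_* (2 ^ (k ∸ 1)) ^ k) (^-*-assoc 2 (k ∸ 1) n) ⟩
        2 ^ ((k ∸ 1) * n) * (2 ^ (k ∸ 1)) ^ k         ∎
      bound : time ^ k ≤ (2 ^ (k ∸ 1) * C₁ * R) ^ k * 2 ^ ((k ∸ 1) * n + k * G)
      bound = begin
        time ^ k
          ≤⟨ ^-monoˡ-≤ k T≤ ⟩
        (E * (C₁ * R * 2 ^ G)) ^ k
          ≡⟨ trans (^-distribʳ-* E _ k) (cong (E ^ k *_) (^-distribʳ-* (C₁ * R) (2 ^ G) k)) ⟩
        E ^ k * ((C₁ * R) ^ k * (2 ^ G) ^ k)
          ≤⟨ *-monoˡ-≤ _ E^k≤ ⟩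
        2 ^ ((k ∸ 1) * n) * (2 ^ (k ∸ 1)) ^ k * ((C₁ * R) ^ k * (2 ^ G) ^ k)
          ≡⟨ solve 4 (λ a b x y → a :* b :* (x :* y) :≡ b :* x :* (a :* y)) refl (2 ^ ((k ∸ 1) * n)) ((2 ^ (k ∸ 1)) ^ k) ((C₁ * R) ^ k) ((2 ^ G) ^ k) ⟩
        (2 ^ (k ∸ 1)) ^ k * (C₁ * R) ^ k * (2 ^ ((k ∸ 1) * n) * (2 ^ G) ^ k)
          ≡⟨ cong₂ _*_ (trans (sym (^-distribʳ-* (2 ^ (k ∸ 1)) (C₁ * R) k)) (cong (_^ k) (sym (*-assoc (2 ^ (k ∸ 1)) C₁ R))))
                       (trans (cong (2 ^ ((k ∸ 1) * n) *_) (trans (^-*-assoc 2 G k) (cong (2 ^_) (*-comm G k)))) (sym (^-distribˡ-+-* 2 ((k ∸ 1) * n) (k * G)))) ⟩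
        (2 ^ (k ∸ 1) * C₁ * R) ^ k * 2 ^ ((k ∸ 1) * n + k * G) ∎

theorem46 : ∀ k (3≤k : 3 ≤ k) → ∃[ A ]
    ( (∀ (c : ℕ) (ε : ℚ) → 0ℚ <ℚ ε →
    ∃[ N ] ∀ n → N ≤ n →
    (F : CNF n) → F IsCNFOfWidth k → length F ≤ n ^ c →
    (s : ℕ) .{{_ : NonZero s}} → Satisfiable F → s ≤ length (Ω F) →
    ∃[ t ] Pr {t} (succeeds? k 3≤k F s A) ≥ℚ 1ℚ - ε)
    × (∀ (c : ℕ) (s : ℕ → ℕ) → (∀ n → 1 ≤ s n) → (λ n → s n * ⌈log₂ n ⌉) ∈o id →
    ∃[ C ] ∃[ d ] ∃[ g ] g ∈o id ×
    (∀ n (F : CNF n) → F IsCNFOfWidth k → length F ≤ n ^ c →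
    ∃[ T ] T ^ k ≤ (C * suc n ^ d) ^ k * 2 ^ ((k ∸ 1) * n + k * g n)
    × HaltsWithin A (encodeInput F (s n)) T)))
theorem46 k 3≤k = algorithm k , part₁ k 3≤k , part₂ k 3≤k
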